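{- Let $n$ and $k$ be integers with $n\ge 2k+1$ and $k\ge 4$. Then $ex_{\mathcal{P}}(n,C_k\cup C_k^+)=ex_{\mathcal{P}}(n,2C_k)$.
   Context: All graphs are finite and simple. $C_k$ denotes the cycle on $k$ vertices, $C_k^+$ the graph obtained from $C_k$ by adding exactly one pendant edge (joining a new vertex) to a vertex of degree two, $2C_k$ the disjoint union of two copies of $C_k$, and $C_k\cup C_k^+$ the disjoint union of $C_k$ and $C_k^+$. For a graph $H$, $ex_{\mathcal{P}}(n,H)$ is the maximum number of edges in a planar graph on $n$ vertices that does not contain $H$ as a subgraph. -}

module Defs where

open import Data.Bool using (Bool; true; false; _∧_; _∨_; not; if_then_else_)
open import Data.Nat as ℕ using (ℕ; zero; suc; _∸_; _<ᵇ_; _≡ᵇ_)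
open import Data.Fin as Fin using (Fin; toℕ; inject₁; fromℕ; splitAt)
open import Data.Fin.Properties using (_≟_)
open import Data.List using (List; map; allFin)
open import Data.Nat.ListAction using (sum)
open import Data.Product using (Σ; ∃; ∃-syntax; _×_; _,_)
open import Data.Sum using (_⊎_; inj₁; inj₂)
open import Data.Rational as ℚ using (ℚ; 0ℚ; 1ℚ)
open import Relation.Nullary using (¬_)
open import Relation.Nullary.Decidable using (⌊_⌋)
open import Relation.Binary.PropositionalEquality using (_≡_; _≢_)
open import Function.Definitions using (Injective)

-- Finite simple graphs on vertex set Fin n.
-- A graph is given by an arbitrary Boolean relation `rel`; its edge
-- relation is the symmetric, irreflexive closure `Adj` (so every value
-- of the record is a simple graph, and every simple graph arises).

record Graph (n : ℕ) : Set where
  field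
    rel : Fin n → Fin n → Bool

open Graph public

Adj : ∀ {n} → Graph n → Fin n → Fin n → Bool
Adj G i j = not ⌊ i ≟ j ⌋ ∧ (rel G i j ∨ rel G j i)

edges : ∀ {n} → Graph n → ℕ
edges {n} G = sum (map (λ i → sum (map (λ j →
  if (Adj G i j ∧ (toℕ i <ᵇ toℕ j)) then 1 else 0) (allFin n))) (allFin n))

_⊆_ : ∀ {m n} → Graph m → Graph n → Set
_⊆_ {m} {n} H G = Σ (Fin m → Fin n) λ f → Injective _≡_ _≡_ f ×
  (∀ i j → Adj H i j ≡ true → Adj G (f i) (f j) ≡ true)

cycRel : ℕ → ℕ → ℕ → Bool
cycRel k a b = (suc a ≡ᵇ b) ∨ ((a ≡ᵇ (k ∸ 1)) ∧ (b ≡ᵇ 0))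

C : (k : ℕ) → Graph k
C k = record { rel = λ i j → cycRel k (toℕ i) (toℕ j) }

C⁺ : (k : ℕ) → Graph (suc k)
C⁺ k = record { rel = λ i j →
  ((toℕ i <ᵇ k) ∧ (toℕ j <ᵇ k) ∧ cycRel k (toℕ i) (toℕ j))
  ∨ ((toℕ i ≡ᵇ k) ∧ (toℕ j ≡ᵇ 0)) }

_⊕_ : ∀ {m n} → Graph m → Graph n → Graph (m ℕ.+ n)
_⊕_ {m} G H = record { rel = λ i j → go (splitAt m i) (splitAt m j) }
  where
  go : _ → _ → Bool
  go (inj₁ a) (inj₁ b) = rel G a b
  go (inj₂ a) (inj₂ b) = rel H a b
  go _ _ = false

-- Planarity via plane drawings with polygonal arcs (Diestel, Ch. 4;
-- Mohar–Thomassen), with coordinates in ℚ².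

Pt : Set
Pt = ℚ × ℚ

OnSeg : Pt → Pt → Pt → Set
OnSeg (qx , qy) (ax , ay) (bx , by) = Σ ℚ λ t →
  (0ℚ ℚ.≤ t) × (t ℚ.≤ 1ℚ) ×
  (qx ≡ ax ℚ.+ t ℚ.* (bx ℚ.- ax)) × (qy ≡ ay ℚ.+ t ℚ.* (by ℚ.- ay))

-- A polygonal arc: points pt 0, …, pt (m+1) joined by segments
-- seg i = [pt i, pt (i+1)], i = 0..m, forming a simple curve.
record Arc : Set where
  field
    bends : ℕ
    pt    : Fin (suc (suc bends)) → Pt
    nondeg : ∀ (i : Fin (suc bends)) → pt (inject₁ i) ≢ pt (Fin.suc i)
    consec : ∀ (i j : Fin (suc bends)) → toℕ j ≡ suc (toℕ i) → ∀ q →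
             OnSeg q (pt (inject₁ i)) (pt (Fin.suc i)) →
             OnSeg q (pt (inject₁ j)) (pt (Fin.suc j)) → q ≡ pt (Fin.suc i)
    apart  : ∀ (i j : Fin (suc bends)) → suc (toℕ i) ℕ.< toℕ j → ∀ q →
             ¬ (OnSeg q (pt (inject₁ i)) (pt (Fin.suc i)) ×
                OnSeg q (pt (inject₁ j)) (pt (Fin.suc j)))

open Arc public

start end : Arc → Pt
start A = pt A Fin.zero
end A = pt A (fromℕ (suc (bends A)))

OnArc : Pt → Arc → Set
OnArc q A = ∃[ i ] OnSeg q (pt A (inject₁ i)) (pt A (Fin.suc i))

Edge : ∀ {n} → Graph n → Set
Edge {n} G = Σ (Fin n) λ u → Σ (Fin n) λ v →
  (toℕ u ℕ.< toℕ v) × (Adj G u v ≡ true)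

eu ev : ∀ {n} (G : Graph n) → Edge G → Fin n
eu G (u , _) = u
ev G (_ , v , _) = v

record Drawing {n} (G : Graph n) : Set where
  field
    pos    : Fin n → Pt
    pos-inj : Injective _≡_ _≡_ pos
    arc    : Edge G → Arc
    arc-start : ∀ e → start (arc e) ≡ pos (eu G e)
    arc-end   : ∀ e → end (arc e) ≡ pos (ev G e)
    avoid  : ∀ e w → w ≢ eu G e → w ≢ ev G e → ¬ OnArc (pos w) (arc e)
    cross  : ∀ e f → (eu G e , ev G e) ≢ (eu G f , ev G f) → ∀ q →
             OnArc q (arc e) → OnArc q (arc f) →
             ∃[ w ] (q ≡ pos w) × (w ≡ eu G e ⊎ w ≡ ev G e) × (w ≡ eu G f ⊎ w ≡ ev G f)

Planar : ∀ {n} → Graph n → Set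
Planar G = Drawing G

IsExP : ∀ {h} → (n : ℕ) → Graph h → ℕ → Set
IsExP n H m =
  (Σ (Graph n) λ G → Planar G × ¬ (H ⊆ G) × edges G ≡ m) ×
  (∀ (G : Graph n) → Planar G → ¬ (H ⊆ G) → edges G ℕ.≤ m)

{-# OPTIONS --safe #-}
-- Let G be planar without C_k ∪ C_k⁺ and suppose it contains two disjoint k-cycles. No edge leaves
-- their union, since it would be pendant at one of them. If every other k-cycle meets these two,
-- delete the edges at their 2k vertices, at most 6k - 6 by the planar bound, choose a vertex x
-- outside, and glue to x a triangulation on x and 2k - 2 of the vertices and a triangle on x and
-- the other two; this restores 6k - 6 edges. If there is a third disjoint k-cycle, then every
-- k-cycle spans a component; two of them are replaced by a triangulation on 2k - 1 vertices, and
-- each further one, in turn, by a triangulation on k - 2 of its vertices and a fixed vertex x and a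
-- triangle at x. As x is a cut vertex, in both cases all k-cycles of the new graph lie in a set of
-- 2k - 1 vertices, so no two of them are disjoint.
--
-- The bound 3n - 6 needs no Jordan curve theorem. For disjoint polygonal arcs, the parities of the
-- crossings of each arc with the vertical rays from the ends of the other sum to a quantity that
-- depends only on the order of the abscissae of the ends. This identity is inherited by
-- contractions and, summed over independent pairs of edges, fails for K₅ and K₃,₃. In a minimal
-- graph with more than 3n - 6 edges every edge lies in three triangles, so the neighbourhood of a
-- vertex of degree at most 5 yields K₅ or K₃,₃. The triangulations K₂ + P_m are glued into a thin
-- triangle with apex x that meets the old drawing nowhere else.
module Submission where

open import Defs
open import Data.Bool using (Bool; true; false; _∧_; _∨_; _xor_; not; if_then_else_)
open import Data.Empty using (⊥; ⊥-elim)
open import Data.Fin as Fin using (Fin; toℕ; inject₁; fromℕ; fromℕ<; punchIn; splitAt; _↑ˡ_; _↑ʳ_)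
open import Data.Fin.Patterns using (0F; 1F; 2F; 3F; 4F; 5F)
open import Data.Nat as ℕ using (ℕ; zero; suc)
open import Data.Product using (Σ; ∃; ∃₂; _×_; _,_; proj₁; proj₂)
open import Data.Sum using (_⊎_; inj₁; inj₂; [_,_])
open import Data.Unit using (tt)
open import Function.Base using (_∘_; id)
open import Function.Definitions using (Injective)
open import Relation.Binary.Definitions using (tri<; tri≈; tri>)
open import Relation.Binary.PropositionalEquality
  using (_≡_; _≢_; refl; sym; trans; cong; cong₂; subst; subst₂; module ≡-Reasoning)
open import Relation.Nullary using (¬_; Dec; yes; no; does; contradiction)

-- The exchange is an exact balance. A triangulation on 2k - 1 vertices has 6k - 9 edges, three
-- fewer than the bound 6k - 6 for the 2k vertices that lose theirs; the triangle at x supplies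
-- these three, so x has to lie outside both cycles, and this is where n ≥ 2k + 1 enters. For a
-- single component the balance reads 3k - 6 = (3k - 9) + 3. The added triangles carry no k-cycle
-- because k ≥ 4. Planarity is given by polygonal arcs alone: a drawing comes with no faces and
-- cannot be contracted directly. Hence for the upper bound it is replaced at once by a parity
-- identity, from which contraction becomes algebra; contracting an edge in at most two triangles
-- costs at most three edges, which is the drop of 3n - 6. For the new drawings no face is at hand
-- to receive the new edges, so they go into a region that touches the old drawing in one point.
-- This is why everything is glued at a single vertex.

module RationalOrder where

  open import Data.Rational
  open import Data.Rational.Properties
  open import Level using (0ℓ)
  open import Relation.Nullary.Decidable using (dec⇒maybe)
  import Tactic.RingSolver as RS
  import Tactic.RingSolver.Core.AlmostCommutativeRing as ACR

  ℚring : ACR.AlmostCommutativeRing 0ℓ 0ℓ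
  ℚring = ACR.fromCommutativeRing +-*-commutativeRing (λ x → dec⇒maybe (0ℚ ≟ x))

  private variable p q r s : ℚ

  <⇒0<- : p < q → 0ℚ < q - p
  <⇒0<- {p} {q} p<q = subst (_< q - p) (+-inverseʳ p) (+-monoˡ-< (- p) p<q)

  0<-⇒< : 0ℚ < q - p → p < q
  0<-⇒< {q} {p} h = subst₂ _<_ (+-identityˡ p) (lemma q p) (+-monoˡ-< p h)
    where
    lemma : ∀ q p → q - p + p ≡ q
    lemma = RS.solve-∀ ℚring

  ≤⇒0≤- : p ≤ q → 0ℚ ≤ q - p
  ≤⇒0≤- {p} {q} p≤q = subst (_≤ q - p) (+-inverseʳ p) (+-monoˡ-≤ (- p) p≤q)

  0≤-⇒≤ : 0ℚ ≤ q - p → p ≤ q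
  0≤-⇒≤ {q} {p} h = subst₂ _≤_ (+-identityˡ p) (lemma q p) (+-monoˡ-≤ p h)
    where
    lemma : ∀ q p → q - p + p ≡ q
    lemma = RS.solve-∀ ℚring

  0<*0< : 0ℚ < p → 0ℚ < q → 0ℚ < p * q
  0<*0< {p} {q} 0<p 0<q =
    positive⁻¹ _ {{pos*pos⇒pos p {{positive 0<p}} q {{positive 0<q}}}}

  0≤*0≤ : 0ℚ ≤ p → 0ℚ ≤ q → 0ℚ ≤ p * q
  0≤*0≤ {p} {q} 0≤p 0≤q =
    nonNegative⁻¹ _ {{nonNeg*nonNeg⇒nonNeg p {{nonNegative 0≤p}} q {{nonNegative 0≤q}}}}

  0≤+0≤ : 0ℚ ≤ p → 0ℚ ≤ q → 0ℚ ≤ p + q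
  0≤+0≤ = +-mono-≤

  0<+0≤ : 0ℚ < p → 0ℚ ≤ q → 0ℚ < p + q
  0<+0≤ = +-mono-<-≤

  0≤+0< : 0ℚ ≤ p → 0ℚ < q → 0ℚ < p + q
  0≤+0< = +-mono-≤-<

  0<+0< : 0ℚ < p → 0ℚ < q → 0ℚ < p + q
  0<+0< = +-mono-<

  <0⇒0<- : p < 0ℚ → 0ℚ < - p
  <0⇒0<- = neg-antimono-<

  0<⇒≢0 : 0ℚ < p → p ≢ 0ℚ
  0<⇒≢0 0<p refl = <-irrefl refl 0<p

  0<⇒¬≤0 : 0ℚ < p → ¬ p ≤ 0ℚ
  0<⇒¬≤0 0<p p≤0 = <-irrefl refl (<-≤-trans 0<p p≤0)

  0<*-cancel : 0ℚ < p → 0ℚ < q * p → 0ℚ < q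
  0<*-cancel {p} {q} 0<p h =
    *-cancelʳ-<-nonNeg p {{nonNegative (<⇒≤ 0<p)}} (subst (_< q * p) (sym (*-zeroˡ p)) h)

  0≤*-cancel : 0ℚ < p → 0ℚ ≤ q * p → 0ℚ ≤ q
  0≤*-cancel {p} {q} 0<p h =
    *-cancelʳ-≤-pos p {{positive 0<p}} (subst (_≤ q * p) (sym (*-zeroˡ p)) h)

  quotient : ∀ p → 0ℚ < q → Σ ℚ λ t → t * q ≡ p
  quotient {q} p 0<q = p * 1/ q , (begin
    p * 1/ q * q   ≡⟨ *-assoc p (1/ q) q ⟩
    p * (1/ q * q) ≡⟨ cong (p *_) (*-inverseˡ q) ⟩
    p * 1ℚ         ≡⟨ *-identityʳ p ⟩
    p              ∎)
    where
    open ≡-Reasoning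
    instance
      q≢0 : NonZero q
      q≢0 = pos⇒nonZero q {{positive 0<q}}

  *-cancel-0< : 0ℚ < r → p * r ≡ q * r → p ≡ q
  *-cancel-0< {r} {p} {q} 0<r eq =
    ≤-antisym (*-cancelʳ-≤-pos r {{positive 0<r}} (≤-reflexive eq))
              (*-cancelʳ-≤-pos r {{positive 0<r}} (≤-reflexive (sym eq)))

  unitQuotient : 0ℚ ≤ p → p ≤ q → 0ℚ < q → Σ ℚ λ t → 0ℚ ≤ t × t ≤ 1ℚ × t * q ≡ p
  unitQuotient {p} {q} 0≤p p≤q 0<q with quotient p 0<q
  ... | t , eq = t , 0≤*-cancel 0<q (subst (0ℚ ≤_) (sym eq) 0≤p)
                   , *-cancelʳ-≤-pos q {{positive 0<q}} (subst₂ _≤_ (sym eq) (sym (*-identityˡ q)) p≤q)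
                   , eq

  x-y≡0⇒x≡y : p - q ≡ 0ℚ → p ≡ q
  x-y≡0⇒x≡y {p} {q} eq = begin
    p           ≡⟨ lemma p q ⟩
    p - q + q   ≡⟨ cong (_+ q) eq ⟩
    0ℚ + q      ≡⟨ +-identityˡ q ⟩
    q           ∎
    where
    open ≡-Reasoning
    lemma : ∀ p q → p ≡ p - q + q
    lemma = RS.solve-∀ ℚring

-- Disjoint segments and the vertical rays from their ends.

module Segments where

  open RationalOrder
  open import Data.Rational
  open import Data.Rational.Properties
  open import Data.Bool.Properties using (xor-comm)
  open import Relation.Nullary.Decidable using (_×-dec_; _⊎-dec_; dec-true; dec-false)
  import Tactic.RingSolver as RS

  OnSeg-sym : ∀ {q a b} → OnSeg q a b → OnSeg q b a
  OnSeg-sym {qx , qy} {ax , ay} {bx , by} (t , 0≤t , t≤1 , refl , refl) =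
    1ℚ - t , ≤⇒0≤- t≤1 , 0≤-⇒≤ (subst (0ℚ ≤_) (flip t) 0≤t) , reverse ax bx t , reverse ay by t
    where
    flip : ∀ t → t ≡ 1ℚ - (1ℚ - t)
    flip = RS.solve-∀ ℚring
    reverse : ∀ a b t → a + t * (b - a) ≡ b + (1ℚ - t) * (a - b)
    reverse = RS.solve-∀ ℚring

  OnSeg-start : ∀ a b → OnSeg a a b
  OnSeg-start (ax , ay) (bx , by) =
    0ℚ , ≤-refl , <⇒≤ (positive⁻¹ 1ℚ) , zeroth ax bx , zeroth ay by
    where
    zeroth : ∀ a b → a ≡ a + 0ℚ * (b - a)
    zeroth = RS.solve-∀ ℚring

  OnSeg-end : ∀ a b → OnSeg b a b
  OnSeg-end a b = OnSeg-sym {b} {b} {a} (OnSeg-start b a)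

  -- Twice the signed area of the triangle a b c.
  area : Pt → Pt → Pt → ℚ
  area (ax , ay) (bx , by) (cx , cy) = (bx - ax) * (cy - ay) - (by - ay) * (cx - ax)

  Disjoint : Pt → Pt → Pt → Pt → Set
  Disjoint a b c d = ∀ q → OnSeg q a b → ¬ OnSeg q c d

  -- Cramer's rule: the lines meet at parameter `area c d a` / Δ on ab and - `area a b c` / Δ on cd.
  -- Since Δ is also `area c d a - area c d b`, the sign conditions put both parameters into the
  -- unit interval.
  crossingPoint : ∀ a b c d → area a b c ≤ 0ℚ → 0ℚ ≤ area a b d →
    0ℚ ≤ area c d a → area c d b ≤ 0ℚ → 0ℚ < area a b d - area a b c →
    ¬ Disjoint a b c d
  crossingPoint a@(ax , ay) b@(bx , by) c@(cx , cy) d@(dx , dy) abc≤0 0≤abd 0≤cda cdb≤0 0<Δ disj =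
    common (unitQuotient 0≤cda cda≤Δ 0<Δ) (unitQuotient 0≤-abc -abc≤Δ 0<Δ)
    where
    open ≡-Reasoning
    Δ = area a b d - area a b c
    cda≤Δ : area c d a ≤ Δ
    cda≤Δ = 0≤-⇒≤ (subst (0ℚ ≤_) (eq ax ay bx by cx cy dx dy) (neg-antimono-≤ cdb≤0))
      where
      eq : ∀ ax ay bx by cx cy dx dy →
        - ((dx - cx) * (by - cy) - (dy - cy) * (bx - cx)) ≡
        ((bx - ax) * (dy - ay) - (by - ay) * (dx - ax) - ((bx - ax) * (cy - ay) - (by - ay) * (cx - ax)))
        - ((dx - cx) * (ay - cy) - (dy - cy) * (ax - cx))
      eq = RS.solve-∀ ℚring
    0≤-abc : 0ℚ ≤ - area a b c
    0≤-abc = neg-antimono-≤ abc≤0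
    -abc≤Δ : - area a b c ≤ Δ
    -abc≤Δ = 0≤-⇒≤ (subst (0ℚ ≤_) (eq (area a b d) (area a b c)) 0≤abd)
      where
      eq : ∀ u v → u ≡ u - v - (- v)
      eq = RS.solve-∀ ℚring
    split : ∀ a t e Δ → (a + t * e) * Δ ≡ a * Δ + t * Δ * e
    split = RS.solve-∀ ℚring
    xeq : ∀ ax ay bx by cx cy dx dy →
      ax * ((bx - ax) * (dy - ay) - (by - ay) * (dx - ax) - ((bx - ax) * (cy - ay) - (by - ay) * (cx - ax)))
      + ((dx - cx) * (ay - cy) - (dy - cy) * (ax - cx)) * (bx - ax) ≡
      cx * ((bx - ax) * (dy - ay) - (by - ay) * (dx - ax) - ((bx - ax) * (cy - ay) - (by - ay) * (cx - ax)))
      + (- ((bx - ax) * (cy - ay) - (by - ay) * (cx - ax))) * (dx - cx)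
    xeq = RS.solve-∀ ℚring
    yeq : ∀ ax ay bx by cx cy dx dy →
      ay * ((bx - ax) * (dy - ay) - (by - ay) * (dx - ax) - ((bx - ax) * (cy - ay) - (by - ay) * (cx - ax)))
      + ((dx - cx) * (ay - cy) - (dy - cy) * (ax - cx)) * (by - ay) ≡
      cy * ((bx - ax) * (dy - ay) - (by - ay) * (dx - ax) - ((bx - ax) * (cy - ay) - (by - ay) * (cx - ax)))
      + (- ((bx - ax) * (cy - ay) - (by - ay) * (cx - ax))) * (dy - cy)
    yeq = RS.solve-∀ ℚring
    coordinate : ∀ {t s Δ cda -abc a b c d} → 0ℚ < Δ → t * Δ ≡ cda → s * Δ ≡ -abc →
      a * Δ + cda * (b - a) ≡ c * Δ + -abc * (d - c) →
      a + t * (b - a) ≡ c + s * (d - c)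
    coordinate {t} {s} {Δ} {_} {_} {a} {b} {c} {d} 0<Δ refl refl eq =
      *-cancel-0< 0<Δ (trans (split a t (b - a) Δ) (trans eq (sym (split c s (d - c) Δ))))
    common : Σ ℚ (λ t → 0ℚ ≤ t × t ≤ 1ℚ × t * Δ ≡ area c d a) →
             Σ ℚ (λ s → 0ℚ ≤ s × s ≤ 1ℚ × s * Δ ≡ - area a b c) → ⊥
    common (t , 0≤t , t≤1 , teq) (s , 0≤s , s≤1 , seq) =
      disj (ax + t * (bx - ax) , ay + t * (by - ay)) (t , 0≤t , t≤1 , refl , refl)
        (s , 0≤s , s≤1
           , coordinate {t} {s} {a = ax} {bx} {cx} {dx} 0<Δ teq seq (xeq ax ay bx by cx cy dx dy)
           , coordinate {t} {s} {a = ay} {by} {cy} {dy} 0<Δ teq seq (yeq ax ay bx by cx cy dx dy))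

  -- The order of the abscissae after an infinitesimal shear.
  Lex : Pt → Pt → Set
  Lex (ax , ay) (bx , by) = ax < bx ⊎ (ax ≡ bx × ay < by)

  lex? : ∀ a b → Dec (Lex a b)
  lex? (ax , ay) (bx , by) = (ax <? bx) ⊎-dec ((ax ≟ bx) ×-dec (ay <? by))

  Lex-trans : ∀ {a b c} → Lex a b → Lex b c → Lex a c
  Lex-trans (inj₁ p) (inj₁ q) = inj₁ (<-trans p q)
  Lex-trans (inj₁ p) (inj₂ (refl , _)) = inj₁ p
  Lex-trans (inj₂ (refl , _)) (inj₁ q) = inj₁ q
  Lex-trans (inj₂ (refl , p)) (inj₂ (refl , q)) = inj₂ (refl , <-trans p q)

  Lex-irrefl : ∀ {a} → ¬ Lex a a
  Lex-irrefl (inj₁ p) = <-irrefl refl p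
  Lex-irrefl (inj₂ (_ , p)) = <-irrefl refl p

  Lex⇒≤ : ∀ {a b} → Lex a b → proj₁ a ≤ proj₁ b
  Lex⇒≤ (inj₁ p) = <⇒≤ p
  Lex⇒≤ (inj₂ (refl , _)) = ≤-refl

  Lex-total : ∀ {a b} → a ≢ b → Lex a b ⊎ Lex b a
  Lex-total {ax , ay} {bx , by} a≢b with <-cmp ax bx | <-cmp ay by
  ... | tri< p _ _ | _ = inj₁ (inj₁ p)
  ... | tri> _ _ p | _ = inj₂ (inj₁ p)
  ... | tri≈ _ refl _ | tri< p _ _ = inj₁ (inj₂ (refl , p))
  ... | tri≈ _ refl _ | tri> _ _ p = inj₂ (inj₂ (refl , p))
  ... | tri≈ _ refl _ | tri≈ _ refl _ = ⊥-elim (a≢b refl)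

  collinear⇒OnSeg : ∀ {a b c} → area a b c ≡ 0ℚ → Lex a c → Lex c b → OnSeg c a b
  collinear⇒OnSeg {ax , ay} {bx , by} {cx , cy} abc≡0 ac cb = helper (<-cmp ax bx) ac cb
    where
    ax≤cx : ax ≤ cx
    ax≤cx = Lex⇒≤ {ax , ay} {cx , cy} ac
    cx≤bx : cx ≤ bx
    cx≤bx = Lex⇒≤ {cx , cy} {bx , by} cb
    split : ∀ a c → c ≡ a + (c - a)
    split = RS.solve-∀ ℚring
    const : ∀ a t → a ≡ a + t * (a - a)
    const = RS.solve-∀ ℚring
    eq₁ : ∀ ax ay bx by cx cy → cy * (bx - ax) ≡
      (bx - ax) * (cy - ay) - (by - ay) * (cx - ax) + (ay * (bx - ax) + (cx - ax) * (by - ay))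
    eq₁ = RS.solve-∀ ℚring
    eq₂ : ∀ ay d e t → 0ℚ + (ay * d + t * d * e) ≡ (ay + t * e) * d
    eq₂ = RS.solve-∀ ℚring
    skew : ax < bx → Σ ℚ (λ t → 0ℚ ≤ t × t ≤ 1ℚ × t * (bx - ax) ≡ cx - ax) → OnSeg (cx , cy) (ax , ay) (bx , by)
    skew ax<bx (t , 0≤t , t≤1 , teq) = t , 0≤t , t≤1 , trans (split ax cx) (cong (ax +_) (sym teq)) ,
      *-cancel-0< (<⇒0<- ax<bx)
        (trans (eq₁ ax ay bx by cx cy)
          (trans (cong₂ (λ u v → u + (ay * (bx - ax) + v * (by - ay))) abc≡0 (sym teq))
            (eq₂ ay (bx - ax) (by - ay) t)))
    vertical : ax ≡ cx → ax ≡ bx → Σ ℚ (λ t → 0ℚ ≤ t × t ≤ 1ℚ × t * (by - ay) ≡ cy - ay) → OnSeg (cx , cy) (ax , ay) (bx , by)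
    vertical refl refl (t , 0≤t , t≤1 , teq) =
      t , 0≤t , t≤1 , const ax t , trans (split ay cy) (cong (ay +_) (sym teq))
    helper : _ → Lex (ax , ay) (cx , cy) → Lex (cx , cy) (bx , by) → OnSeg (cx , cy) (ax , ay) (bx , by)
    helper (tri> _ _ bx<ax) _ _ = ⊥-elim (<-irrefl refl (<-≤-trans bx<ax (≤-trans ax≤cx cx≤bx)))
    helper (tri< ax<bx _ _) _ _ =
      skew ax<bx (unitQuotient (≤⇒0≤- ax≤cx) (+-monoˡ-≤ (- ax) cx≤bx) (<⇒0<- ax<bx))
    helper (tri≈ _ ax≡bx _) (inj₁ ax<cx) _ =
      ⊥-elim (<-irrefl ax≡bx (<-≤-trans ax<cx cx≤bx))
    helper (tri≈ _ ax≡bx _) _ (inj₁ cx<bx) =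
      ⊥-elim (<-irrefl ax≡bx (≤-<-trans ax≤cx cx<bx))
    helper (tri≈ _ ax≡bx _) (inj₂ (ax≡cx , ay<cy)) (inj₂ (_ , cy<by)) =
      vertical ax≡cx ax≡bx (unitQuotient (<⇒≤ (<⇒0<- ay<cy)) (+-monoˡ-≤ (- ay) (<⇒≤ cy<by)) (<⇒0<- (<-trans ay<cy cy<by)))

  Disjoint-reverse : ∀ {a b c d} → Disjoint a b c d → Disjoint a b d c
  Disjoint-reverse {a} {b} {c} {d} disj q ab dc = disj q ab (OnSeg-sym {q} {d} {c} dc)

  Disjoint-swap : ∀ {a b c d} → Disjoint a b c d → Disjoint c d a b
  Disjoint-swap disj q cd ab = disj q ab cd

  reflect : Pt → Pt
  reflect (x , y) = x , - y

  Disjoint-reflect : ∀ {a b c d} → Disjoint a b c d → Disjoint (reflect a) (reflect b) (reflect c) (reflect d)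
  Disjoint-reflect {a} {b} {c} {d} disj q ab cd = disj (reflect q) (unreflect q a b ab) (unreflect q c d cd)
    where
    eq : ∀ a b t → - (- a + t * (- b - - a)) ≡ a + t * (b - a)
    eq = RS.solve-∀ ℚring
    unreflect : ∀ q a b → OnSeg q (reflect a) (reflect b) → OnSeg (reflect q) a b
    unreflect (qx , qy) (ax , ay) (bx , by) (t , 0≤t , t≤1 , xeq , yeq) =
      t , 0≤t , t≤1 , xeq , trans (cong -_ yeq) (eq ay by t)

  area-reflect : ∀ a b c → area (reflect a) (reflect b) (reflect c) ≡ - area a b c
  area-reflect (ax , ay) (bx , by) (cx , cy) = eq ax ay bx by cx cy
    where
    eq : ∀ ax ay bx by cx cy →
      (bx - ax) * (- cy - - ay) - (- by - - ay) * (cx - ax) ≡ - ((bx - ax) * (cy - ay) - (by - ay) * (cx - ax))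
    eq = RS.solve-∀ ℚring

  -- For p to the left of q, `area p q r < 0` means that r lies below pq. So cd is the lower segment
  -- at the abscissa of c and the higher one at that of b, and the two cross in between.
  interleaved⁻ : ∀ a b c d → proj₁ a ≤ proj₁ c → proj₁ c ≤ proj₁ b → proj₁ b ≤ proj₁ d →
    area a b c < 0ℚ → area c d b < 0ℚ → ¬ Disjoint a b c d
  interleaved⁻ a@(ax , ay) b@(bx , by) c@(cx , cy) d@(dx , dy) ax≤cx cx≤bx bx≤dx abc<0 cdb<0 disj =
    helper (cx <? bx) (ax <? cx)
    where
    cda-eq : ∀ ax ay bx by cx cy dx dy →
      (cx - ax) * (- ((dx - cx) * (by - cy) - (dy - cy) * (bx - cx))) +
      (dx - cx) * (- ((bx - ax) * (cy - ay) - (by - ay) * (cx - ax)))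
      ≡ ((dx - cx) * (ay - cy) - (dy - cy) * (ax - cx)) * (bx - cx)
    cda-eq = RS.solve-∀ ℚring
    abd-eq : ∀ ax ay bx by cx cy dx dy →
      (dx - bx) * (- ((bx - ax) * (cy - ay) - (by - ay) * (cx - ax))) +
      (bx - ax) * (- ((dx - cx) * (by - cy) - (dy - cy) * (bx - cx)))
      ≡ ((bx - ax) * (dy - ay) - (by - ay) * (dx - ax)) * (bx - cx)
    abd-eq = RS.solve-∀ ℚring
    vertical : ∀ x ay by cy → (x - x) * (cy - ay) - (by - ay) * (x - x) ≡ 0ℚ
    vertical = RS.solve-∀ ℚring
    collapse : ∀ z x → z * (x - x) ≡ 0ℚ
    collapse = RS.solve-∀ ℚring
    0<-abc = <0⇒0<- abc<0
    0<-cdb = <0⇒0<- cdb<0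
    cx≤dx = ≤-trans cx≤bx bx≤dx
    helper : Dec (cx < bx) → Dec (ax < cx) → ⊥
    helper (yes cx<bx) _ = crossingPoint a b c d (<⇒≤ abc<0) 0≤abd 0≤cda (<⇒≤ cdb<0) (0≤+0< 0≤abd 0<-abc) disj
      where
      0≤cda : 0ℚ ≤ area c d a
      0≤cda = 0≤*-cancel (<⇒0<- cx<bx) (subst (0ℚ ≤_) (cda-eq ax ay bx by cx cy dx dy)
        (0≤+0≤ (0≤*0≤ (≤⇒0≤- ax≤cx) (<⇒≤ 0<-cdb)) (0≤*0≤ (≤⇒0≤- cx≤dx) (<⇒≤ 0<-abc))))
      0≤abd : 0ℚ ≤ area a b d
      0≤abd = 0≤*-cancel (<⇒0<- cx<bx) (subst (0ℚ ≤_) (abd-eq ax ay bx by cx cy dx dy)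
        (0≤+0≤ (0≤*0≤ (≤⇒0≤- bx≤dx) (<⇒≤ 0<-abc)) (0≤*0≤ (≤⇒0≤- (≤-trans ax≤cx cx≤bx)) (<⇒≤ 0<-cdb))))
    -- The degenerate positions have `cx` equal to `bx` and are contradictory: the identity equates
    -- a positive number with zero, or, if `ax` agrees too, `area a b c` vanishes.
    helper (no cx≮bx) (yes ax<cx) = 0<⇒≢0
      (subst (0ℚ <_) (cda-eq ax ay bx by cx cy dx dy)
        (0<+0≤ (0<*0< (<⇒0<- ax<cx) 0<-cdb) (0≤*0≤ (≤⇒0≤- cx≤dx) (<⇒≤ 0<-abc))))
      (trans (cong (λ z → area c d a * (bx - z)) (≤-antisym cx≤bx (≮⇒≥ cx≮bx))) (collapse (area c d a) bx))
    helper (no cx≮bx) (no ax≮cx) = <-irrefl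
      (trans (cong₂ (λ u v → (u - ax) * (cy - ay) - (by - ay) * (v - ax)) (sym (trans ax≡cx cx≡bx)) (sym ax≡cx)) (vertical ax ay by cy))
      abc<0
      where
      cx≡bx = ≤-antisym cx≤bx (≮⇒≥ cx≮bx)
      ax≡cx = ≤-antisym ax≤cx (≮⇒≥ ax≮cx)

  interleaved⁺ : ∀ a b c d → proj₁ a ≤ proj₁ c → proj₁ c ≤ proj₁ b → proj₁ b ≤ proj₁ d →
    0ℚ < area a b c → 0ℚ < area c d b → ¬ Disjoint a b c d
  interleaved⁺ a b c d ac cb bd 0<abc 0<cdb disj =
    interleaved⁻ (reflect a) (reflect b) (reflect c) (reflect d) ac cb bd
      (subst (_< 0ℚ) (sym (area-reflect a b c)) (neg-antimono-< 0<abc))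
      (subst (_< 0ℚ) (sym (area-reflect c d b)) (neg-antimono-< 0<cdb))
      (Disjoint-reflect {a} {b} {c} {d} disj)

  -- The ends of cd lie on different sides of the line ab, and cd stays over the interval of
  -- abscissae of ab; so it meets that line inside the segment.
  nested : ∀ a b c d → proj₁ a ≤ proj₁ c → proj₁ c ≤ proj₁ b → proj₁ a ≤ proj₁ d → proj₁ d ≤ proj₁ b →
    area a b c < 0ℚ → 0ℚ < area a b d → ¬ Disjoint a b c d
  nested a@(ax , ay) b@(bx , by) c@(cx , cy) d@(dx , dy) ax≤cx cx≤bx ax≤dx dx≤bx abc<0 0<abd = helper (ax <? bx)
    where
    cda-eq : ∀ ax ay bx by cx cy dx dy →
      ((bx - ax) * (dy - ay) - (by - ay) * (dx - ax)) * (cx - ax) +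
      (- ((bx - ax) * (cy - ay) - (by - ay) * (cx - ax))) * (dx - ax)
      ≡ ((dx - cx) * (ay - cy) - (dy - cy) * (ax - cx)) * (bx - ax)
    cda-eq = RS.solve-∀ ℚring
    cdb-eq : ∀ ax ay bx by cx cy dx dy →
      ((bx - ax) * (dy - ay) - (by - ay) * (dx - ax)) * (bx - cx) +
      (- ((bx - ax) * (cy - ay) - (by - ay) * (cx - ax))) * (bx - dx)
      ≡ (0ℚ - ((dx - cx) * (by - cy) - (dy - cy) * (bx - cx))) * (bx - ax)
    cdb-eq = RS.solve-∀ ℚring
    vertical : ∀ x ay by cy → (x - x) * (cy - ay) - (by - ay) * (x - x) ≡ 0ℚ
    vertical = RS.solve-∀ ℚring
    0<-abc = <0⇒0<- abc<0
    helper : Dec (ax < bx) → ¬ Disjoint a b c d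
    helper (yes ax<bx) = crossingPoint a b c d (<⇒≤ abc<0) (<⇒≤ 0<abd)
      (0≤*-cancel (<⇒0<- ax<bx) (subst (0ℚ ≤_) (cda-eq ax ay bx by cx cy dx dy)
        (0≤+0≤ (0≤*0≤ (<⇒≤ 0<abd) (≤⇒0≤- ax≤cx)) (0≤*0≤ (<⇒≤ 0<-abc) (≤⇒0≤- ax≤dx)))))
      (0≤-⇒≤ (0≤*-cancel (<⇒0<- ax<bx) (subst (0ℚ ≤_) (cdb-eq ax ay bx by cx cy dx dy)
        (0≤+0≤ (0≤*0≤ (<⇒≤ 0<abd) (≤⇒0≤- cx≤bx)) (0≤*0≤ (<⇒≤ 0<-abc) (≤⇒0≤- dx≤bx))))))
      (0<+0< 0<abd 0<-abc)
    helper (no ax≮bx) _ = <-irrefl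
      (trans (cong₂ (λ u v → (u - ax) * (cy - ay) - (by - ay) * (v - ax)) (sym ax≡bx) (sym ax≡cx)) (vertical ax ay by cy))
      abc<0
      where
      ax≡bx = ≤-antisym (≤-trans ax≤cx cx≤bx) (≮⇒≥ ax≮bx)
      ax≡cx = ≤-antisym ax≤cx (≤-trans cx≤bx (≮⇒≥ ax≮bx))

  infix 4 _≺_
  _≺_ : Pt → Pt → Bool
  a ≺ b = does (lex? a b)

  below : Pt → Pt → Pt → Bool
  below c d p = does (area c d p <? 0ℚ)

  -- Whether the vertical ray upwards from p meets the segment from c to d, for c ≺ d.
  rayʳ : Pt → Pt → Pt → Bool
  rayʳ p c d = (c ≺ p) ∧ ((p ≺ d) ∧ below c d p)

  -- The ends may come in either order; at most one of the two summands is true.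
  ray : Pt → Pt → Pt → Bool
  ray p c d = rayʳ p c d xor rayʳ p d c

  ray-sym : ∀ p c d → ray p c d ≡ ray p d c
  ray-sym p c d = xor-comm (rayʳ p c d) (rayʳ p d c)

  -- Carries the values of both comparisons, so that one case distinction fixes all booleans by
  -- `rewrite`.
  Before : Pt → Pt → Set
  Before a b = Lex a b × (a ≺ b) ≡ true × (b ≺ a) ≡ false

  Lex⇒Before : ∀ {a b} → Lex a b → Before a b
  Lex⇒Before {a} {b} ab = ab , dec-true (lex? a b) ab , dec-false (lex? b a) (λ ba → Lex-irrefl {a} (Lex-trans {a} {b} {a} ab ba))

  Before-total : ∀ {a b} → a ≢ b → Before a b ⊎ Before b a
  Before-total {a} {b} a≢b = Data.Sum.map (Lex⇒Before {a} {b}) (Lex⇒Before {b} {a}) (Lex-total a≢b)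

  ≺-total : ∀ {a b} → a ≢ b → (a ≺ b) xor (b ≺ a) ≡ true
  ≺-total a≢b with Before-total a≢b
  ... | inj₁ (_ , p , q) rewrite p | q = refl
  ... | inj₂ (_ , p , q) rewrite p | q = refl

  Disjoint⇒≢ : ∀ {a b c d} → Disjoint a b c d → a ≢ c
  Disjoint⇒≢ {a} {b} {c} {d} disj refl = disj a (OnSeg-start a b) (OnSeg-start a d)

  Disjoint-reverseˡ : ∀ {a b c d} → Disjoint a b c d → Disjoint b a c d
  Disjoint-reverseˡ {a} {b} {c} {d} disj q ba cd = disj q (OnSeg-sym {q} {b} {a} ba) cd

  -- Over the common interval from c to b one of the disjoint segments is the lower one. If it is
  -- ab, then b is below cd and c is not below ab; if it is cd, the reverse holds.
  below-xor : ∀ {a b c d} → Lex a c → Lex c b → Lex b d → Disjoint a b c d →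
    below a b c xor below c d b ≡ true
  below-xor {a} {b} {c} {d} ac cb bd disj = helper (area a b c <? 0ℚ) (area c d b <? 0ℚ)
    where
    off : ∀ {a b c d} → Lex a c → Lex c b → Disjoint a b c d → ¬ area a b c < 0ℚ → 0ℚ < area a b c
    off {a} {b} {c} {d} ac cb disj ≮0 with <-cmp (area a b c) 0ℚ
    ... | tri< <0 _ _ = ⊥-elim (≮0 <0)
    ... | tri≈ _ ≡0 _ = ⊥-elim (disj c (collinear⇒OnSeg {a} {b} {c} ≡0 ac cb) (OnSeg-start c d))
    ... | tri> _ _ >0 = >0
    helper : (m : Dec (area a b c < 0ℚ)) (n : Dec (area c d b < 0ℚ)) → does m xor does n ≡ true
    helper (yes p) (yes q) = ⊥-elim (interleaved⁻ a b c d (Lex⇒≤ {a} {c} ac) (Lex⇒≤ {c} {b} cb) (Lex⇒≤ {b} {d} bd) p q disj)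
    helper (yes p) (no q) = refl
    helper (no p) (yes q) = refl
    helper (no p) (no q) = ⊥-elim (interleaved⁺ a b c d (Lex⇒≤ {a} {c} ac) (Lex⇒≤ {c} {b} cb) (Lex⇒≤ {b} {d} bd)
      (off {a} {b} {c} {d} ac cb disj p)
      (off {c} {d} {b} {a} cb bd (Disjoint-reverse {c} {d} {a} {b} (Disjoint-swap {a} {b} {c} {d} disj)) q) disj)

  below-same : ∀ {a b c d} → Lex a c → Lex c b → Lex a d → Lex d b → Disjoint a b c d →
    below a b c xor below a b d ≡ false
  below-same {a} {b} {c} {d} ac cb ad db disj = helper (<-cmp (area a b c) 0ℚ) (<-cmp (area a b d) 0ℚ)
    where
    ≤s : ∀ {c} → Lex a c → Lex c b → proj₁ a ≤ proj₁ c × proj₁ c ≤ proj₁ b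
    ≤s {c} ac cb = Lex⇒≤ {a} {c} ac , Lex⇒≤ {c} {b} cb
    ac≤ = ≤s {c} ac cb
    ad≤ = ≤s {d} ad db
    helper : _ → _ → does (area a b c <? 0ℚ) xor does (area a b d <? 0ℚ) ≡ false
    helper (tri≈ _ ≡0 _) _ = ⊥-elim (disj c (collinear⇒OnSeg {a} {b} {c} ≡0 ac cb) (OnSeg-start c d))
    helper _ (tri≈ _ ≡0 _) = ⊥-elim (disj d (collinear⇒OnSeg {a} {b} {d} ≡0 ad db) (OnSeg-end c d))
    helper (tri< p _ _) (tri< q _ _) = cong₂ _xor_ (dec-true (area a b c <? 0ℚ) p) (dec-true (area a b d <? 0ℚ) q)
    helper (tri> p _ _) (tri> q _ _) = cong₂ _xor_ (dec-false (area a b c <? 0ℚ) p) (dec-false (area a b d <? 0ℚ) q)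
    helper (tri< p _ _) (tri> _ _ q) =
      ⊥-elim (nested a b c d (proj₁ ac≤) (proj₂ ac≤) (proj₁ ad≤) (proj₂ ad≤) p q disj)
    helper (tri> _ _ p) (tri< q _ _) =
      ⊥-elim (nested a b d c (proj₁ ad≤) (proj₂ ad≤) (proj₁ ac≤) (proj₂ ac≤) q p (Disjoint-reverse {a} {b} {c} {d} disj))

  -- The right side is true exactly when the intervals from a to b and from c to d interleave in the
  -- order `Lex`. It is written as a sum of comparisons of ends so that it adds up along polygonal
  -- chains.
  Parity : Pt → Pt → Pt → Pt → Set
  Parity a b c d = (ray a c d xor ray b c d) xor (ray c a b xor ray d a b) ≡
                   ((a ≺ c) xor (a ≺ d)) xor ((b ≺ c) xor (b ≺ d))

  private
    -- Named after the order of the ends from left to right: the goals left in `parity-oriented`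
    -- once all comparisons have been evaluated.
    acbd : ∀ {e} x y → y xor x ≡ e → (x xor false) xor ((y xor false) xor false) ≡ e
    acbd false false refl = refl
    acbd false true  refl = refl
    acbd true  false refl = refl
    acbd true  true  refl = refl

    acdb : ∀ {e} x y → x xor y ≡ e → (x xor false) xor (y xor false) ≡ e
    acdb false false refl = refl
    acdb false true  refl = refl
    acdb true  false refl = refl
    acdb true  true  refl = refl

    cabd : ∀ {e} x y → x xor y ≡ e → ((x xor false) xor (y xor false)) xor false ≡ e
    cabd false false refl = refl
    cabd false true  refl = refl
    cabd true  false refl = refl
    cabd true  true  refl = refl

    cadb : ∀ {e} x y → x xor y ≡ e → ((x xor false) xor false) xor (y xor false) ≡ e
    cadb false false refl = refl
    cadb false true  refl = refl
    cadb true  false refl = refl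
    cadb true  true  refl = refl

    parity-oriented : ∀ a b c d → Lex a b → Lex c d → Disjoint a b c d → Parity a b c d
    parity-oriented a b c d ab cd disj
      with Before-total (Disjoint⇒≢ {a} {b} {c} {d} disj)
         | Before-total (Disjoint⇒≢ {a} {b} {d} {c} (Disjoint-reverse {a} {b} {c} {d} disj))
         | Before-total (Disjoint⇒≢ {b} {a} {c} {d} (Disjoint-reverseˡ {a} {b} {c} {d} disj))
         | Before-total (Disjoint⇒≢ {b} {a} {d} {c} (Disjoint-reverse {b} {a} {c} {d} (Disjoint-reverseˡ {a} {b} {c} {d} disj)))
    ... | inj₁ (ac , e₁ , e₂) | inj₁ (ad , e₃ , e₄) | inj₁ (bc , e₅ , e₆) | inj₁ (bd , e₇ , e₈)
      rewrite e₁ | e₂ | e₃ | e₄ | e₅ | e₆ | e₇ | e₈ = refl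
    ... | inj₁ (ac , e₁ , e₂) | inj₁ (ad , e₃ , e₄) | inj₂ (cb , e₅ , e₆) | inj₁ (bd , e₇ , e₈)
      rewrite e₁ | e₂ | e₃ | e₄ | e₅ | e₆ | e₇ | e₈ = acbd (below c d b) (below a b c) (below-xor {a} {b} {c} {d} ac cb bd disj)
    ... | inj₁ (ac , e₁ , e₂) | inj₁ (ad , e₃ , e₄) | inj₂ (cb , e₅ , e₆) | inj₂ (db , e₇ , e₈)
      rewrite e₁ | e₂ | e₃ | e₄ | e₅ | e₆ | e₇ | e₈ = acdb (below a b c) (below a b d) (below-same {a} {b} {c} {d} ac cb ad db disj)
    ... | inj₂ (ca , e₁ , e₂) | inj₁ (ad , e₃ , e₄) | inj₂ (cb , e₅ , e₆) | inj₁ (bd , e₇ , e₈)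
      rewrite e₁ | e₂ | e₃ | e₄ | e₅ | e₆ | e₇ | e₈ = cabd (below c d a) (below c d b) (below-same {c} {d} {a} {b} ca ad cb bd (Disjoint-swap {a} {b} {c} {d} disj))
    ... | inj₂ (ca , e₁ , e₂) | inj₁ (ad , e₃ , e₄) | inj₂ (cb , e₅ , e₆) | inj₂ (db , e₇ , e₈)
      rewrite e₁ | e₂ | e₃ | e₄ | e₅ | e₆ | e₇ | e₈ = cadb (below c d a) (below a b d) (below-xor {c} {d} {a} {b} ca ad db (Disjoint-swap {a} {b} {c} {d} disj))
    ... | inj₂ (ca , e₁ , e₂) | inj₂ (da , e₃ , e₄) | inj₂ (cb , e₅ , e₆) | inj₂ (db , e₇ , e₈)
      rewrite e₁ | e₂ | e₃ | e₄ | e₅ | e₆ | e₇ | e₈ = refl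
    -- The remaining combinations contradict transitivity, as a comes before b and c before d.
    ... | inj₁ (ac , _) | inj₂ (da , _) | _ | _ = ⊥-elim (Lex-irrefl {a} (Lex-trans {a} {c} {a} ac (Lex-trans {c} {d} {a} cd da)))
    ... | _ | _ | inj₁ (bc , _) | inj₂ (db , _) = ⊥-elim (Lex-irrefl {b} (Lex-trans {b} {c} {b} bc (Lex-trans {c} {d} {b} cd db)))
    ... | inj₂ (ca , _) | _ | inj₁ (bc , _) | _ = ⊥-elim (Lex-irrefl {a} (Lex-trans {a} {b} {a} ab (Lex-trans {b} {c} {a} bc ca)))
    ... | _ | inj₂ (da , _) | _ | inj₁ (bd , _) = ⊥-elim (Lex-irrefl {a} (Lex-trans {a} {b} {a} ab (Lex-trans {b} {d} {a} bd da)))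

    Parity-reverse : ∀ a b c d → Parity a b d c → Parity a b c d
    Parity-reverse a b c d h = trans
      (cong₂ _xor_ (cong₂ _xor_ (ray-sym a c d) (ray-sym b c d)) (xor-comm (ray c a b) (ray d a b)))
      (trans h (cong₂ _xor_ (xor-comm (a ≺ d) (a ≺ c)) (xor-comm (b ≺ d) (b ≺ c))))

    Parity-reverseˡ : ∀ a b c d → Parity b a c d → Parity a b c d
    Parity-reverseˡ a b c d h = trans
      (cong₂ _xor_ (xor-comm (ray a c d) (ray b c d)) (cong₂ _xor_ (ray-sym c a b) (ray-sym d a b)))
      (trans h (xor-comm ((b ≺ c) xor (b ≺ d)) ((a ≺ c) xor (a ≺ d))))

  parity : ∀ a b c d → a ≢ b → c ≢ d → Disjoint a b c d → Parity a b c d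
  parity a b c d a≢b c≢d disj with Lex-total a≢b | Lex-total c≢d
  ... | inj₁ ab | inj₁ cd = parity-oriented a b c d ab cd disj
  ... | inj₁ ab | inj₂ dc = Parity-reverse a b c d
    (parity-oriented a b d c ab dc (Disjoint-reverse {a} {b} {c} {d} disj))
  ... | inj₂ ba | inj₁ cd = Parity-reverseˡ a b c d
    (parity-oriented b a c d ba cd (Disjoint-reverseˡ {a} {b} {c} {d} disj))
  ... | inj₂ ba | inj₂ dc = Parity-reverseˡ a b c d (Parity-reverse b a c d
    (parity-oriented b a d c ba dc (Disjoint-reverse {b} {a} {c} {d} (Disjoint-reverseˡ {a} {b} {c} {d} disj))))

-- The parity identity for the edges of a plane drawing.

module VanKampen where

  open Segments
  open import Data.Nat.Properties using (<-cmp)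
  open import Data.Fin.Properties using (toℕ-injective; _≟_)
  open import Data.Bool.Properties using (xor-comm; xor-same; ∨-comm)
  open import Data.Bool.Solver using (module xor-∧-Solver)

  -- In the parity identities a curve from c to d meets a curve from a to b;
  -- each side is additive under concatenation of either curve.
  joinʳ : ∀ r s r′ s′ u v t w x y z x₂ z₂ →
    (r xor s) xor (u xor v) ≡ (w xor x) xor (y xor z) →
    (r′ xor s′) xor (v xor t) ≡ (x xor x₂) xor (z xor z₂) →
    ((r xor r′) xor (s xor s′)) xor (u xor t) ≡ (w xor x₂) xor (y xor z₂)
  joinʳ r s r′ s′ u v t w x y z x₂ z₂ p q = trans
    (solve 7 (λ r s r′ s′ u v t →
      ((r :+ r′) :+ (s :+ s′)) :+ (u :+ t) := ((r :+ s) :+ (u :+ v)) :+ ((r′ :+ s′) :+ (v :+ t))) refl r s r′ s′ u v t)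
    (trans (cong₂ _xor_ p q)
    (solve 6 (λ w x y z x₂ z₂ →
      ((w :+ x) :+ (y :+ z)) :+ ((x :+ x₂) :+ (z :+ z₂)) := (w :+ x₂) :+ (y :+ z₂)) refl w x y z x₂ z₂))
    where open xor-∧-Solver

  joinˡ : ∀ r s t u v u′ v′ w x y z y₂ z₂ →
    (r xor s) xor (u xor v) ≡ (w xor x) xor (y xor z) →
    (s xor t) xor (u′ xor v′) ≡ (y xor z) xor (y₂ xor z₂) →
    (r xor t) xor ((u xor u′) xor (v xor v′)) ≡ (w xor x) xor (y₂ xor z₂)
  joinˡ r s t u v u′ v′ w x y z y₂ z₂ p q = trans
    (solve 7 (λ r s t u v u′ v′ →
      (r :+ t) :+ ((u :+ u′) :+ (v :+ v′)) := ((r :+ s) :+ (u :+ v)) :+ ((s :+ t) :+ (u′ :+ v′))) refl r s t u v u′ v′)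
    (trans (cong₂ _xor_ p q)
    (solve 6 (λ w x y z y₂ z₂ →
      ((w :+ x) :+ (y :+ z)) :+ ((y :+ z) :+ (y₂ :+ z₂)) := (w :+ x) :+ (y₂ :+ z₂)) refl w x y z y₂ z₂))
    where open xor-∧-Solver

  rayChain : ∀ {l} → Pt → (Fin (suc l) → Pt) → Bool
  rayChain {zero}  p γ = false
  rayChain {suc l} p γ = ray p (γ Fin.zero) (γ (Fin.suc Fin.zero)) xor rayChain p (γ ∘ Fin.suc)

  Nondegenerate : ∀ {l} → (Fin (suc l) → Pt) → Set
  Nondegenerate γ = ∀ i → γ (inject₁ i) ≢ γ (Fin.suc i)

  parity-segment-chain : ∀ {l} a b (γ : Fin (suc l) → Pt) → a ≢ b → Nondegenerate γ →
    (∀ i → Disjoint a b (γ (inject₁ i)) (γ (Fin.suc i))) →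
    (rayChain a γ xor rayChain b γ) xor (ray (γ Fin.zero) a b xor ray (γ (fromℕ l)) a b) ≡
    ((a ≺ γ Fin.zero) xor (a ≺ γ (fromℕ l))) xor ((b ≺ γ Fin.zero) xor (b ≺ γ (fromℕ l)))
  parity-segment-chain {zero} a b γ _ _ _ = trans (xor-same (ray (γ Fin.zero) a b))
    (sym (cong₂ _xor_ (xor-same (a ≺ γ Fin.zero)) (xor-same (b ≺ γ Fin.zero))))
  parity-segment-chain {suc l} a b γ a≢b γ-nd disj =
    joinʳ (ray a γ₀ γ₁) (ray b γ₀ γ₁) (rayChain a (γ ∘ Fin.suc)) (rayChain b (γ ∘ Fin.suc))
      (ray γ₀ a b) (ray γ₁ a b) (ray γₗ a b) (a ≺ γ₀) (a ≺ γ₁) (b ≺ γ₀) (b ≺ γ₁) (a ≺ γₗ) (b ≺ γₗ)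
      (parity a b γ₀ γ₁ a≢b (γ-nd Fin.zero) (disj Fin.zero))
      (parity-segment-chain a b (γ ∘ Fin.suc) a≢b (γ-nd ∘ Fin.suc) (disj ∘ Fin.suc))
    where
    γ₀ = γ Fin.zero
    γ₁ = γ (Fin.suc Fin.zero)
    γₗ = γ (fromℕ (suc l))

  parity-chain-chain : ∀ {l m} (δ : Fin (suc m) → Pt) (γ : Fin (suc l) → Pt) → Nondegenerate δ → Nondegenerate γ →
    (∀ j i → Disjoint (δ (inject₁ j)) (δ (Fin.suc j)) (γ (inject₁ i)) (γ (Fin.suc i))) →
    (rayChain (δ Fin.zero) γ xor rayChain (δ (fromℕ m)) γ) xor (rayChain (γ Fin.zero) δ xor rayChain (γ (fromℕ l)) δ) ≡
    ((δ Fin.zero ≺ γ Fin.zero) xor (δ Fin.zero ≺ γ (fromℕ l))) xor ((δ (fromℕ m) ≺ γ Fin.zero) xor (δ (fromℕ m) ≺ γ (fromℕ l)))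
  parity-chain-chain {l} {zero} δ γ _ _ _ =
    trans (cong (_xor false) (xor-same (rayChain (δ Fin.zero) γ)))
    (sym (xor-same ((δ Fin.zero ≺ γ Fin.zero) xor (δ Fin.zero ≺ γ (fromℕ l)))))
  parity-chain-chain {l} {suc m} δ γ δ-nd γ-nd disj =
    joinˡ (rayChain δ₀ γ) (rayChain δ₁ γ) (rayChain δₘ γ) (ray γ₀ δ₀ δ₁) (ray γₗ δ₀ δ₁)
      (rayChain γ₀ (δ ∘ Fin.suc)) (rayChain γₗ (δ ∘ Fin.suc))
      (δ₀ ≺ γ₀) (δ₀ ≺ γₗ) (δ₁ ≺ γ₀) (δ₁ ≺ γₗ) (δₘ ≺ γ₀) (δₘ ≺ γₗ)
      (parity-segment-chain δ₀ δ₁ γ (δ-nd Fin.zero) γ-nd (disj Fin.zero))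
      (parity-chain-chain (δ ∘ Fin.suc) γ (δ-nd ∘ Fin.suc) γ-nd (disj ∘ Fin.suc))
    where
    γ₀ = γ Fin.zero
    γₗ = γ (fromℕ l)
    δ₀ = δ Fin.zero
    δ₁ = δ (Fin.suc Fin.zero)
    δₘ = δ (fromℕ (suc m))

  -- The combinatorial trace of a plane drawing (vanishing of the van Kampen obstruction mod 2):
  -- u ⊰ v compares abscissae, and cut p c d is the parity of the intersections of the
  -- edge cd with the vertical ray from p.
  record Flat {n} (a : Fin n → Fin n → Bool) : Set where
    field
      _⊰_     : Fin n → Fin n → Bool
      ⊰-total : ∀ {u v} → u ≢ v → (u ⊰ v) xor (v ⊰ u) ≡ true
      cut     : Fin n → Fin n → Fin n → Bool
      even    : ∀ {s t u v} → s ≢ u → s ≢ v → t ≢ u → t ≢ v → a s t ≡ true → a u v ≡ true →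
                (cut s u v xor cut t u v) xor (cut u s t xor cut v s t) ≡
                ((s ⊰ u) xor (s ⊰ v)) xor ((t ⊰ u) xor (t ⊰ v))

  Adj-sym : ∀ {n} (G : Graph n) u v → Adj G u v ≡ Adj G v u
  Adj-sym G u v with u ≟ v | v ≟ u
  ... | yes _ | yes _ = refl
  ... | yes p | no q = ⊥-elim (q (sym p))
  ... | no p | yes q = ⊥-elim (p (sym q))
  ... | no _ | no _ = ∨-comm (rel G u v) (rel G v u)

  Adj-irrefl : ∀ {n} (G : Graph n) u → Adj G u u ≡ false
  Adj-irrefl G u with u ≟ u
  ... | yes _ = refl
  ... | no q = ⊥-elim (q refl)

  module _ {n} {G : Graph n} (D : Drawing G) where
    open Drawing D

    -- A drawing has arcs only for edges listed from the smaller to the larger index, whereas `cut`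
    -- needs a value for every ordered pair.
    data EdgeView (u v : Fin n) : Set where
      forward  : (e : Edge G) → eu G e ≡ u → ev G e ≡ v → EdgeView u v
      backward : (e : Edge G) → eu G e ≡ v → ev G e ≡ u → EdgeView u v
      nonedge  : Adj G u v ≡ false → EdgeView u v

    edgeView : ∀ u v → EdgeView u v
    edgeView u v with Adj G u v in eq
    ... | false = nonedge eq
    ... | true with <-cmp (toℕ u) (toℕ v)
    ...   | tri< u<v _ _ = forward (u , v , u<v , eq) refl refl
    ...   | tri> _ _ v<u = backward (v , u , v<u , trans (Adj-sym G v u) eq) refl refl
    ...   | tri≈ _ u≡v _ with toℕ-injective u≡v
    ...     | refl with trans (sym eq) (Adj-irrefl G u)
    ...       | ()

    rayEdge : Pt → ∀ {u v} → EdgeView u v → Bool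
    rayEdge p (forward e _ _)  = rayChain p (pt (arc e))
    rayEdge p (backward e _ _) = rayChain p (pt (arc e))
    rayEdge p (nonedge _)      = false

    arcs-disjoint : ∀ e f → eu G e ≢ eu G f → eu G e ≢ ev G f → ev G e ≢ eu G f → ev G e ≢ ev G f →
      ∀ q → OnArc q (arc e) → ¬ OnArc q (arc f)
    arcs-disjoint e f uu uv vu vv q qe qf with cross e f (λ eq → uu (cong proj₁ eq)) q qe qf
    ... | w , _ , inj₁ refl , inj₁ x = uu x
    ... | w , _ , inj₁ refl , inj₂ x = uv x
    ... | w , _ , inj₂ refl , inj₁ x = vu x
    ... | w , _ , inj₂ refl , inj₂ x = vv x

    parity-edges : ∀ e f → eu G e ≢ eu G f → eu G e ≢ ev G f → ev G e ≢ eu G f → ev G e ≢ ev G f →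
      let s = pos (eu G e) ; t = pos (ev G e) ; u = pos (eu G f) ; v = pos (ev G f)
          δ = pt (arc e) ; γ = pt (arc f) in
      (rayChain s γ xor rayChain t γ) xor (rayChain u δ xor rayChain v δ) ≡
      ((s ≺ u) xor (s ≺ v)) xor ((t ≺ u) xor (t ≺ v))
    parity-edges e f uu uv vu vv rewrite sym (arc-start e) | sym (arc-end e) | sym (arc-start f) | sym (arc-end f) =
      parity-chain-chain (pt (arc e)) (pt (arc f)) (nondeg (arc e)) (nondeg (arc f))
        (λ j i q qe qf → arcs-disjoint e f uu uv vu vv q (j , qe) (i , qf))

    drawing⇒flat : Flat (Adj G)
    drawing⇒flat = record
      { _⊰_ = λ u v → pos u ≺ pos v
      ; ⊰-total = λ u≢v → ≺-total (λ eq → u≢v (pos-inj eq))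
      ; cut = λ p u v → rayEdge (pos p) (edgeView u v)
      ; even = λ {s} {t} {u} {v} su sv tu tv st uv → evenView (edgeView s t) (edgeView u v) su sv tu tv st uv
      }
      where
      -- Reversing either edge only permutes summands on both sides of the identity.
      swapˡ : ∀ r s u v w x y z → (r xor s) xor (u xor v) ≡ (w xor x) xor (y xor z) →
        (s xor r) xor (u xor v) ≡ (y xor z) xor (w xor x)
      swapˡ r s u v w x y z p = trans (cong (_xor (u xor v)) (xor-comm s r)) (trans p (xor-comm (w xor x) (y xor z)))
      swapʳ : ∀ r s u v w x y z → (r xor s) xor (u xor v) ≡ (w xor x) xor (y xor z) →
        (r xor s) xor (v xor u) ≡ (x xor w) xor (z xor y)
      swapʳ r s u v w x y z p = trans (cong ((r xor s) xor_) (xor-comm v u)) (trans p (cong₂ _xor_ (xor-comm w x) (xor-comm y z)))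
      evenView : ∀ {s t u v} (E : EdgeView s t) (F : EdgeView u v) → s ≢ u → s ≢ v → t ≢ u → t ≢ v →
        Adj G s t ≡ true → Adj G u v ≡ true →
        (rayEdge (pos s) F xor rayEdge (pos t) F) xor (rayEdge (pos u) E xor rayEdge (pos v) E) ≡
        ((pos s ≺ pos u) xor (pos s ≺ pos v)) xor ((pos t ≺ pos u) xor (pos t ≺ pos v))
      evenView (nonedge p) _ _ _ _ _ st _ with trans (sym p) st
      ... | ()
      evenView (forward _ _ _) (nonedge p) _ _ _ _ _ uv with trans (sym p) uv
      ... | ()
      evenView (backward _ _ _) (nonedge p) _ _ _ _ _ uv with trans (sym p) uv
      ... | ()
      evenView (forward e refl refl) (forward f refl refl) su sv tu tv _ _ = parity-edges e f su sv tu tv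
      evenView {s} {t} {u} {v} E@(backward e refl refl) F@(forward f refl refl) su sv tu tv _ _ =
        swapˡ (rayEdge (pos t) F) (rayEdge (pos s) F) (rayEdge (pos u) E) (rayEdge (pos v) E) (pos t ≺ pos u) (pos t ≺ pos v) (pos s ≺ pos u) (pos s ≺ pos v)
          (parity-edges e f tu tv su sv)
      evenView {s} {t} {u} {v} E@(forward e refl refl) F@(backward f refl refl) su sv tu tv _ _ =
        swapʳ (rayEdge (pos s) F) (rayEdge (pos t) F) (rayEdge (pos v) E) (rayEdge (pos u) E) (pos s ≺ pos v) (pos s ≺ pos u) (pos t ≺ pos v) (pos t ≺ pos u)
          (parity-edges e f sv su tv tu)
      evenView {s} {t} {u} {v} E@(backward e refl refl) F@(backward f refl refl) su sv tu tv _ _ =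
        swapʳ (rayEdge (pos s) F) (rayEdge (pos t) F) (rayEdge (pos v) E) (rayEdge (pos u) E) (pos s ≺ pos v) (pos s ≺ pos u) (pos t ≺ pos v) (pos t ≺ pos u)
        (swapˡ (rayEdge (pos t) F) (rayEdge (pos s) F) (rayEdge (pos v) E) (rayEdge (pos u) E) (pos t ≺ pos v) (pos t ≺ pos u) (pos s ≺ pos v) (pos s ≺ pos u)
          (parity-edges e f tv tu sv su))

-- The identity fails for K₅ and K₃,₃.

module Kuratowski where

  open VanKampen
  open import Data.Nat using (_<ᵇ_)
  open import Data.Fin.Properties using (_≟_)
  open import Data.Bool.Solver using (module xor-∧-Solver)
  open import Relation.Nullary.Decidable using (⌊_⌋)

  complete : Fin 5 → Fin 5 → Bool
  complete u v = not ⌊ u ≟ v ⌋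

  bipartite : Fin 6 → Fin 6 → Bool
  bipartite u v = (toℕ u <ᵇ 3) xor (toℕ v <ᵇ 3)

  infixl 6 _⊹_
  _⊹_ : ∀ {s t u v} → s ≡ t → u ≡ v → s xor u ≡ t xor v
  _⊹_ = cong₂ _xor_

  -- Summed over all pairs of independent edges, every ray count occurs an even number of times.
  K₅-not-flat : ¬ Flat complete
  K₅-not-flat F = contradiction (trans (sym rays≡false) (trans pairs orders≡true)) λ ()
    where
    open Flat F
    open xor-∧-Solver
    -- The fifteen pairs of independent edges. A value `cut p u v` arises once for each of the two
    -- edges at p that avoid u and v.
    pairs = even {0F} {1F} {2F} {3F} (λ ()) (λ ()) (λ ()) (λ ()) refl refl
          ⊹ even {0F} {1F} {2F} {4F} (λ ()) (λ ()) (λ ()) (λ ()) refl refl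
          ⊹ even {0F} {1F} {3F} {4F} (λ ()) (λ ()) (λ ()) (λ ()) refl refl
          ⊹ even {0F} {2F} {1F} {3F} (λ ()) (λ ()) (λ ()) (λ ()) refl refl
          ⊹ even {0F} {2F} {1F} {4F} (λ ()) (λ ()) (λ ()) (λ ()) refl refl
          ⊹ even {0F} {2F} {3F} {4F} (λ ()) (λ ()) (λ ()) (λ ()) refl refl
          ⊹ even {0F} {3F} {1F} {2F} (λ ()) (λ ()) (λ ()) (λ ()) refl refl
          ⊹ even {0F} {3F} {1F} {4F} (λ ()) (λ ()) (λ ()) (λ ()) refl refl
          ⊹ even {0F} {3F} {2F} {4F} (λ ()) (λ ()) (λ ()) (λ ()) refl refl
          ⊹ even {0F} {4F} {1F} {2F} (λ ()) (λ ()) (λ ()) (λ ()) refl refl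
          ⊹ even {0F} {4F} {1F} {3F} (λ ()) (λ ()) (λ ()) (λ ()) refl refl
          ⊹ even {0F} {4F} {2F} {3F} (λ ()) (λ ()) (λ ()) (λ ()) refl refl
          ⊹ even {1F} {2F} {3F} {4F} (λ ()) (λ ()) (λ ()) (λ ()) refl refl
          ⊹ even {1F} {3F} {2F} {4F} (λ ()) (λ ()) (λ ()) (λ ()) refl refl
          ⊹ even {1F} {4F} {2F} {3F} (λ ()) (λ ()) (λ ()) (λ ()) refl refl
    rays≡false = solve 30 (λ c₀₂₃ c₁₂₃ c₂₀₁ c₃₀₁ c₀₂₄ c₁₂₄ c₄₀₁ c₀₃₄ c₁₃₄ c₀₁₃ c₂₁₃ c₁₀₂ c₃₀₂ c₀₁₄ c₂₁₄ c₄₀₂ c₂₃₄ c₀₁₂ c₃₁₂ c₁₀₃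
        c₂₀₃ c₃₁₄ c₄₀₃ c₃₂₄ c₄₁₂ c₁₀₄ c₂₀₄ c₄₁₃ c₃₀₄ c₄₂₃ →
        ((c₀₂₃ :+ c₁₂₃) :+ (c₂₀₁ :+ c₃₀₁))
      :+ ((c₀₂₄ :+ c₁₂₄) :+ (c₂₀₁ :+ c₄₀₁))
      :+ ((c₀₃₄ :+ c₁₃₄) :+ (c₃₀₁ :+ c₄₀₁))
      :+ ((c₀₁₃ :+ c₂₁₃) :+ (c₁₀₂ :+ c₃₀₂))
      :+ ((c₀₁₄ :+ c₂₁₄) :+ (c₁₀₂ :+ c₄₀₂))
      :+ ((c₀₃₄ :+ c₂₃₄) :+ (c₃₀₂ :+ c₄₀₂))
      :+ ((c₀₁₂ :+ c₃₁₂) :+ (c₁₀₃ :+ c₂₀₃))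
      :+ ((c₀₁₄ :+ c₃₁₄) :+ (c₁₀₃ :+ c₄₀₃))
      :+ ((c₀₂₄ :+ c₃₂₄) :+ (c₂₀₃ :+ c₄₀₃))
      :+ ((c₀₁₂ :+ c₄₁₂) :+ (c₁₀₄ :+ c₂₀₄))
      :+ ((c₀₁₃ :+ c₄₁₃) :+ (c₁₀₄ :+ c₃₀₄))
      :+ ((c₀₂₃ :+ c₄₂₃) :+ (c₂₀₄ :+ c₃₀₄))
      :+ ((c₁₃₄ :+ c₂₃₄) :+ (c₃₁₂ :+ c₄₁₂))
      :+ ((c₁₂₄ :+ c₃₂₄) :+ (c₂₁₃ :+ c₄₁₃))
      :+ ((c₁₂₃ :+ c₄₂₃) :+ (c₂₁₄ :+ c₃₁₄)) := con false) refl
      (cut 0F 2F 3F) (cut 1F 2F 3F) (cut 2F 0F 1F) (cut 3F 0F 1F) (cut 0F 2F 4F) (cut 1F 2F 4F)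
      (cut 4F 0F 1F) (cut 0F 3F 4F) (cut 1F 3F 4F) (cut 0F 1F 3F) (cut 2F 1F 3F) (cut 1F 0F 2F)
      (cut 3F 0F 2F) (cut 0F 1F 4F) (cut 2F 1F 4F) (cut 4F 0F 2F) (cut 2F 3F 4F) (cut 0F 1F 2F)
      (cut 3F 1F 2F) (cut 1F 0F 3F) (cut 2F 0F 3F) (cut 3F 1F 4F) (cut 4F 0F 3F) (cut 3F 2F 4F)
      (cut 4F 1F 2F) (cut 1F 0F 4F) (cut 2F 0F 4F) (cut 4F 1F 3F) (cut 3F 0F 4F) (cut 4F 2F 3F)
    -- With the edges listed in this way, only the pairs among the vertices 2, 3, 4 are compared an
    -- odd number of times in both directions. By totality each of these three pairs contributes
    -- true; all else cancels.
    orders≡true = trans (solve 16 (λ l₀₂ l₀₃ l₁₂ l₁₃ l₀₄ l₁₄ l₀₁ l₂₁ l₂₃ l₂₄ l₃₁ l₃₂ l₃₄ l₄₁ l₄₂ l₄₃ →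
        ((l₀₂ :+ l₀₃) :+ (l₁₂ :+ l₁₃))
      :+ ((l₀₂ :+ l₀₄) :+ (l₁₂ :+ l₁₄))
      :+ ((l₀₃ :+ l₀₄) :+ (l₁₃ :+ l₁₄))
      :+ ((l₀₁ :+ l₀₃) :+ (l₂₁ :+ l₂₃))
      :+ ((l₀₁ :+ l₀₄) :+ (l₂₁ :+ l₂₄))
      :+ ((l₀₃ :+ l₀₄) :+ (l₂₃ :+ l₂₄))
      :+ ((l₀₁ :+ l₀₂) :+ (l₃₁ :+ l₃₂))
      :+ ((l₀₁ :+ l₀₄) :+ (l₃₁ :+ l₃₄))
      :+ ((l₀₂ :+ l₀₄) :+ (l₃₂ :+ l₃₄))
      :+ ((l₀₁ :+ l₀₂) :+ (l₄₁ :+ l₄₂))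
      :+ ((l₀₁ :+ l₀₃) :+ (l₄₁ :+ l₄₃))
      :+ ((l₀₂ :+ l₀₃) :+ (l₄₂ :+ l₄₃))
      :+ ((l₁₃ :+ l₁₄) :+ (l₂₃ :+ l₂₄))
      :+ ((l₁₂ :+ l₁₄) :+ (l₃₂ :+ l₃₄))
      :+ ((l₁₂ :+ l₁₃) :+ (l₄₂ :+ l₄₃)) :=
        ((l₂₃ :+ l₃₂) :+ (l₂₄ :+ l₄₂)) :+ (l₃₄ :+ l₄₃)) refl
      (0F ⊰ 2F) (0F ⊰ 3F) (1F ⊰ 2F) (1F ⊰ 3F) (0F ⊰ 4F) (1F ⊰ 4F) (0F ⊰ 1F) (2F ⊰ 1F) (2F ⊰ 3F) (2F ⊰ 4F)
      (3F ⊰ 1F) (3F ⊰ 2F) (3F ⊰ 4F) (4F ⊰ 1F) (4F ⊰ 2F) (4F ⊰ 3F))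
      (cong₂ _xor_ (cong₂ _xor_ (⊰-total {2F} {3F} λ ()) (⊰-total {2F} {4F} λ ())) (⊰-total {3F} {4F} λ ()))

  K₃₃-not-flat : ¬ Flat bipartite
  K₃₃-not-flat F = contradiction (trans (sym rays≡false) (trans pairs orders≡true)) λ ()
    where
    open Flat F
    open xor-∧-Solver
    -- The eighteen pairs of independent edges. Of the three edges at p, exactly two avoid a given
    -- edge uv off p, so again every `cut p u v` occurs twice.
    pairs = even {0F} {3F} {1F} {4F} (λ ()) (λ ()) (λ ()) (λ ()) refl refl
          ⊹ even {0F} {3F} {1F} {5F} (λ ()) (λ ()) (λ ()) (λ ()) refl refl
          ⊹ even {0F} {3F} {2F} {4F} (λ ()) (λ ()) (λ ()) (λ ()) refl refl
          ⊹ even {0F} {3F} {2F} {5F} (λ ()) (λ ()) (λ ()) (λ ()) refl refl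
          ⊹ even {0F} {4F} {1F} {3F} (λ ()) (λ ()) (λ ()) (λ ()) refl refl
          ⊹ even {0F} {4F} {1F} {5F} (λ ()) (λ ()) (λ ()) (λ ()) refl refl
          ⊹ even {0F} {4F} {2F} {3F} (λ ()) (λ ()) (λ ()) (λ ()) refl refl
          ⊹ even {0F} {4F} {2F} {5F} (λ ()) (λ ()) (λ ()) (λ ()) refl refl
          ⊹ even {0F} {5F} {1F} {3F} (λ ()) (λ ()) (λ ()) (λ ()) refl refl
          ⊹ even {0F} {5F} {1F} {4F} (λ ()) (λ ()) (λ ()) (λ ()) refl refl
          ⊹ even {0F} {5F} {2F} {3F} (λ ()) (λ ()) (λ ()) (λ ()) refl refl
          ⊹ even {0F} {5F} {2F} {4F} (λ ()) (λ ()) (λ ()) (λ ()) refl refl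
          ⊹ even {1F} {3F} {2F} {4F} (λ ()) (λ ()) (λ ()) (λ ()) refl refl
          ⊹ even {1F} {3F} {2F} {5F} (λ ()) (λ ()) (λ ()) (λ ()) refl refl
          ⊹ even {1F} {4F} {2F} {3F} (λ ()) (λ ()) (λ ()) (λ ()) refl refl
          ⊹ even {1F} {4F} {2F} {5F} (λ ()) (λ ()) (λ ()) (λ ()) refl refl
          ⊹ even {1F} {5F} {2F} {3F} (λ ()) (λ ()) (λ ()) (λ ()) refl refl
          ⊹ even {1F} {5F} {2F} {4F} (λ ()) (λ ()) (λ ()) (λ ()) refl refl
    rays≡false = solve 36 (λ c₀₁₄ c₃₁₄ c₁₀₃ c₄₀₃ c₀₁₅ c₃₁₅ c₅₀₃ c₀₂₄ c₃₂₄ c₂₀₃ c₀₂₅ c₃₂₅ c₀₁₃ c₄₁₃ c₁₀₄ c₃₀₄ c₄₁₅ c₅₀₄ c₀₂₃ c₄₂₃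
        c₂₀₄ c₄₂₅ c₅₁₃ c₁₀₅ c₃₀₅ c₅₁₄ c₄₀₅ c₅₂₃ c₂₀₅ c₅₂₄ c₁₂₄ c₂₁₃ c₁₂₅ c₁₂₃ c₂₁₄ c₂₁₅ →
        ((c₀₁₄ :+ c₃₁₄) :+ (c₁₀₃ :+ c₄₀₃))
      :+ ((c₀₁₅ :+ c₃₁₅) :+ (c₁₀₃ :+ c₅₀₃))
      :+ ((c₀₂₄ :+ c₃₂₄) :+ (c₂₀₃ :+ c₄₀₃))
      :+ ((c₀₂₅ :+ c₃₂₅) :+ (c₂₀₃ :+ c₅₀₃))
      :+ ((c₀₁₃ :+ c₄₁₃) :+ (c₁₀₄ :+ c₃₀₄))
      :+ ((c₀₁₅ :+ c₄₁₅) :+ (c₁₀₄ :+ c₅₀₄))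
      :+ ((c₀₂₃ :+ c₄₂₃) :+ (c₂₀₄ :+ c₃₀₄))
      :+ ((c₀₂₅ :+ c₄₂₅) :+ (c₂₀₄ :+ c₅₀₄))
      :+ ((c₀₁₃ :+ c₅₁₃) :+ (c₁₀₅ :+ c₃₀₅))
      :+ ((c₀₁₄ :+ c₅₁₄) :+ (c₁₀₅ :+ c₄₀₅))
      :+ ((c₀₂₃ :+ c₅₂₃) :+ (c₂₀₅ :+ c₃₀₅))
      :+ ((c₀₂₄ :+ c₅₂₄) :+ (c₂₀₅ :+ c₄₀₅))
      :+ ((c₁₂₄ :+ c₃₂₄) :+ (c₂₁₃ :+ c₄₁₃))
      :+ ((c₁₂₅ :+ c₃₂₅) :+ (c₂₁₃ :+ c₅₁₃))
      :+ ((c₁₂₃ :+ c₄₂₃) :+ (c₂₁₄ :+ c₃₁₄))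
      :+ ((c₁₂₅ :+ c₄₂₅) :+ (c₂₁₄ :+ c₅₁₄))
      :+ ((c₁₂₃ :+ c₅₂₃) :+ (c₂₁₅ :+ c₃₁₅))
      :+ ((c₁₂₄ :+ c₅₂₄) :+ (c₂₁₅ :+ c₄₁₅)) := con false) refl
      (cut 0F 1F 4F) (cut 3F 1F 4F) (cut 1F 0F 3F) (cut 4F 0F 3F) (cut 0F 1F 5F) (cut 3F 1F 5F)
      (cut 5F 0F 3F) (cut 0F 2F 4F) (cut 3F 2F 4F) (cut 2F 0F 3F) (cut 0F 2F 5F) (cut 3F 2F 5F)
      (cut 0F 1F 3F) (cut 4F 1F 3F) (cut 1F 0F 4F) (cut 3F 0F 4F) (cut 4F 1F 5F) (cut 5F 0F 4F)
      (cut 0F 2F 3F) (cut 4F 2F 3F) (cut 2F 0F 4F) (cut 4F 2F 5F) (cut 5F 1F 3F) (cut 1F 0F 5F)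
      (cut 3F 0F 5F) (cut 5F 1F 4F) (cut 4F 0F 5F) (cut 5F 2F 3F) (cut 2F 0F 5F) (cut 5F 2F 4F)
      (cut 1F 2F 4F) (cut 2F 1F 3F) (cut 1F 2F 5F) (cut 1F 2F 3F) (cut 2F 1F 4F) (cut 2F 1F 5F)
    -- Here the pairs among 3, 4, 5 survive, again an odd number of them.
    orders≡true = trans (solve 21 (λ l₀₁ l₀₄ l₃₁ l₃₄ l₀₅ l₃₅ l₀₂ l₃₂ l₀₃ l₄₁ l₄₃ l₄₅ l₄₂ l₅₁ l₅₃ l₅₄ l₅₂ l₁₂ l₁₄ l₁₅ l₁₃ →
        ((l₀₁ :+ l₀₄) :+ (l₃₁ :+ l₃₄))
      :+ ((l₀₁ :+ l₀₅) :+ (l₃₁ :+ l₃₅))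
      :+ ((l₀₂ :+ l₀₄) :+ (l₃₂ :+ l₃₄))
      :+ ((l₀₂ :+ l₀₅) :+ (l₃₂ :+ l₃₅))
      :+ ((l₀₁ :+ l₀₃) :+ (l₄₁ :+ l₄₃))
      :+ ((l₀₁ :+ l₀₅) :+ (l₄₁ :+ l₄₅))
      :+ ((l₀₂ :+ l₀₃) :+ (l₄₂ :+ l₄₃))
      :+ ((l₀₂ :+ l₀₅) :+ (l₄₂ :+ l₄₅))
      :+ ((l₀₁ :+ l₀₃) :+ (l₅₁ :+ l₅₃))
      :+ ((l₀₁ :+ l₀₄) :+ (l₅₁ :+ l₅₄))
      :+ ((l₀₂ :+ l₀₃) :+ (l₅₂ :+ l₅₃))
      :+ ((l₀₂ :+ l₀₄) :+ (l₅₂ :+ l₅₄))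
      :+ ((l₁₂ :+ l₁₄) :+ (l₃₂ :+ l₃₄))
      :+ ((l₁₂ :+ l₁₅) :+ (l₃₂ :+ l₃₅))
      :+ ((l₁₂ :+ l₁₃) :+ (l₄₂ :+ l₄₃))
      :+ ((l₁₂ :+ l₁₅) :+ (l₄₂ :+ l₄₅))
      :+ ((l₁₂ :+ l₁₃) :+ (l₅₂ :+ l₅₃))
      :+ ((l₁₂ :+ l₁₄) :+ (l₅₂ :+ l₅₄)) :=
        ((l₃₄ :+ l₄₃) :+ (l₃₅ :+ l₅₃)) :+ (l₄₅ :+ l₅₄)) refl
      (0F ⊰ 1F) (0F ⊰ 4F) (3F ⊰ 1F) (3F ⊰ 4F) (0F ⊰ 5F) (3F ⊰ 5F) (0F ⊰ 2F) (3F ⊰ 2F) (0F ⊰ 3F) (4F ⊰ 1F)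
      (4F ⊰ 3F) (4F ⊰ 5F) (4F ⊰ 2F) (5F ⊰ 1F) (5F ⊰ 3F) (5F ⊰ 4F) (5F ⊰ 2F) (1F ⊰ 2F) (1F ⊰ 4F) (1F ⊰ 5F)
      (1F ⊰ 3F))
      (cong₂ _xor_ (cong₂ _xor_ (⊰-total {3F} {4F} λ ()) (⊰-total {3F} {5F} λ ())) (⊰-total {4F} {5F} λ ()))

-- Finite sums and counts of edges.

module Counting where

  open import Data.Nat
  open import Data.Nat.Properties hiding (suc-injective)
  open import Data.Fin.Properties using (suc-injective) renaming (_≟_ to _≟ᶠ_)
  open import Relation.Nullary.Decidable using (dec-true; dec-false)
  open import Algebra.Properties.CommutativeMonoid.Sum +-0-commutativeMonoid public
    using (sum; sum-remove; ∑-distrib-+; ∑-comm)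

  𝟙 : Bool → ℕ
  𝟙 true  = 1
  𝟙 false = 0

  sum-mono : ∀ {n} {f g : Fin n → ℕ} → (∀ i → f i ≤ g i) → sum f ≤ sum g
  sum-mono {zero}  h = z≤n
  sum-mono {suc n} h = +-mono-≤ (h Fin.zero) (sum-mono (h ∘ Fin.suc))

  sum-cong : ∀ {n} {f g : Fin n → ℕ} → (∀ i → f i ≡ g i) → sum f ≡ sum g
  sum-cong {zero}  h = refl
  sum-cong {suc n} h = cong₂ _+_ (h Fin.zero) (sum-cong (h ∘ Fin.suc))

  sum-const : ∀ n c → sum {n} (λ _ → c) ≡ n * c
  sum-const zero    c = refl
  sum-const (suc n) c = cong (c +_) (sum-const n c)

  term≤sum : ∀ {n} (f : Fin n → ℕ) i → f i ≤ sum f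
  term≤sum f Fin.zero    = m≤m+n _ _
  term≤sum f (Fin.suc i) = ≤-trans (term≤sum (f ∘ Fin.suc) i) (m≤n+m _ _)

  _==_ : ∀ {n} → Fin n → Fin n → Bool
  i == j = does (i ≟ᶠ j)

  ==-refl : ∀ {n} (i : Fin n) → (i == i) ≡ true
  ==-refl i = dec-true (i ≟ᶠ i) refl

  ==-≢ : ∀ {n} {i j : Fin n} → i ≢ j → (i == j) ≡ false
  ==-≢ {i = i} {j} = dec-false (i ≟ᶠ j)

  ==⇒≡ : ∀ {n} {i j : Fin n} → (i == j) ≡ true → i ≡ j
  ==⇒≡ {i = i} {j} h with i ≟ᶠ j
  ... | yes p = p
  ==⇒≡ () | no _

  sum-point : ∀ {n} (u : Fin n) (f : Fin n → ℕ) → sum (λ i → 𝟙 (i == u) * f i) ≡ f u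
  sum-point {suc n} Fin.zero f = trans
    (cong₂ _+_ (+-identityʳ (f Fin.zero)) (trans (sum-const n 0) (*-zeroʳ n)))
    (+-identityʳ (f Fin.zero))
  sum-point {suc n} (Fin.suc u) f = sum-point u (f ∘ Fin.suc)

  sum-indicator : ∀ {n} (u : Fin n) → sum (λ i → 𝟙 (i == u)) ≡ 1
  sum-indicator u = trans (sum-cong (λ i → sym (*-identityʳ (𝟙 (i == u))))) (sum-point u (λ _ → 1))

  sum-distrib₃ : ∀ {n} (f g h : Fin n → ℕ) → sum (λ i → f i + g i + h i) ≡ sum f + sum g + sum h
  sum-distrib₃ f g h = trans (∑-distrib-+ (λ i → f i + g i) h) (cong (_+ sum h) (∑-distrib-+ f g))

  𝟙≤1 : ∀ b → 𝟙 b ≤ 1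
  𝟙≤1 true  = ≤-refl
  𝟙≤1 false = z≤n

  sum-positive : ∀ {n} (f : Fin n → Bool) → 0 < sum (𝟙 ∘ f) → ∃ λ i → f i ≡ true
  sum-positive {suc n} f h with f Fin.zero in eq
  ... | true  = Fin.zero , eq
  ... | false = let i , p = sum-positive (f ∘ Fin.suc) h in Fin.suc i , p

  -- The last component transfers counts: with P the neighbourhood of x, the common neighbours of x
  -- and `e i` become the neighbours of `e i` inside that neighbourhood.
  enumerate : ∀ {n} (P : Fin n → Bool) → Σ (Fin (sum (𝟙 ∘ P)) → Fin n) λ e →
    Injective _≡_ _≡_ e × (∀ i → P (e i) ≡ true) ×
    (∀ (Q : Fin n → Bool) → sum (λ j → 𝟙 (P j ∧ Q j)) ≡ sum (λ i → 𝟙 (Q (e i))))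
  enumerate {zero} P = (λ ()) , (λ {}) , (λ ()) , λ Q → refl
  enumerate {suc n} P with P Fin.zero in eq | enumerate (P ∘ Fin.suc)
  ... | false | e , inj , sat , count = Fin.suc ∘ e , inj ∘ suc-injective , sat , λ Q → count (Q ∘ Fin.suc)
  ... | true | e , inj , sat , count = e′ , inj′ , sat′ , λ Q → cong (𝟙 (Q Fin.zero) +_) (count (Q ∘ Fin.suc))
    where
    e′ : Fin (suc (sum (𝟙 ∘ P ∘ Fin.suc))) → Fin (suc n)
    e′ Fin.zero    = Fin.zero
    e′ (Fin.suc i) = Fin.suc (e i)
    inj′ : Injective _≡_ _≡_ e′
    inj′ {Fin.zero}  {Fin.zero}  p = refl
    inj′ {Fin.suc i} {Fin.suc j} p = cong Fin.suc (inj (suc-injective p))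
    sat′ : ∀ i → P (e′ i) ≡ true
    sat′ Fin.zero    = eq
    sat′ (Fin.suc i) = sat i

  -- Split off the term at `φ 0F` and squeeze the rest of φ into the remaining indices. It bounds
  -- the count of a fan by that of its image in a larger graph.
  sum-pullback-≤ : ∀ {m n} {φ : Fin m → Fin n} → Injective _≡_ _≡_ φ → (f : Fin n → ℕ) → sum (f ∘ φ) ≤ sum f
  sum-pullback-≤ {zero} φ-inj f = z≤n
  sum-pullback-≤ {suc m} {zero} {φ} φ-inj f with φ Fin.zero
  ... | ()
  sum-pullback-≤ {suc m} {suc n} {φ} φ-inj f = begin
    f v + sum (f ∘ φ ∘ Fin.suc)                    ≡⟨ cong (f v +_) (sum-cong (λ i → cong f (sym (punchIn-punchOut (v≢ i))))) ⟩
    f v + sum (f ∘ punchIn v ∘ ψ)                  ≤⟨ +-monoʳ-≤ (f v) (sum-pullback-≤ ψ-inj (f ∘ punchIn v)) ⟩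
    f v + sum (f ∘ punchIn v)                      ≡⟨ sum-remove {i = v} f ⟨
    sum f                                          ∎
    where
    open ≤-Reasoning
    open import Data.Fin.Properties using (punchIn-punchOut; punchOut-injective)
    v = φ Fin.zero
    v≢ : ∀ i → v ≢ φ (Fin.suc i)
    v≢ i eq with φ-inj eq
    ... | ()
    ψ : Fin m → Fin n
    ψ i = Fin.punchOut (v≢ i)
    ψ-inj : Injective _≡_ _≡_ ψ
    ψ-inj {i} {j} eq = suc-injective (φ-inj (punchOut-injective (v≢ i) (v≢ j) eq))

  -- For an adjacency function this is twice the number of edges.
  size : ∀ {n} → (Fin n → Fin n → Bool) → ℕ
  size a = sum (λ i → sum (λ j → 𝟙 (a i j)))

  Symm Irrefl : ∀ {n} → (Fin n → Fin n → Bool) → Set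
  Symm a = ∀ i j → a i j ≡ a j i
  Irrefl a = ∀ i → a i i ≡ false

  degree : ∀ {n} → (Fin n → Fin n → Bool) → Fin n → ℕ
  degree a v = sum (λ j → 𝟙 (a v j))

  size-remove : ∀ {n} (a : Fin (suc n) → Fin (suc n) → Bool) → Symm a → Irrefl a → ∀ v →
    size a ≡ size (λ i j → a (punchIn v i) (punchIn v j)) + (degree a v + degree a v)
  size-remove a a-sym a-irr v = begin
    size a                                             ≡⟨ sum-remove {i = v} (λ i → sum (λ j → 𝟙 (a i j))) ⟩
    d + sum (λ i → sum (λ j → 𝟙 (a (ι i) j)))          ≡⟨ cong (d +_) (sum-cong (λ i → sum-remove {i = v} (λ j → 𝟙 (a (ι i) j)))) ⟩
    d + sum (λ i → 𝟙 (a (ι i) v) + sum (λ j → 𝟙 (a (ι i) (ι j)))) ≡⟨ cong (d +_) (∑-distrib-+ (λ i → 𝟙 (a (ι i) v)) _) ⟩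
    d + (sum (λ i → 𝟙 (a (ι i) v)) + s)                ≡⟨ cong (λ z → d + (z + s)) col ⟩
    d + (d + s)                                        ≡⟨ +-assoc d d s ⟨
    d + d + s                                          ≡⟨ +-comm (d + d) s ⟩
    s + (d + d)                                        ∎
    where
    open ≡-Reasoning
    ι = punchIn v
    d = degree a v
    s = size (λ i j → a (ι i) (ι j))
    col : sum (λ i → 𝟙 (a (ι i) v)) ≡ d
    col = begin
      sum (λ i → 𝟙 (a (ι i) v))               ≡⟨ sum-cong (λ i → cong 𝟙 (a-sym (ι i) v)) ⟩
      sum (λ i → 𝟙 (a v (ι i)))               ≡⟨ cong (λ b → 𝟙 b + sum (λ i → 𝟙 (a v (ι i)))) (a-irr v) ⟨
      𝟙 (a v v) + sum (λ i → 𝟙 (a v (ι i)))   ≡⟨ sum-remove {i = v} (λ j → 𝟙 (a v j)) ⟨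
      d                                       ∎

-- Contraction of an edge.

module Contractions where

  open VanKampen using (Flat; joinʳ; joinˡ)
  open Counting
  open import Data.Nat using (_+_; _*_; _≤_; z≤n; s≤s)
  open import Data.Nat.Properties hiding (_≟_; suc-injective)
  open import Data.Nat.Tactic.RingSolver using (solve-∀)
  open import Data.Fin.Properties using (_≟_; punchInᵢ≢i; punchIn-injective)
  open import Data.Bool.Properties using (∨-comm)

  Flat-pullback : ∀ {m n} {a : Fin n → Fin n → Bool} {b : Fin m → Fin m → Bool} {φ : Fin m → Fin n} →
    Injective _≡_ _≡_ φ → (∀ i j → b i j ≡ true → a (φ i) (φ j) ≡ true) → Flat a → Flat b
  Flat-pullback {φ = φ} φ-inj sub F = record
    { _⊰_     = λ u v → φ u ⊰ φ v
    ; ⊰-total = λ u≢v → ⊰-total (u≢v ∘ φ-inj)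
    ; cut     = λ p u v → cut (φ p) (φ u) (φ v)
    ; even    = λ su sv tu tv st uv →
        even (su ∘ φ-inj) (sv ∘ φ-inj) (tu ∘ φ-inj) (tv ∘ φ-inj) (sub _ _ st) (sub _ _ uv)
    }
    where open Flat F

  false≢true : false ≢ true
  false≢true ()

  ¬true⇒false : ∀ {b} → b ≢ true → b ≡ false
  ¬true⇒false {true}  h = ⊥-elim (h refl)
  ¬true⇒false {false} h = refl

  ∧-true : ∀ {x y} → x ∧ y ≡ true → x ≡ true × y ≡ true
  ∧-true {true} h = refl , h

  ∨-true : ∀ {x y} → x ∨ y ≡ true → x ≡ true ⊎ y ≡ true
  ∨-true {true} h = inj₁ refl
  ∨-true {false} h = inj₂ h

  common : ∀ {n} → (Fin n → Fin n → Bool) → Fin n → Fin n → ℕ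
  common a u v = sum (λ j → 𝟙 (a u j ∧ a v j))

  module Contraction {n} (a : Fin (suc n) → Fin (suc n) → Bool) (a-sym : Symm a) (a-irr : Irrefl a)
    (v : Fin (suc n)) (u : Fin n) (edge : a v (punchIn v u) ≡ true) where

    private
      ι = punchIn v

    -- The edges at v that become new edges at u: the contracted edge disappears, and an edge to a
    -- common neighbour merges with one already there.
    transferred : Fin n → Bool
    transferred j = not (j == u) ∧ (a v (ι j) ∧ not (a (ι u) (ι j)))

    contract : Fin n → Fin n → Bool
    contract i j = a (ι i) (ι j) ∨ (((i == u) ∧ transferred j) ∨ ((j == u) ∧ transferred i))

    contract-sym : Symm contract
    contract-sym i j = cong₂ _∨_ (a-sym (ι i) (ι j)) (∨-comm ((i == u) ∧ transferred j) _)

    contract-irr : Irrefl contract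
    contract-irr i rewrite a-irr (ι i) with i ≟ u
    ... | yes _ = refl
    ... | no _ = refl

    -- An edge of the contracted graph is drawn either as it was or as a path through v.
    data Route (i j : Fin n) : Set where
      direct : a (ι i) (ι j) ≡ true → Route i j
      via    : i ≡ u → a v (ι j) ≡ true → Route i j
      via′   : j ≡ u → a (ι i) v ≡ true → Route i j
      none   : contract i j ≡ false → Route i j

    route : ∀ i j → Route i j
    route i j with contract i j in eq
    ... | false = none eq
    ... | true with ∨-true {a (ι i) (ι j)} eq
    ...   | inj₁ p = direct p
    ...   | inj₂ q with ∨-true {(i == u) ∧ transferred j} q
    ...     | inj₁ r = let i≡u , s = ∧-true {i == u} r in
                       via (==⇒≡ i≡u) (proj₁ (∧-true (proj₂ (∧-true {not (j == u)} s))))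
    ...     | inj₂ r = let j≡u , s = ∧-true {j == u} r in
                       via′ (==⇒≡ j≡u) (trans (a-sym (ι i) v) (proj₁ (∧-true (proj₂ (∧-true {not (i == u)} s)))))

    -- Two independent edges cannot both run through v, since each would end in u. So at most one is
    -- a path of two old edges, both independent of the other edge, and their two identities add up
    -- to the required one.
    contract-flat : Flat a → Flat contract
    contract-flat F = record
      { _⊰_     = λ i j → ι i ⊰ ι j
      ; ⊰-total = λ i≢j → ⊰-total (i≢j ∘ punchIn-injective v _ _)
      ; cut     = λ p i j → cutRoute p (route i j)
      ; even    = λ {s} {t} {i} {j} si sj ti tj st ij → evenRoute (route s t) (route i j) si sj ti tj st ij
      }
      where
      open Flat F
      cutRoute : Fin n → ∀ {i j} → Route i j → Bool
      cutRoute p {i} {j} (direct _) = cut (ι p) (ι i) (ι j)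
      cutRoute p {i} {j} (via _ _)  = cut (ι p) (ι u) v xor cut (ι p) v (ι j)
      cutRoute p {i} {j} (via′ _ _) = cut (ι p) (ι i) v xor cut (ι p) v (ι u)
      cutRoute p (none _) = false
      ι≢ : ∀ {i j} → i ≢ j → ι i ≢ ι j
      ι≢ i≢j = i≢j ∘ punchIn-injective v _ _
      ≢v : ∀ {i} → ι i ≢ v
      ≢v {i} = punchInᵢ≢i v i
      v≢ : ∀ {i} → v ≢ ι i
      v≢ {i} = punchInᵢ≢i v i ∘ sym
      edge′ : a (ι u) v ≡ true
      edge′ = trans (a-sym (ι u) v) edge
      evenRoute : ∀ {s t i j} (R : Route s t) (S : Route i j) → s ≢ i → s ≢ j → t ≢ i → t ≢ j →
        contract s t ≡ true → contract i j ≡ true →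
        (cutRoute s S xor cutRoute t S) xor (cutRoute i R xor cutRoute j R) ≡
        ((ι s ⊰ ι i) xor (ι s ⊰ ι j)) xor ((ι t ⊰ ι i) xor (ι t ⊰ ι j))
      evenRoute (none p) _ _ _ _ _ q _ with trans (sym p) q
      ... | ()
      evenRoute (direct _) (none p) _ _ _ _ _ q with trans (sym p) q
      ... | ()
      evenRoute (via _ _) (none p) _ _ _ _ _ q with trans (sym p) q
      ... | ()
      evenRoute (via′ _ _) (none p) _ _ _ _ _ q with trans (sym p) q
      ... | ()
      evenRoute (via refl _) (via refl _) si _ _ _ _ _ = ⊥-elim (si refl)
      evenRoute (via refl _) (via′ refl _) _ sj _ _ _ _ = ⊥-elim (sj refl)
      evenRoute (via′ refl _) (via refl _) _ _ ti _ _ _ = ⊥-elim (ti refl)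
      evenRoute (via′ refl _) (via′ refl _) _ _ _ tj _ _ = ⊥-elim (tj refl)
      evenRoute (direct st) (direct ij) si sj ti tj _ _ = even (ι≢ si) (ι≢ sj) (ι≢ ti) (ι≢ tj) st ij
      evenRoute {s} {t} {i} {j} (direct st) (via refl vj) si sj ti tj _ _ =
        joinʳ (cut (ι s) (ι u) v) (cut (ι t) (ι u) v) (cut (ι s) v (ι j)) (cut (ι t) v (ι j))
          (cut (ι u) (ι s) (ι t)) (cut v (ι s) (ι t)) (cut (ι j) (ι s) (ι t))
          (ι s ⊰ ι u) (ι s ⊰ v) (ι t ⊰ ι u) (ι t ⊰ v) (ι s ⊰ ι j) (ι t ⊰ ι j)
          (even (ι≢ si) ≢v (ι≢ ti) ≢v st edge′) (even ≢v (ι≢ sj) ≢v (ι≢ tj) st vj)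
      evenRoute {s} {t} {i} {j} (direct st) (via′ refl iv) si sj ti tj _ _ =
        joinʳ (cut (ι s) (ι i) v) (cut (ι t) (ι i) v) (cut (ι s) v (ι u)) (cut (ι t) v (ι u))
          (cut (ι i) (ι s) (ι t)) (cut v (ι s) (ι t)) (cut (ι u) (ι s) (ι t))
          (ι s ⊰ ι i) (ι s ⊰ v) (ι t ⊰ ι i) (ι t ⊰ v) (ι s ⊰ ι u) (ι t ⊰ ι u)
          (even (ι≢ si) ≢v (ι≢ ti) ≢v st iv) (even ≢v (ι≢ sj) ≢v (ι≢ tj) st edge)
      evenRoute {s} {t} {i} {j} (via refl vt) (direct ij) si sj ti tj _ _ =
        joinˡ (cut (ι u) (ι i) (ι j)) (cut v (ι i) (ι j)) (cut (ι t) (ι i) (ι j))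
          (cut (ι i) (ι u) v) (cut (ι j) (ι u) v) (cut (ι i) v (ι t)) (cut (ι j) v (ι t))
          (ι u ⊰ ι i) (ι u ⊰ ι j) (v ⊰ ι i) (v ⊰ ι j) (ι t ⊰ ι i) (ι t ⊰ ι j)
          (even (ι≢ si) (ι≢ sj) v≢ v≢ edge′ ij) (even v≢ v≢ (ι≢ ti) (ι≢ tj) vt ij)
      evenRoute {s} {t} {i} {j} (via′ refl sv) (direct ij) si sj ti tj _ _ =
        joinˡ (cut (ι s) (ι i) (ι j)) (cut v (ι i) (ι j)) (cut (ι u) (ι i) (ι j))
          (cut (ι i) (ι s) v) (cut (ι j) (ι s) v) (cut (ι i) v (ι u)) (cut (ι j) v (ι u))
          (ι s ⊰ ι i) (ι s ⊰ ι j) (v ⊰ ι i) (v ⊰ ι j) (ι u ⊰ ι i) (ι u ⊰ ι j)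
          (even (ι≢ si) (ι≢ sj) v≢ v≢ sv ij) (even v≢ v≢ (ι≢ ti) (ι≢ tj) edge ij)

    private
      E = sum (𝟙 ∘ transferred)
      rest = size (λ i j → a (ι i) (ι j))
      c = common a v (ι u)

    size-contract : rest + (E + E) ≤ size contract
    size-contract = begin
      rest + (E + E)                                        ≡⟨ +-assoc rest E E ⟨
      rest + E + E                                          ≡⟨ cong₂ (λ x y → rest + x + y) second third ⟨
      rest + sum (λ i → sum (λ j → 𝟙 (i == u) * 𝟙 (transferred j))) + sum (λ i → sum (λ j → 𝟙 (j == u) * 𝟙 (transferred i)))
        ≡⟨ sum-distrib₃ (λ i → sum (λ j → 𝟙 (a (ι i) (ι j)))) (λ i → sum (λ j → 𝟙 (i == u) * 𝟙 (transferred j))) _ ⟨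
      sum (λ i → sum (λ j → 𝟙 (a (ι i) (ι j))) + sum (λ j → 𝟙 (i == u) * 𝟙 (transferred j)) + sum (λ j → 𝟙 (j == u) * 𝟙 (transferred i)))
        ≡⟨ sum-cong (λ i → sum-distrib₃ (λ j → 𝟙 (a (ι i) (ι j))) (λ j → 𝟙 (i == u) * 𝟙 (transferred j)) _) ⟨
      sum (λ i → sum (λ j → 𝟙 (a (ι i) (ι j)) + 𝟙 (i == u) * 𝟙 (transferred j) + 𝟙 (j == u) * 𝟙 (transferred i)))
        ≤⟨ sum-mono (λ i → sum-mono (pointwise i)) ⟩
      size contract                                         ∎
      where
      open ≤-Reasoning
      third : sum (λ i → sum (λ j → 𝟙 (j == u) * 𝟙 (transferred i))) ≡ E
      third = sum-cong (λ i → sum-point u (λ _ → 𝟙 (transferred i)))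
      second : sum (λ i → sum (λ j → 𝟙 (i == u) * 𝟙 (transferred j))) ≡ E
      second = trans (∑-comm (λ i j → 𝟙 (i == u) * 𝟙 (transferred j))) third
      pointwise : ∀ i j → 𝟙 (a (ι i) (ι j)) + 𝟙 (i == u) * 𝟙 (transferred j) + 𝟙 (j == u) * 𝟙 (transferred i) ≤ 𝟙 (contract i j)
      pointwise i j with i ≟ u | j ≟ u
      pointwise i j | yes refl | yes refl rewrite a-irr (ι i) = z≤n
      pointwise i j | yes refl | no _ with a (ι i) (ι j) | a v (ι j)
      ... | true  | true  = s≤s z≤n
      ... | true  | false = s≤s z≤n
      ... | false | true  = s≤s z≤n
      ... | false | false = z≤n
      pointwise i j | no _ | yes refl with a (ι i) (ι j) | a (ι j) (ι i) | a-sym (ι i) (ι j) | a v (ι i)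
      ... | true  | true  | refl | true  = s≤s z≤n
      ... | true  | true  | refl | false = s≤s z≤n
      ... | false | false | refl | true  = s≤s z≤n
      ... | false | false | refl | false = z≤n
      pointwise i j | no _ | no _ with a (ι i) (ι j)
      ... | true  = s≤s z≤n
      ... | false = z≤n

    degree-contracted : degree a v ≤ 1 + E + c
    degree-contracted = begin
      degree a v                                 ≡⟨ sum-remove {i = v} (λ j → 𝟙 (a v j)) ⟩
      𝟙 (a v v) + sum (λ j → 𝟙 (a v (ι j)))      ≡⟨ cong (λ b → 𝟙 b + sum (λ j → 𝟙 (a v (ι j)))) (a-irr v) ⟩
      sum (λ j → 𝟙 (a v (ι j)))                  ≤⟨ sum-mono pointwise ⟩
      sum (λ j → 𝟙 (j == u) + 𝟙 (transferred j) + 𝟙 (a v (ι j) ∧ a (ι u) (ι j)))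
        ≡⟨ sum-distrib₃ (λ j → 𝟙 (j == u)) (𝟙 ∘ transferred) _ ⟩
      sum (λ j → 𝟙 (j == u)) + E + c′            ≡⟨ cong (λ z → z + E + c′) (sum-indicator u) ⟩
      1 + E + c′                                 ≤⟨ +-monoʳ-≤ (1 + E) (m≤n+m c′ (𝟙 (a v v ∧ a (ι u) v))) ⟩
      1 + E + (𝟙 (a v v ∧ a (ι u) v) + c′)       ≡⟨ cong (1 + E +_) (sum-remove {i = v} (λ j → 𝟙 (a v j ∧ a (ι u) j))) ⟨
      1 + E + c                                  ∎
      where
      open ≤-Reasoning
      c′ = sum (λ j → 𝟙 (a v (ι j) ∧ a (ι u) (ι j)))
      pointwise : ∀ j → 𝟙 (a v (ι j)) ≤ 𝟙 (j == u) + 𝟙 (transferred j) + 𝟙 (a v (ι j) ∧ a (ι u) (ι j))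
      pointwise j with j ≟ u | a v (ι j) | a (ι u) (ι j)
      ... | yes _ | true  | _     = s≤s z≤n
      ... | yes _ | false | _     = z≤n
      ... | no _  | true  | true  = s≤s z≤n
      ... | no _  | true  | false = s≤s z≤n
      ... | no _  | false | _     = z≤n

    -- In numbers of edges the loss is at most 1 + c: the contracted edge and one edge for each
    -- triangle on it.
    size≤contract : size a ≤ size contract + (2 + 2 * c)
    size≤contract = begin
      size a                               ≡⟨ size-remove a a-sym a-irr v ⟩
      rest + (degree a v + degree a v)     ≤⟨ +-monoʳ-≤ rest (+-mono-≤ degree-contracted degree-contracted) ⟩
      rest + (1 + E + c + (1 + E + c))     ≡⟨ arith rest E c ⟩
      rest + (E + E) + (2 + 2 * c)         ≤⟨ +-monoˡ-≤ (2 + 2 * c) size-contract ⟩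
      size contract + (2 + 2 * c)          ∎
      where
      open ≤-Reasoning
      arith : ∀ r E c → r + (1 + E + c + (1 + E + c)) ≡ r + (E + E) + (2 + 2 * c)
      arith = solve-∀

-- The bound 3n - 6.

module PlanarBound where

  open VanKampen using (Flat)
  open Kuratowski using (complete; bipartite; K₅-not-flat; K₃₃-not-flat)
  open Counting
  open Contractions
  open import Data.Nat using (_+_; _*_; _≤_; _<_; _≤?_; z≤n; s≤s)
  open import Data.Nat.Properties hiding (_≟_; suc-injective)
  open import Data.Nat.Tactic.RingSolver using (solve-∀)
  open import Data.Fin.Properties using (_≟_; punchInᵢ≢i; punchIn-injective; any?; punchIn-punchOut)
  import Data.Bool.Properties as Bool
  open import Data.Vec.Functional using (_∷_)
  open import Relation.Nullary.Decidable using (_×-dec_; ¬?)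

  ∷-injective : ∀ {m n} {x : Fin n} {φ : Fin m → Fin n} → (∀ i → φ i ≢ x) →
    Injective _≡_ _≡_ φ → Injective _≡_ _≡_ (x ∷ φ)
  ∷-injective x∉ φ-inj {Fin.zero}  {Fin.zero}  _ = refl
  ∷-injective x∉ φ-inj {Fin.zero}  {Fin.suc j} p = ⊥-elim (x∉ j (sym p))
  ∷-injective x∉ φ-inj {Fin.suc i} {Fin.zero}  p = ⊥-elim (x∉ i p)
  ∷-injective x∉ φ-inj {Fin.suc i} {Fin.suc j} p = cong Fin.suc (φ-inj p)

  row-bound : ∀ {n} (f : Fin n → Bool) p → f p ≡ false → sum (𝟙 ∘ f) + 1 ≤ n
  row-bound {n} f p fp = begin
    sum (𝟙 ∘ f) + 1                                  ≡⟨ cong (sum (𝟙 ∘ f) +_) (sum-indicator p) ⟨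
    sum (𝟙 ∘ f) + sum (λ i → 𝟙 (i == p))             ≡⟨ ∑-distrib-+ (𝟙 ∘ f) _ ⟨
    sum (λ i → 𝟙 (f i) + 𝟙 (i == p))                 ≤⟨ sum-mono pointwise ⟩
    sum {n} (λ _ → 1)                                ≡⟨ trans (sum-const n 1) (*-identityʳ n) ⟩
    n                                                ∎
    where
    open ≤-Reasoning
    pointwise : ∀ i → 𝟙 (f i) + 𝟙 (i == p) ≤ 1
    pointwise i with i ≟ p
    ... | yes refl rewrite fp = ≤-refl
    ... | no _ = subst (_≤ 1) (sym (+-identityʳ (𝟙 (f i)))) (𝟙≤1 (f i))

  row-bound₂ : ∀ {n} (f : Fin n → Bool) {p q} → p ≢ q → f p ≡ false → f q ≡ false → sum (𝟙 ∘ f) + 2 ≤ n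
  row-bound₂ {n} f {p} {q} p≢q fp fq = begin
    sum (𝟙 ∘ f) + 2                                  ≡⟨ cong (sum (𝟙 ∘ f) +_) (cong₂ _+_ (sum-indicator p) (sum-indicator q)) ⟨
    sum (𝟙 ∘ f) + (sum (λ i → 𝟙 (i == p)) + sum (λ i → 𝟙 (i == q))) ≡⟨ +-assoc (sum (𝟙 ∘ f)) _ _ ⟨
    sum (𝟙 ∘ f) + sum (λ i → 𝟙 (i == p)) + sum (λ i → 𝟙 (i == q)) ≡⟨ sum-distrib₃ (𝟙 ∘ f) (λ i → 𝟙 (i == p)) _ ⟨
    sum (λ i → 𝟙 (f i) + 𝟙 (i == p) + 𝟙 (i == q))    ≤⟨ sum-mono pointwise ⟩
    sum {n} (λ _ → 1)                                ≡⟨ trans (sum-const n 1) (*-identityʳ n) ⟩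
    n                                                ∎
    where
    open ≤-Reasoning
    pointwise : ∀ i → 𝟙 (f i) + 𝟙 (i == p) + 𝟙 (i == q) ≤ 1
    pointwise i with i ≟ p | i ≟ q
    ... | yes refl | yes refl = ⊥-elim (p≢q refl)
    ... | yes refl | no _ rewrite fp = ≤-refl
    ... | no _ | yes refl rewrite fq = ≤-refl
    ... | no _ | no _ = subst (_≤ 1) (sym (trans (+-identityʳ _) (+-identityʳ (𝟙 (f i))))) (𝟙≤1 (f i))

  row-bound₃ : ∀ {n} (f : Fin n → Bool) {p q r} → p ≢ q → r ≢ p → r ≢ q →
    f p ≡ false → f q ≡ false → f r ≡ false → sum (𝟙 ∘ f) + 3 ≤ n
  row-bound₃ {n} f {p} {q} {r} p≢q r≢p r≢q fp fq fr = begin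
    sum (𝟙 ∘ f) + 3          ≡⟨ +-assoc (sum (𝟙 ∘ f)) 1 2 ⟨
    sum (𝟙 ∘ f) + 1 + 2      ≡⟨ cong (λ z → sum (𝟙 ∘ f) + z + 2) (sum-indicator r) ⟨
    sum (𝟙 ∘ f) + sum (λ i → 𝟙 (i == r)) + 2 ≡⟨ cong (_+ 2) (∑-distrib-+ (𝟙 ∘ f) _) ⟨
    sum (λ i → 𝟙 (f i) + 𝟙 (i == r)) + 2 ≡⟨ cong (_+ 2) (sum-cong pointwise) ⟩
    sum (𝟙 ∘ g) + 2          ≤⟨ row-bound₂ g p≢q gp gq ⟩
    n                        ∎
    where
    open ≤-Reasoning
    g : Fin n → Bool
    g i = f i ∨ (i == r)
    gp : g p ≡ false
    gp rewrite fp = ==-≢ (r≢p ∘ sym)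
    gq : g q ≡ false
    gq rewrite fq = ==-≢ (r≢q ∘ sym)
    pointwise : ∀ i → 𝟙 (f i) + 𝟙 (i == r) ≡ 𝟙 (g i)
    pointwise i with i ≟ r
    ... | yes refl rewrite fr = refl
    ... | no _ with f i
    ...   | true = refl
    ...   | false = refl

  -- In the complement all degrees are at most one. Hence a vertex and its non-neighbour are both
  -- joined to the other three; if neither 0 nor 1 has a non-neighbour, these two serve.
  twoHubs : (b : Fin 5 → Fin 5 → Bool) → Symm b → Irrefl b → (∀ i → 3 ≤ sum (𝟙 ∘ b i)) →
    ∃₂ λ p q → p ≢ q × (∀ r → r ≢ p → r ≢ q → b p r ≡ true × b q r ≡ true)
  twoHubs b b-sym b-irr rows = helper (non-neighbour? 0F) (non-neighbour? 1F)
    where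
    non-neighbour? : ∀ p → Dec (∃ λ q → p ≢ q × b p q ≡ false)
    non-neighbour? p = any? (λ q → ¬? (p ≟ q) ×-dec (b p q Bool.≟ false))
    others : ∀ {p q r} → p ≢ q → r ≢ p → r ≢ q → b p q ≡ false → b p r ≡ true
    others {p} {q} {r} p≢q r≢p r≢q pq with b p r in pr
    ... | true = refl
    ... | false = ⊥-elim (<-irrefl refl (≤-trans (+-monoˡ-≤ 3 (rows p)) (row-bound₃ (b p) p≢q r≢p r≢q (b-irr p) pq pr)))
    full : ∀ {p} → ¬ (∃ λ q → p ≢ q × b p q ≡ false) → ∀ r → r ≢ p → b p r ≡ true
    full {p} none r r≢p with b p r in pr
    ... | true = refl
    ... | false = ⊥-elim (none (r , r≢p ∘ sym , pr))
    pair : ∀ {p q} → p ≢ q → b p q ≡ false → ∀ r → r ≢ p → r ≢ q → b p r ≡ true × b q r ≡ true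
    pair p≢q pq r r≢p r≢q = others p≢q r≢p r≢q pq , others (p≢q ∘ sym) r≢q r≢p (trans (b-sym _ _) pq)
    helper : Dec (∃ λ q → 0F ≢ q × b 0F q ≡ false) → Dec (∃ λ q → 1F ≢ q × b 1F q ≡ false) → _
    helper (yes (q , 0≢q , 0q)) _ = 0F , q , 0≢q , pair 0≢q 0q
    helper (no _) (yes (q , 1≢q , 1q)) = 1F , q , 1≢q , pair 1≢q 1q
    helper (no ¬0) (no ¬1) = 0F , 1F , (λ ()) , λ r r≢0 r≢1 → full ¬0 r r≢0 , full ¬1 r r≢1

  module _ {n} (a : Fin n → Fin n → Bool) (a-sym : Symm a) (a-irr : Irrefl a) (F : Flat a) where

    -- Minimum degree three on four vertices forces K₄, which together with x is K₅.
    no-K₁⊕K₄ : ∀ x (e : Fin 4 → Fin n) → Injective _≡_ _≡_ e → (∀ i → a x (e i) ≡ true) →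
      ¬ (∀ i → 3 ≤ sum (λ j → 𝟙 (a (e i) (e j))))
    no-K₁⊕K₄ x e e-inj xe rows = K₅-not-flat (Flat-pullback (∷-injective e≢x e-inj) adjacent F)
      where
      e≢x : ∀ i → e i ≢ x
      e≢x i refl with trans (sym (a-irr x)) (xe i)
      ... | ()
      adjacent : ∀ i j → complete i j ≡ true → a ((x ∷ e) i) ((x ∷ e) j) ≡ true
      adjacent 0F 0F ()
      adjacent 0F (Fin.suc j) _ = xe j
      adjacent (Fin.suc i) 0F _ = trans (a-sym (e i) x) (xe i)
      adjacent (Fin.suc i) (Fin.suc j) i≠j with a (e i) (e j) in ij
      ... | true = refl
      ... | false = ⊥-elim (<-irrefl refl (≤-trans (+-monoˡ-≤ 2 (rows i)) (row-bound₂ (λ j → a (e i) (e j)) i≢j (a-irr (e i)) ij)))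
        where
        i≢j : i ≢ j
        i≢j refl with trans (sym (complete-irr (Fin.suc i))) i≠j
          where
          complete-irr : ∀ i → complete i i ≡ false
          complete-irr i with i ≟ i
          ... | yes _ = refl
          ... | no i≢i = ⊥-elim (i≢i refl)
        ... | ()

    -- x and the two hubs form one side of K₃,₃, the other three neighbours of x the second.
    no-K₁⊕wheel : ∀ x (e : Fin 5 → Fin n) → Injective _≡_ _≡_ e → (∀ i → a x (e i) ≡ true) →
      ¬ (∀ i → 3 ≤ sum (λ j → 𝟙 (a (e i) (e j))))
    no-K₁⊕wheel x e e-inj xe rows
      with twoHubs (λ i j → a (e i) (e j)) (λ i j → a-sym (e i) (e j)) (λ i → a-irr (e i)) rows
    ... | p , q , p≢q , hubs = K₃₃-not-flat (Flat-pullback (∷-injective e≢x (h-inj ∘ e-inj)) adjacent F)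
      where
      q′ : Fin 4
      q′ = Fin.punchOut p≢q
      r : Fin 3 → Fin 5
      r i = punchIn p (punchIn q′ i)
      h : Fin 5 → Fin 5
      h = p ∷ q ∷ r
      r≢q : ∀ i → r i ≢ q
      r≢q i eq = punchInᵢ≢i q′ i (punchIn-injective p _ _ (trans eq (sym (punchIn-punchOut p≢q))))
      r≢p : ∀ i → r i ≢ p
      r≢p i = punchInᵢ≢i p (punchIn q′ i)
      h-inj : Injective _≡_ _≡_ h
      h-inj = ∷-injective (λ { 0F → p≢q ∘ sym ; (Fin.suc i) → r≢p i })
        (∷-injective r≢q (punchIn-injective q′ _ _ ∘ punchIn-injective p _ _))
      e≢x : ∀ i → e (h i) ≢ x
      e≢x i eq with trans (sym (a-irr x)) (trans (cong (a x) (sym eq)) (xe (h i)))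
      ... | ()
      g : Fin 6 → Fin n
      g = x ∷ (e ∘ h)
      half : ∀ (i : Fin 3) (j : Fin 3) → a (g (i Fin.↑ˡ 3)) (g (3 Fin.↑ʳ j)) ≡ true
      half 0F j = xe (r j)
      half 1F j = proj₁ (hubs (r j) (r≢p j) (r≢q j))
      half 2F j = proj₂ (hubs (r j) (r≢p j) (r≢q j))
      adjacent : ∀ i j → bipartite i j ≡ true → a (g i) (g j) ≡ true
      adjacent 0F (Fin.suc (Fin.suc (Fin.suc j))) _ = half 0F j
      adjacent 1F (Fin.suc (Fin.suc (Fin.suc j))) _ = half 1F j
      adjacent 2F (Fin.suc (Fin.suc (Fin.suc j))) _ = half 2F j
      adjacent (Fin.suc (Fin.suc (Fin.suc i))) 0F _ = trans (a-sym _ _) (half 0F i)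
      adjacent (Fin.suc (Fin.suc (Fin.suc i))) 1F _ = trans (a-sym _ _) (half 1F i)
      adjacent (Fin.suc (Fin.suc (Fin.suc i))) 2F _ = trans (a-sym _ _) (half 2F i)

    -- Inside the neighbourhood of x, the degree of a neighbour is the number of triangles on its
    -- edge to x. So all degrees there are at least three, which requires four vertices, and four or
    -- five of them yield K₅ or K₃,₃.
    edge-in-few-triangles : ∀ x → 0 < degree a x → degree a x ≤ 5 → ¬ (∀ u v → a u v ≡ true → 3 ≤ common a u v)
    edge-in-few-triangles x 0<deg deg≤5 triangles = helper (degree a x) 0<deg deg≤5 (proj₁ E) (proj₁ (proj₂ E)) sat
      (λ i → subst (3 ≤_) (proj₂ (proj₂ (proj₂ E)) (a (proj₁ E i))) (triangles x (proj₁ E i) (sat i)))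
      where
      E = enumerate (a x)
      sat = proj₁ (proj₂ (proj₂ E))
      few : ∀ d (e : Fin (suc d) → Fin n) → suc d ≤ 3 → ¬ (∀ i → 3 ≤ sum (λ j → 𝟙 (a (e i) (e j))))
      few d e d≤3 rows = <-irrefl refl
        (≤-trans (+-monoˡ-≤ 1 (rows 0F)) (≤-trans (row-bound (λ j → a (e 0F) (e j)) 0F (a-irr (e 0F))) d≤3))
      helper : ∀ d → 0 < d → d ≤ 5 → (e : Fin d → Fin n) → Injective _≡_ _≡_ e → (∀ i → a x (e i) ≡ true) →
        ¬ (∀ i → 3 ≤ sum (λ j → 𝟙 (a (e i) (e j))))
      helper 1 _ _ e _ _ = few 0 e (s≤s z≤n)
      helper 2 _ _ e _ _ = few 1 e (s≤s (s≤s z≤n))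
      helper 3 _ _ e _ _ = few 2 e ≤-refl
      helper 4 _ _ e e-inj xe = no-K₁⊕K₄ x e e-inj xe
      helper 5 _ _ e e-inj xe = no-K₁⊕wheel x e e-inj xe
      helper (suc (suc (suc (suc (suc (suc d)))))) _ (s≤s (s≤s (s≤s (s≤s (s≤s ()))))) e e-inj xe

  module Deletion {n} (a : Fin n → Fin n → Bool) (a-sym : Symm a) {u v : Fin n} (u≢v : u ≢ v) (edge : a u v ≡ true) where

    delete : Fin n → Fin n → Bool
    delete i j = a i j ∧ not (((i == u) ∧ (j == v)) ∨ ((j == u) ∧ (i == v)))

    delete-sym : Symm delete
    delete-sym i j = cong₂ (λ x y → x ∧ not y) (a-sym i j) (Bool.∨-comm ((i == u) ∧ (j == v)) _)

    delete-⊆ : ∀ i j → delete i j ≡ true → a i j ≡ true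
    delete-⊆ i j h = proj₁ (∧-true {a i j} h)

    size-delete : size a ≡ size delete + 2
    size-delete = begin
      size a ≡⟨ sum-cong (λ i → sum-cong (pointwise i)) ⟩
      sum (λ i → sum (λ j → 𝟙 (delete i j) + 𝟙 (i == u) * 𝟙 (j == v) + 𝟙 (j == u) * 𝟙 (i == v)))
        ≡⟨ sum-cong (λ i → sum-distrib₃ (λ j → 𝟙 (delete i j)) (λ j → 𝟙 (i == u) * 𝟙 (j == v)) _) ⟩
      sum (λ i → sum (λ j → 𝟙 (delete i j)) + sum (λ j → 𝟙 (i == u) * 𝟙 (j == v)) + sum (λ j → 𝟙 (j == u) * 𝟙 (i == v)))
        ≡⟨ sum-distrib₃ (λ i → sum (λ j → 𝟙 (delete i j))) (λ i → sum (λ j → 𝟙 (i == u) * 𝟙 (j == v))) _ ⟩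
      size delete + sum (λ i → sum (λ j → 𝟙 (i == u) * 𝟙 (j == v))) + sum (λ i → sum (λ j → 𝟙 (j == u) * 𝟙 (i == v)))
        ≡⟨ cong₂ (λ x y → size delete + x + y) (trans (∑-comm (λ i j → 𝟙 (i == u) * 𝟙 (j == v))) (one v)) (one v) ⟩
      size delete + 1 + 1 ≡⟨ +-assoc (size delete) 1 1 ⟩
      size delete + 2 ∎
      where
      open ≡-Reasoning
      one : ∀ v → sum (λ i → sum (λ j → 𝟙 (j == u) * 𝟙 (i == v))) ≡ 1
      one v = trans (sum-cong (λ i → sum-point u (λ _ → 𝟙 (i == v)))) (sum-indicator v)
      pointwise : ∀ i j → 𝟙 (a i j) ≡ 𝟙 (delete i j) + 𝟙 (i == u) * 𝟙 (j == v) + 𝟙 (j == u) * 𝟙 (i == v)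
      pointwise i j with i ≟ u | j ≟ v | j ≟ u | i ≟ v
      ... | yes refl | _ | _ | yes refl = ⊥-elim (u≢v refl)
      ... | _ | yes refl | yes refl | _ = ⊥-elim (u≢v refl)
      ... | yes refl | yes refl | no _ | no _ rewrite edge = refl
      ... | no _ | no _ | yes refl | yes refl rewrite a-sym i j | edge = refl
      ... | yes _ | no _ | yes _ | no _ rewrite Bool.∧-identityʳ (a i j) = sym (trans (+-identityʳ _) (+-identityʳ _))
      ... | yes _ | no _ | no _ | no _ rewrite Bool.∧-identityʳ (a i j) = sym (trans (+-identityʳ _) (+-identityʳ _))
      ... | no _ | yes _ | no _ | yes _ rewrite Bool.∧-identityʳ (a i j) = sym (trans (+-identityʳ _) (+-identityʳ _))
      ... | no _ | yes _ | no _ | no _ rewrite Bool.∧-identityʳ (a i j) = sym (trans (+-identityʳ _) (+-identityʳ _))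
      ... | no _ | no _ | yes _ | no _ rewrite Bool.∧-identityʳ (a i j) = sym (trans (+-identityʳ _) (+-identityʳ _))
      ... | no _ | no _ | no _ | yes _ rewrite Bool.∧-identityʳ (a i j) = sym (trans (+-identityʳ _) (+-identityʳ _))
      ... | no _ | no _ | no _ | no _ rewrite Bool.∧-identityʳ (a i j) = sym (trans (+-identityʳ _) (+-identityʳ _))

  -- Twice the inequality e ≤ 3N - 6 on N = 3 + n vertices. The outer induction is on the number of
  -- vertices, the inner one, `by-size`, on a bound for `size`.
  flat-size : ∀ n (a : Fin (3 + n) → Fin (3 + n) → Bool) → Symm a → Irrefl a → Flat a → size a + 12 ≤ 6 * (3 + n)
  flat-size zero a a-sym a-irr F = +-monoˡ-≤ 12 (sum-mono {f = λ i → degree a i} {g = λ _ → 2} (λ i → +-cancelʳ-≤ 1 _ _ (row-bound (a i) i (a-irr i))))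
  flat-size (suc n) a a-sym a-irr F = by-size (size a) a a-sym a-irr F ≤-refl
    where
    N = 4 + n
    6N : ∀ n → 6 * (3 + n) + 6 ≡ 6 * (4 + n)
    6N = solve-∀
    by-size : ∀ s (a : Fin N → Fin N → Bool) → Symm a → Irrefl a → Flat a → size a ≤ s → size a + 12 ≤ 6 * N
    by-size zero a _ _ _ size≤ = ≤-trans (+-monoˡ-≤ 12 size≤) (≤-trans (m≤m+n 12 (12 + 6 * n)) (≤-reflexive (arith n)))
      where
      arith : ∀ n → 12 + (12 + 6 * n) ≡ 6 * (4 + n)
      arith = solve-∀
    by-size (suc s) a a-sym a-irr F size≤ = helper
      (any? (λ u → any? (λ v → (a u v Bool.≟ true) ×-dec (common a u v ≤? 2))))
      (any? (λ x → degree a x ≤? 5))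
      where
      open ≤-Reasoning
      helper : Dec (∃ λ u → ∃ λ v → a u v ≡ true × common a u v ≤ 2) → Dec (∃ λ x → degree a x ≤ 5) → size a + 12 ≤ 6 * N
      -- The loss 2 + 2 * 2 in `size` equals the drop of 6N when a vertex disappears.
      helper (yes (v , u , edge , few)) _ = begin
        size a + 12                            ≤⟨ +-monoˡ-≤ 12 size≤contract ⟩
        size contract + (2 + 2 * common a v (punchIn v u′)) + 12 ≤⟨ +-monoˡ-≤ 12 (+-monoʳ-≤ (size contract) (+-monoʳ-≤ 2 (*-monoʳ-≤ 2 few′))) ⟩
        size contract + 6 + 12                 ≡⟨ arith (size contract) ⟩
        size contract + 12 + 6                 ≤⟨ +-monoˡ-≤ 6 (flat-size n contract contract-sym contract-irr (contract-flat F)) ⟩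
        6 * (3 + n) + 6                        ≡⟨ 6N n ⟩
        6 * N                                  ∎
        where
        v≢u : v ≢ u
        v≢u refl with trans (sym (a-irr v)) edge
        ... | ()
        u′ = Fin.punchOut v≢u
        ιu′≡u : punchIn v u′ ≡ u
        ιu′≡u = punchIn-punchOut v≢u
        few′ : common a v (punchIn v u′) ≤ 2
        few′ = subst (λ z → common a v z ≤ 2) (sym ιu′≡u) few
        open Contraction a a-sym a-irr v u′ (trans (cong (a v) ιu′≡u) edge)
        arith : ∀ s → s + 6 + 12 ≡ s + 12 + 6
        arith = solve-∀
      helper (no many) (yes (x , deg≤5)) with degree a x in deg
      ... | suc d = ⊥-elim (edge-in-few-triangles a a-sym a-irr F x (subst (0 <_) (sym deg) (s≤s z≤n)) (subst (_≤ 5) (sym deg) deg≤5)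
                     (λ u v uv → ≰⇒> (λ few → many (u , v , uv , few))))
      ... | zero = begin
        size a + 12                ≡⟨ cong (_+ 12) (trans (size-remove a a-sym a-irr x) (cong (size a∖x +_) (cong₂ _+_ deg deg))) ⟩
        size a∖x + 0 + 12          ≡⟨ cong (_+ 12) (+-identityʳ (size a∖x)) ⟩
        size a∖x + 12              ≤⟨ flat-size n a∖x (λ i j → a-sym _ _) (λ i → a-irr _)
                                      (Flat-pullback (punchIn-injective x _ _) (λ i j p → p) F) ⟩
        6 * (3 + n)                ≤⟨ m≤m+n _ 6 ⟩
        6 * (3 + n) + 6            ≡⟨ 6N n ⟩
        6 * N                      ∎
        where
        a∖x : Fin (3 + n) → Fin (3 + n) → Bool
        a∖x i j = a (punchIn x i) (punchIn x j)
      -- All degrees are at least six, so `size a` is at least 6N. Deleting one edge takes only two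
      -- from it, but by the inner induction at most 6N - 12 may remain.
      helper (no many) (no high) = ⊥-elim (<-irrefl refl (begin-strict
        6 * N                      ≡⟨ trans (*-comm 6 N) (sym (sum-const N 6)) ⟩
        sum {N} (λ _ → 6)          ≤⟨ sum-mono (λ x → ≰⇒> (λ low → high (x , low))) ⟩
        size a                     ≡⟨ size-delete ⟩
        size delete + 2            <⟨ +-monoʳ-< (size delete) (s≤s (s≤s (s≤s z≤n))) ⟩
        size delete + 12           ≤⟨ by-size s delete delete-sym delete-irr (Flat-pullback (λ p → p) delete-⊆ F) size-delete≤s ⟩
        6 * N                      ∎))
        where
        has-edge : ∃ λ v → a 0F v ≡ true
        has-edge = sum-positive (a 0F) (≤-trans (s≤s z≤n) (≰⇒> (λ low → high (0F , low))))
        0≢v : 0F ≢ proj₁ has-edge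
        0≢v eq with trans (sym (a-irr 0F)) (trans (cong (a 0F) eq) (proj₂ has-edge))
        ... | ()
        open Deletion a a-sym 0≢v (proj₂ has-edge)
        delete-irr : Irrefl delete
        delete-irr i rewrite a-irr i = refl
        size-delete≤s : size delete ≤ s
        size-delete≤s = +-cancelʳ-≤ 1 _ _ (≤-trans (+-monoʳ-≤ (size delete) (s≤s z≤n))
          (≤-trans (≤-reflexive (sym size-delete)) (≤-trans size≤ (≤-reflexive (+-comm 1 s)))))

-- A straight-line drawing of K₂ + P_m.

module Fans where

  open RationalOrder
  open Segments using (OnSeg-sym)
  open import Data.Nat using (_≡ᵇ_)
  import Data.Nat.Properties as ℕₚ
  open import Data.Fin.Properties using (toℕ-injective; toℕ<n)
  open import Data.Rational
  open import Data.Rational.Properties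
  open import Data.Bool using (T)
  open import Data.Bool.Properties using (∨-comm)
  import Tactic.RingSolver as RS

  2ℚ : ℚ
  2ℚ = 1ℚ + 1ℚ

  height : ℕ → ℚ
  height zero    = 1ℚ
  height (suc i) = height i + 1ℚ

  0<1 : 0ℚ < 1ℚ
  0<1 = positive⁻¹ 1ℚ

  1<2 : 1ℚ < 2ℚ
  1<2 = +-monoʳ-< 1ℚ 0<1

  height-pos : ∀ i → 0ℚ < height i
  height-pos zero    = 0<1
  height-pos (suc i) = 0<+0< (height-pos i) 0<1

  height-step : ∀ i → height i < height (suc i)
  height-step i = 0<-⇒< (subst (0ℚ <_) (lemma (height i)) 0<1)
    where
    lemma : ∀ h → 1ℚ ≡ h + 1ℚ - h
    lemma = RS.solve-∀ ℚring

  height-mono : ∀ {i j} → i ℕ.≤ j → height i ≤ height j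
  height-mono {i} i≤j = helper (ℕₚ.≤⇒≤′ i≤j)
    where
    helper : ∀ {j} → i ℕ.≤′ j → height i ≤ height j
    helper ℕ.≤′-refl = ≤-refl
    helper (ℕ.≤′-step {n = j} p) = ≤-trans (helper p) (<⇒≤ (height-step j))

  height-mono-< : ∀ {i j} → i ℕ.< j → height i < height j
  height-mono-< {i} i<j = <-≤-trans (height-step i) (height-mono i<j)

  height-cancel : ∀ {i j} → height i ≤ height j → i ℕ.≤ j
  height-cancel h = ℕₚ.≮⇒≥ (λ j<i → <-irrefl refl (<-≤-trans (height-mono-< j<i) h))

  height-injective : ∀ {i j} → height i ≡ height j → i ≡ j
  height-injective eq = ℕₚ.≤-antisym (height-cancel (≤-reflexive eq)) (height-cancel (≤-reflexive (sym eq)))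

  pattern path i = Fin.suc (Fin.suc i)

  -- K₂ + P_m.
  fanʳ : ∀ {m} → Fin (2 ℕ.+ m) → Fin (2 ℕ.+ m) → Bool
  fanʳ 0F       (Fin.suc _) = true
  fanʳ 1F       (path _)    = true
  fanʳ (path i) (path j)    = toℕ j ≡ᵇ suc (toℕ i)
  fanʳ _        _           = false

  fan : ∀ {m} → Fin (2 ℕ.+ m) → Fin (2 ℕ.+ m) → Bool
  fan i j = fanʳ i j ∨ fanʳ j i

  -- With the path stacked above the middle of the base, the edges at either base vertex have
  -- distinct slopes, and a slanted edge reaches the line x = 1 of the rungs only at its path
  -- vertex.
  fanPos : ∀ {m} → Fin (2 ℕ.+ m) → Pt
  fanPos 0F       = 0ℚ , 0ℚ
  fanPos 1F       = 2ℚ , 0ℚ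
  fanPos (path i) = 1ℚ , height (toℕ i)

  data FanEdge {m} : Fin (2 ℕ.+ m) → Fin (2 ℕ.+ m) → Set where
    base  : FanEdge 0F 1F
    left  : ∀ i → FanEdge 0F (path i)
    right : ∀ i → FanEdge 1F (path i)
    rung  : ∀ i j → toℕ j ≡ suc (toℕ i) → FanEdge (path i) (path j)

  fanEdge : ∀ {m} (i j : Fin (2 ℕ.+ m)) → fanʳ i j ≡ true → FanEdge i j
  fanEdge 0F 1F _ = base
  fanEdge 0F (path j) _ = left j
  fanEdge 1F (path j) _ = right j
  fanEdge (path i) (path j) h = rung i j (ℕₚ.≡ᵇ⇒≡ (toℕ j) (suc (toℕ i)) (subst T (sym h) tt))

  private
    variable
      m : ℕ
      i j k l : Fin (2 ℕ.+ m)

  -- The parameter of `OnSeg` is eliminated, so that every intersection reduces to a comparison of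
  -- slopes or heights.
  Locus : FanEdge i j → Pt → Set
  Locus base         (x , y) = 0ℚ ≤ x × x ≤ 2ℚ × y ≡ 0ℚ
  Locus (left i)     (x , y) = 0ℚ ≤ x × x ≤ 1ℚ × y ≡ height (toℕ i) * x
  Locus (right i)    (x , y) = 1ℚ ≤ x × x ≤ 2ℚ × y ≡ height (toℕ i) * (2ℚ - x)
  Locus (rung i _ _) (x , y) = x ≡ 1ℚ × height (toℕ i) ≤ y × y ≤ height (suc (toℕ i))

  locus : (e : FanEdge i j) → ∀ q → OnSeg q (fanPos i) (fanPos j) → Locus e q
  locus base (x , y) (t , 0≤t , t≤1 , xeq , yeq) =
    subst (0ℚ ≤_) (sym x≡2t) (0≤*0≤ (<⇒≤ (<-trans 0<1 1<2)) 0≤t) ,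
    subst (_≤ 2ℚ) (sym x≡2t) (≤-trans (*-monoˡ-≤-nonNeg 2ℚ t≤1) (≤-reflexive (*-identityʳ 2ℚ))) ,
    trans yeq (eq t)
    where
    eq′ : ∀ t → 0ℚ + t * (1ℚ + 1ℚ - 0ℚ) ≡ (1ℚ + 1ℚ) * t
    eq′ = RS.solve-∀ ℚring
    eq : ∀ t → 0ℚ + t * (0ℚ - 0ℚ) ≡ 0ℚ
    eq = RS.solve-∀ ℚring
    x≡2t : x ≡ 2ℚ * t
    x≡2t = trans xeq (eq′ t)
  locus (left i) (x , y) (t , 0≤t , t≤1 , xeq , yeq) =
    subst (0ℚ ≤_) (sym x≡t) 0≤t , subst (_≤ 1ℚ) (sym x≡t) t≤1 ,
    trans yeq (trans (eq₂ (height (toℕ i)) t) (cong (height (toℕ i) *_) (sym x≡t)))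
    where
    eq₁ : ∀ t → 0ℚ + t * (1ℚ - 0ℚ) ≡ t
    eq₁ = RS.solve-∀ ℚring
    eq₂ : ∀ h t → 0ℚ + t * (h - 0ℚ) ≡ h * t
    eq₂ = RS.solve-∀ ℚring
    x≡t = trans xeq (eq₁ t)
  locus (right i) (x , y) (t , 0≤t , t≤1 , xeq , yeq) =
    0≤-⇒≤ (subst (0ℚ ≤_) (trans (eq₃ t) (cong (_- 1ℚ) (sym x≡2-t))) (≤⇒0≤- t≤1)) ,
    0≤-⇒≤ (subst (0ℚ ≤_) t≡2-x 0≤t) ,
    trans yeq (trans (eq₂ (height (toℕ i)) t) (cong (height (toℕ i) *_) t≡2-x))
    where
    eq₁ : ∀ t → (1ℚ + 1ℚ) + t * (1ℚ - (1ℚ + 1ℚ)) ≡ (1ℚ + 1ℚ) - t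
    eq₁ = RS.solve-∀ ℚring
    eq₂ : ∀ h t → 0ℚ + t * (h - 0ℚ) ≡ h * t
    eq₂ = RS.solve-∀ ℚring
    eq₃ : ∀ t → 1ℚ - t ≡ (1ℚ + 1ℚ) - t - 1ℚ
    eq₃ = RS.solve-∀ ℚring
    eq₄ : ∀ t → t ≡ (1ℚ + 1ℚ) - ((1ℚ + 1ℚ) - t)
    eq₄ = RS.solve-∀ ℚring
    x≡2-t : x ≡ 2ℚ - t
    x≡2-t = trans xeq (eq₁ t)
    t≡2-x : t ≡ 2ℚ - x
    t≡2-x = trans (eq₄ t) (cong (λ z → 2ℚ - z) (sym x≡2-t))
  locus (rung i j eq) (x , y) (t , 0≤t , t≤1 , xeq , yeq) rewrite eq =
    trans xeq (eq₁ t) ,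
    subst (height (toℕ i) ≤_) (sym y≡) (≤-trans (≤-reflexive (sym (+-identityʳ _))) (+-monoʳ-≤ (height (toℕ i)) 0≤t)) ,
    subst (_≤ height (toℕ i) + 1ℚ) (sym y≡) (+-monoʳ-≤ (height (toℕ i)) t≤1)
    where
    eq₁ : ∀ t → 1ℚ + t * (1ℚ - 1ℚ) ≡ 1ℚ
    eq₁ = RS.solve-∀ ℚring
    eq₂ : ∀ h t → h + t * (h + 1ℚ - h) ≡ h + t
    eq₂ = RS.solve-∀ ℚring
    y≡ : y ≡ height (toℕ i) + t
    y≡ = trans yeq (eq₂ (height (toℕ i)) t)

  Meet : (i j k l : Fin (2 ℕ.+ m)) → Pt → Set
  Meet i j k l q = (i ≡ k × j ≡ l) ⊎ (∃ λ w → q ≡ fanPos w × (w ≡ i ⊎ w ≡ j) × (w ≡ k ⊎ w ≡ l))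

  Meet-swap : ∀ {q} → Meet i j k l q → Meet k l i j q
  Meet-swap (inj₁ (p , q)) = inj₁ (sym p , sym q)
  Meet-swap (inj₂ (w , p , q , r)) = inj₂ (w , p , r , q)

  private
    zero-factor : ∀ {h x} → 0ℚ < h → 0ℚ ≡ h * x → x ≡ 0ℚ
    zero-factor {h} {x} 0<h eq = *-cancel-0< 0<h (trans (*-comm x h) (trans (sym eq) (sym (*-zeroˡ h))))

    equal-slopes : ∀ {h h′ x} → h < h′ → h * x ≡ h′ * x → x ≡ 0ℚ
    equal-slopes {h} {h′} {x} h<h′ eq = zero-factor (<⇒0<- h<h′)
      (trans (sym (+-inverseʳ (h′ * x))) (trans (cong (λ z → h′ * x - z) (sym eq)) (lemma h h′ x)))
      where
      lemma : ∀ h h′ x → h′ * x - h * x ≡ (h′ - h) * x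
      lemma = RS.solve-∀ ℚring

    slopes : ∀ {m} (i j : Fin m) x y → y ≡ height (toℕ i) * x → y ≡ height (toℕ j) * x → i ≡ j ⊎ x ≡ 0ℚ × y ≡ 0ℚ
    slopes i j x y p q = helper (ℕₚ.<-cmp (toℕ i) (toℕ j))
      where
      origin : x ≡ 0ℚ → x ≡ 0ℚ × y ≡ 0ℚ
      origin x≡0 = x≡0 , trans p (trans (cong (height (toℕ i) *_) x≡0) (*-zeroʳ (height (toℕ i))))
      helper : _ → i ≡ j ⊎ x ≡ 0ℚ × y ≡ 0ℚ
      helper (tri< i<j _ _) = inj₂ (origin (equal-slopes {height (toℕ i)} {height (toℕ j)} {x} (height-mono-< i<j) (trans (sym p) q)))
      helper (tri≈ _ i≡j _) = inj₁ (toℕ-injective i≡j)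
      helper (tri> _ _ j<i) = inj₂ (origin (equal-slopes {height (toℕ j)} {height (toℕ i)} {x} (height-mono-< j<i) (trans (sym q) p)))

    on-rung : ∀ {m} (i j k : Fin m) → toℕ j ≡ suc (toℕ i) → height (toℕ i) ≤ height (toℕ k) →
      height (toℕ k) ≤ height (suc (toℕ i)) → k ≡ i ⊎ k ≡ j
    on-rung i j k eq i≤k k≤j = between (height-cancel {toℕ i} {toℕ k} i≤k) (height-cancel {toℕ k} {suc (toℕ i)} k≤j)
      where
      between : toℕ i ℕ.≤ toℕ k → toℕ k ℕ.≤ suc (toℕ i) → k ≡ i ⊎ k ≡ j
      between i≤k k≤j with ℕₚ.m≤n⇒m<n∨m≡n i≤k
      ... | inj₁ i<k = inj₂ (toℕ-injective (trans (ℕₚ.≤-antisym k≤j i<k) (sym eq)))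
      ... | inj₂ i≡k = inj₁ (toℕ-injective (sym i≡k))

    2-x≡0 : ∀ x → 2ℚ - x ≡ 0ℚ → x ≡ 2ℚ
    2-x≡0 x eq = sym (x-y≡0⇒x≡y {2ℚ} {x} eq)

    1-of : ∀ h → h * (1ℚ + 1ℚ - 1ℚ) ≡ h
    1-of = RS.solve-∀ ℚring

    ss : ∀ {m} {i j : Fin m} → i ≡ j → path i ≡ path j
    ss = cong (λ i → path i)

    ss⊎ : ∀ {m} {i j k : Fin m} → i ≡ j ⊎ i ≡ k → path i ≡ path j ⊎ path i ≡ path k
    ss⊎ = Data.Sum.map ss ss

  private
    meet-base : ∀ {m} {k l : Fin (2 ℕ.+ m)} (f : FanEdge k l) → ∀ q → Locus (base {m}) q → Locus f q → Meet 0F 1F k l q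
    meet-base base q _ _ = inj₁ (refl , refl)
    meet-base (left i) (x , y) (_ , _ , y≡0) (_ , _ , y≡hx) =
      inj₂ (0F , cong₂ _,_ (zero-factor (height-pos (toℕ i)) (trans (sym y≡0) y≡hx)) y≡0 , inj₁ refl , inj₁ refl)
    meet-base (right i) (x , y) (_ , _ , y≡0) (_ , _ , y≡hx) =
      inj₂ (1F , cong₂ _,_ (2-x≡0 x (zero-factor (height-pos (toℕ i)) (trans (sym y≡0) y≡hx))) y≡0 , inj₂ refl , inj₁ refl)
    meet-base (rung i _ _) (x , y) (_ , _ , refl) (_ , h≤0 , _) = ⊥-elim (0<⇒¬≤0 (height-pos (toℕ i)) h≤0)

    meet-left-right : ∀ (i j : Fin m) q → Locus (left i) q → Locus (right j) q →
      Meet 0F (path i) 1F (path j) q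
    meet-left-right i j (x , y) (_ , x≤1 , p) (1≤x , _ , q) = inj₂
      (path i , cong₂ _,_ x≡1 y≡i , inj₂ refl ,
       inj₂ (ss (toℕ-injective (height-injective (trans (sym y≡i) y≡j)))))
      where
      x≡1 = ≤-antisym x≤1 1≤x
      y≡i : y ≡ height (toℕ i)
      y≡i = trans p (trans (cong (height (toℕ i) *_) x≡1) (*-identityʳ (height (toℕ i))))
      y≡j : y ≡ height (toℕ j)
      y≡j = trans q (trans (cong (λ x → height (toℕ j) * (2ℚ - x)) x≡1) (1-of (height (toℕ j))))

    meet-rung : ∀ {v} (i j k : Fin m) (eq : toℕ j ≡ suc (toℕ i)) x y → y ≡ height (toℕ k) → Locus (rung i j eq) (x , y) →
      Meet v (path k) (path i) (path j) (x , y)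
    meet-rung i j k eq x y y≡ (x≡1 , i≤ , ≤j) =
      inj₂ (path k , cong₂ _,_ x≡1 y≡ , inj₂ refl ,
            ss⊎ (on-rung i j k eq (subst (height (toℕ i) ≤_) y≡ i≤) (subst (_≤ height (suc (toℕ i))) y≡ ≤j)))

    meet-left-rung : ∀ (i j k : Fin m) (eq : toℕ j ≡ suc (toℕ i)) q → Locus (left k) q → Locus (rung i j eq) q →
      Meet 0F (path k) (path i) (path j) q
    meet-left-rung i j k eq (x , y) (_ , _ , p) r = meet-rung i j k eq x y
      (trans p (trans (cong (height (toℕ k) *_) (proj₁ r)) (*-identityʳ (height (toℕ k))))) r

    meet-right-rung : ∀ (i j k : Fin m) (eq : toℕ j ≡ suc (toℕ i)) q → Locus (right k) q → Locus (rung i j eq) q →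
      Meet 1F (path k) (path i) (path j) q
    meet-right-rung i j k eq (x , y) (_ , _ , p) r = meet-rung i j k eq x y
      (trans p (trans (cong (λ x → height (toℕ k) * (2ℚ - x)) (proj₁ r)) (1-of (height (toℕ k))))) r

    meet-left-left : ∀ (i j : Fin m) q → Locus (left i) q → Locus (left j) q →
      Meet 0F (path i) 0F (path j) q
    meet-left-left i j (x , y) (_ , _ , p) (_ , _ , q) = helper (slopes i j x y p q)
      where
      helper : i ≡ j ⊎ x ≡ 0ℚ × y ≡ 0ℚ → Meet 0F (path i) 0F (path j) (x , y)
      helper (inj₁ i≡j) = inj₁ (refl , ss i≡j)
      helper (inj₂ (x≡0 , y≡0)) = inj₂ (0F , cong₂ _,_ x≡0 y≡0 , inj₁ refl , inj₁ refl)

    meet-right-right : ∀ (i j : Fin m) q → Locus (right i) q → Locus (right j) q →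
      Meet 1F (path i) 1F (path j) q
    meet-right-right i j (x , y) (_ , _ , p) (_ , _ , q) = helper (slopes i j (2ℚ - x) y p q)
      where
      helper : i ≡ j ⊎ 2ℚ - x ≡ 0ℚ × y ≡ 0ℚ → Meet 1F (path i) 1F (path j) (x , y)
      helper (inj₁ i≡j) = inj₁ (refl , ss i≡j)
      helper (inj₂ (2-x , y≡0)) = inj₂ (1F , cong₂ _,_ (2-x≡0 x 2-x) y≡0 , inj₁ refl , inj₁ refl)

    meet-rung-rung : ∀ (i j k l : Fin m) (eq : toℕ j ≡ suc (toℕ i)) (eq′ : toℕ l ≡ suc (toℕ k)) q →
      Locus (rung i j eq) q → Locus (rung k l eq′) q →
      Meet (path i) (path j) (path k) (path l) q
    meet-rung-rung i j k l eq eq′ (x , y) (x≡1 , i≤ , ≤j) (_ , k≤ , ≤l) = helper (ℕₚ.<-cmp (toℕ i) (toℕ k))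
      where
      helper : _ → Meet (path i) (path j) (path k) (path l) (x , y)
      helper (tri≈ _ i≡k _) = inj₁ (ss (toℕ-injective i≡k) , ss (toℕ-injective (trans eq (trans (cong suc i≡k) (sym eq′)))))
      helper (tri< i<k _ _) = inj₂ (path k ,
        cong₂ _,_ x≡1 (≤-antisym (≤-trans ≤j (height-mono {suc (toℕ i)} {toℕ k} i<k)) k≤) ,
        ss⊎ (on-rung i j k eq (height-mono {toℕ i} {toℕ k} (ℕₚ.<⇒≤ i<k)) (≤-trans k≤ ≤j)) , inj₁ refl)
      helper (tri> _ _ k<i) = inj₂ (path i ,
        cong₂ _,_ x≡1 (≤-antisym (≤-trans ≤l (height-mono {suc (toℕ k)} {toℕ i} k<i)) i≤) ,
        inj₁ refl , ss⊎ (on-rung k l i eq′ (height-mono {toℕ k} {toℕ i} (ℕₚ.<⇒≤ k<i)) (≤-trans i≤ ≤l)))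

  meet : (e : FanEdge i j) (f : FanEdge k l) → ∀ q → Locus e q → Locus f q → Meet i j k l q
  meet base f q p r = meet-base f q p r
  meet e@(left _) base q p r = Meet-swap (meet-base e q r p)
  meet e@(right _) base q p r = Meet-swap (meet-base e q r p)
  meet e@(rung _ _ _) base q p r = Meet-swap (meet-base e q r p)
  meet (left i) (left j) q p r = meet-left-left i j q p r
  meet (right i) (right j) q p r = meet-right-right i j q p r
  meet (left i) (right j) q p r = meet-left-right i j q p r
  meet (right i) (left j) q p r = Meet-swap (meet-left-right j i q r p)
  meet (left k) (rung i j eq) q p r = meet-left-rung i j k eq q p r
  meet (rung i j eq) (left k) q p r = Meet-swap (meet-left-rung i j k eq q r p)
  meet (right k) (rung i j eq) q p r = meet-right-rung i j k eq q p r
  meet (rung i j eq) (right k) q p r = Meet-swap (meet-right-rung i j k eq q r p)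
  meet (rung i j eq) (rung k l eq′) q p r = meet-rung-rung i j k l eq eq′ q p r

  off-edge : (e : FanEdge i j) → ∀ w → Locus e (fanPos w) → w ≡ i ⊎ w ≡ j
  off-edge base 0F _ = inj₁ refl
  off-edge base 1F _ = inj₂ refl
  off-edge base (path w) (_ , _ , h≡0) = ⊥-elim (0<⇒≢0 (height-pos (toℕ w)) h≡0)
  off-edge (left i) 0F _ = inj₁ refl
  off-edge (left i) 1F (_ , 2≤1 , _) = ⊥-elim (<-irrefl refl (<-≤-trans 1<2 2≤1))
  off-edge (left i) (path w) (_ , _ , eq) = inj₂ (ss (toℕ-injective (height-injective (trans eq (*-identityʳ _)))))
  off-edge (right i) 0F (1≤0 , _) = ⊥-elim (<-irrefl refl (<-≤-trans 0<1 1≤0))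
  off-edge (right i) 1F _ = inj₁ refl
  off-edge (right i) (path w) (_ , _ , eq) = inj₂ (ss (toℕ-injective (height-injective (trans eq (1-of _)))))
  off-edge (rung i j eq) 0F (() , _)
  off-edge (rung i j eq) 1F (() , _)
  off-edge (rung i j eq) (path w) (_ , i≤ , ≤j) = ss⊎ (on-rung i j w eq i≤ ≤j)

  -- A triangle that contains the whole fan and meets the line x = 0 in the origin alone; an affine
  -- map will take it into a thin triangle at the apex.
  Cone : ℕ → Pt → Set
  Cone m (x , y) = 0ℚ ≤ x × x ≤ 2ℚ × 0ℚ ≤ y × y ≤ height m * x

  edge-cone : (e : FanEdge {m} i j) → ∀ q → Locus e q → Cone m q
  edge-cone {m} base (x , y) (0≤x , x≤2 , refl) = 0≤x , x≤2 , ≤-refl , 0≤*0≤ (<⇒≤ (height-pos m)) 0≤x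
  edge-cone {m} (left i) (x , y) (0≤x , x≤1 , refl) =
    0≤x , ≤-trans x≤1 (<⇒≤ 1<2) , 0≤*0≤ (<⇒≤ (height-pos (toℕ i))) 0≤x ,
    *-monoʳ-≤-nonNeg x {{nonNegative 0≤x}} (height-mono (ℕₚ.<⇒≤ (toℕ<n i)))
  edge-cone {m} (right i) (x , y) (1≤x , x≤2 , refl) =
    ≤-trans (<⇒≤ 0<1) 1≤x , x≤2 , 0≤*0≤ (<⇒≤ (height-pos (toℕ i))) (≤⇒0≤- x≤2) ,
    ≤-trans (*-monoˡ-≤-nonNeg (height (toℕ i)) {{nonNegative (<⇒≤ (height-pos (toℕ i)))}} 2-x≤x)
            (*-monoʳ-≤-nonNeg x {{nonNegative (≤-trans (<⇒≤ 0<1) 1≤x)}} (height-mono (ℕₚ.<⇒≤ (toℕ<n i))))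
    where
    lemma : ∀ x → (x - 1ℚ) + (x - 1ℚ) ≡ x - ((1ℚ + 1ℚ) - x)
    lemma = RS.solve-∀ ℚring
    2-x≤x : 2ℚ - x ≤ x
    2-x≤x = 0≤-⇒≤ (subst (0ℚ ≤_) (lemma x) (0≤+0≤ (≤⇒0≤- 1≤x) (≤⇒0≤- 1≤x)))
  edge-cone {m} (rung i j eq) (x , y) (refl , i≤ , ≤j) =
    <⇒≤ 0<1 , <⇒≤ 1<2 , ≤-trans (<⇒≤ (height-pos (toℕ i))) i≤ ,
    ≤-trans ≤j (≤-trans (height-mono (subst (ℕ._≤ m) eq (ℕₚ.<⇒≤ (toℕ<n j)))) (≤-reflexive (sym (*-identityʳ _))))

  fanPos-cone : ∀ (w : Fin (2 ℕ.+ m)) → Cone m (fanPos w)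
  fanPos-cone {m} 0F = ≤-refl , <⇒≤ (<-trans 0<1 1<2) , ≤-refl , ≤-reflexive (sym (*-zeroʳ (height m)))
  fanPos-cone {m} 1F = <⇒≤ (<-trans 0<1 1<2) , ≤-refl , ≤-refl , 0≤*0≤ (<⇒≤ (height-pos m)) (<⇒≤ (<-trans 0<1 1<2))
  fanPos-cone {m} (path i) = <⇒≤ 0<1 , <⇒≤ 1<2 , <⇒≤ (height-pos (toℕ i)) ,
    ≤-trans (height-mono (ℕₚ.<⇒≤ (toℕ<n i))) (≤-reflexive (sym (*-identityʳ _)))

  fanPos-injective : Injective _≡_ _≡_ (fanPos {m})
  fanPos-injective {x = 0F} {0F} _ = refl
  fanPos-injective {x = 1F} {1F} _ = refl
  fanPos-injective {x = 0F} {1F} ()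
  fanPos-injective {x = 0F} {path j} ()
  fanPos-injective {x = 1F} {0F} ()
  fanPos-injective {x = 1F} {path j} ()
  fanPos-injective {x = path i} {0F} ()
  fanPos-injective {x = path i} {1F} ()
  fanPos-injective {x = path i} {path j} eq = ss (toℕ-injective (height-injective (cong proj₂ eq)))

  fan-orient : (i j : Fin (2 ℕ.+ m)) → fan i j ≡ true → FanEdge i j ⊎ FanEdge j i
  fan-orient i j h with fanʳ i j in eq
  ... | true  = inj₁ (fanEdge i j eq)
  ... | false = inj₂ (fanEdge j i h)

  fan-cone : ∀ {m} {i j : Fin (2 ℕ.+ m)} → fan i j ≡ true → ∀ q → OnSeg q (fanPos i) (fanPos j) → Cone m q
  fan-cone {i = i} {j} ij q on with fan-orient i j ij
  ... | inj₁ e = edge-cone e q (locus e q on)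
  ... | inj₂ e = edge-cone e q (locus e q (OnSeg-sym {q} {fanPos i} {fanPos j} on))

  fan-off : ∀ {m} {i j : Fin (2 ℕ.+ m)} → fan i j ≡ true → ∀ w → OnSeg (fanPos w) (fanPos i) (fanPos j) → w ≡ i ⊎ w ≡ j
  fan-off {i = i} {j} ij w on with fan-orient i j ij
  ... | inj₁ e = off-edge e w (locus e (fanPos w) on)
  ... | inj₂ e = Data.Sum.swap (off-edge e w (locus e (fanPos w) (OnSeg-sym {fanPos w} {fanPos i} {fanPos j} on)))

  fan-meet : ∀ {m} {i j k l : Fin (2 ℕ.+ m)} → fan i j ≡ true → fan k l ≡ true → ∀ q →
    OnSeg q (fanPos i) (fanPos j) → OnSeg q (fanPos k) (fanPos l) →
    ((i ≡ k × j ≡ l) ⊎ (i ≡ l × j ≡ k)) ⊎ (∃ λ w → q ≡ fanPos w × (w ≡ i ⊎ w ≡ j) × (w ≡ k ⊎ w ≡ l))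
  fan-meet {i = i} {j} {k} {l} ij kl q on on′ with fan-orient i j ij | fan-orient k l kl
  ... | inj₁ e | inj₁ f = Data.Sum.map inj₁ (λ x → x) (meet e f q (locus e q on) (locus f q on′))
  ... | inj₁ e | inj₂ f =
    Data.Sum.map inj₂ (λ (w , p , r , s) → w , p , r , Data.Sum.swap s)
      (meet e f q (locus e q on) (locus f q (OnSeg-sym {q} {fanPos k} {fanPos l} on′)))
  ... | inj₂ e | inj₁ f =
    Data.Sum.map (λ (p , r) → inj₂ (r , p)) (λ (w , p , r , s) → w , p , Data.Sum.swap r , s)
      (meet e f q (locus e q (OnSeg-sym {q} {fanPos i} {fanPos j} on)) (locus f q on′))
  ... | inj₂ e | inj₂ f =
    Data.Sum.map (λ (p , r) → inj₁ (r , p)) (λ (w , p , r , s) → w , p , Data.Sum.swap r , Data.Sum.swap s)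
      (meet e f q (locus e q (OnSeg-sym {q} {fanPos i} {fanPos j} on)) (locus f q (OnSeg-sym {q} {fanPos k} {fanPos l} on′)))

  fan-sym : (i j : Fin (2 ℕ.+ m)) → fan i j ≡ fan j i
  fan-sym i j = ∨-comm (fanʳ i j) (fanʳ j i)

  fan-irrefl : (i : Fin (2 ℕ.+ m)) → fan i i ≡ false
  fan-irrefl 0F = refl
  fan-irrefl 1F = refl
  fan-irrefl (path i) = cong₂ _∨_ (n≢suc (toℕ i)) (n≢suc (toℕ i))
    where
    n≢suc : ∀ n → (n ≡ᵇ suc n) ≡ false
    n≢suc zero    = refl
    n≢suc (suc n) = n≢suc n

  cone-origin : ∀ {m} q → Cone m q → ¬ 0ℚ < proj₁ q → q ≡ (0ℚ , 0ℚ)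
  cone-origin {m} (x , y) (0≤x , _ , 0≤y , y≤) x≯0 = cong₂ _,_ x≡0
    (≤-antisym (≤-trans y≤ (≤-reflexive (trans (cong (height m *_) x≡0) (*-zeroʳ (height m))))) 0≤y)
    where
    x≡0 = ≤-antisym (≮⇒≥ x≯0) 0≤x

  fanPos-positive : (i : Fin (1 ℕ.+ m)) → 0ℚ < proj₁ (fanPos {m} (Fin.suc i))
  fanPos-positive 0F          = <-trans 0<1 1<2
  fanPos-positive (Fin.suc i) = 0<1

-- A thin triangle at a point, disjoint from a given drawing.

module ThinTriangles where

  open RationalOrder
  open Segments using (OnSeg-sym; OnSeg-start)
  import Data.Nat.Properties as ℕₚ
  open import Data.Rational using (ℚ; 0ℚ; 1ℚ; ½; _+_; _*_; _-_; -_; _<_; _≤_; positive)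
  open import Data.Rational.Properties
  import Data.Bool.Properties as Bool
  open import Axiom.UniquenessOfIdentityProofs using (module Decidable⇒UIP)
  import Tactic.RingSolver as RS

  half : ∀ {p} → 0ℚ < p → Σ ℚ λ h → 0ℚ < h × h + h ≡ p
  half {p} 0<p = ½ * p , 0<*0< (positive⁻¹ ½) 0<p , trans (sym (*-distribʳ-+ p ½ ½)) (*-identityˡ p)

  smaller : ∀ {p q} → 0ℚ < p → 0ℚ < q → Σ ℚ λ ε → 0ℚ < ε × ε < p × ε < q
  smaller {p} {q} 0<p 0<q = helper (≤-total p q)
    where
    helper : p ≤ q ⊎ q ≤ p → Σ ℚ λ ε → 0ℚ < ε × ε < p × ε < q
    helper (inj₁ p≤q) = let ε , 0<ε , ε<p = <-dense 0<p in ε , 0<ε , ε<p , <-≤-trans ε<p p≤q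
    helper (inj₂ q≤p) = let ε , 0<ε , ε<q = <-dense 0<q in ε , 0<ε , <-≤-trans ε<q q≤p , ε<q

  -- The triangle with apex p, bounded by the slopes l and l + κ M and by the vertical line
  -- at distance δ; the apex itself is excluded.
  module ThinTriangle (p : Pt) (M : ℚ) (0<M : 0ℚ < M) where

    record Shape : Set where
      constructor shape
      field
        l κ δ : ℚ
        0<κ   : 0ℚ < κ
        0<δ   : 0ℚ < δ

    open Shape public

    Triangle₀ : Shape → ℚ → ℚ → Set
    Triangle₀ T x y = 0ℚ < x × x ≤ δ T × l T * x ≤ y × y ≤ (l T + κ T * M) * x

    Triangle : Shape → Pt → Set
    Triangle T (x , y) = Triangle₀ T (x - proj₁ p) (y - proj₂ p)

    _⊑_ : Shape → Shape → Set
    T′ ⊑ T = ∀ {x y} → Triangle₀ T′ x y → Triangle₀ T x y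

    private
      -- For negative K any ε below c / (- K) works.
      positive-near-0 : ∀ {c} K {δ} → 0ℚ < c → 0ℚ < δ → Σ ℚ λ ε → 0ℚ < ε × ε ≤ δ × (∀ x → 0ℚ < x → x ≤ ε → 0ℚ < c + K * x)
      positive-near-0 {c} K {δ} 0<c 0<δ = helper (0ℚ ≤? K)
        where
        helper : Dec (0ℚ ≤ K) → Σ ℚ λ ε → 0ℚ < ε × ε ≤ δ × (∀ x → 0ℚ < x → x ≤ ε → 0ℚ < c + K * x)
        helper (yes 0≤K) = δ , 0<δ , ≤-refl , λ x 0<x _ → 0<+0≤ 0<c (0≤*0≤ 0≤K (<⇒≤ 0<x))
        helper (no 0≰K) = ε , 0<ε , <⇒≤ ε<δ , λ x 0<x x≤ε → subst (0ℚ <_) (trans (cong (λ z → (z - ε * - K) + - K * (ε - x)) rK) (lemma c K ε x))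
            (0<+0≤ (<⇒0<- (*-monoˡ-<-pos (- K) {{positive 0<-K}} ε<r)) (0≤*0≤ (<⇒≤ 0<-K) (≤⇒0≤- x≤ε)))
          where
          0<-K : 0ℚ < - K
          0<-K = <0⇒0<- (≰⇒> 0≰K)
          r = proj₁ (quotient c 0<-K)
          rK = proj₂ (quotient c 0<-K)
          0<r : 0ℚ < r
          0<r = 0<*-cancel 0<-K (subst (0ℚ <_) (sym rK) 0<c)
          S = smaller 0<r 0<δ
          ε = proj₁ S
          0<ε = proj₁ (proj₂ S)
          ε<r = proj₁ (proj₂ (proj₂ S))
          ε<δ = proj₂ (proj₂ (proj₂ S))
          lemma : ∀ c K ε x → (c - ε * - K) + - K * (ε - x) ≡ c + K * x
          lemma = RS.solve-∀ ℚring

    Avoids₀ : Shape → ℚ → ℚ → ℚ → ℚ → Set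
    Avoids₀ T A C B E = ∀ t → 0ℚ ≤ t → t ≤ 1ℚ → ¬ Triangle₀ T (A + t * (B - A)) (C + t * (E - C))

    private
      -- A segment from abscissa A ≤ 0 to B > 0 lies on the line (B - A) y = c + s x.
      module Across (T : Shape) (A C B E : ℚ) (A≤0 : A ≤ 0ℚ) (0<B : 0ℚ < B) where
        W s c μ : ℚ
        W = B - A
        s = E - C
        c = C * B - E * A
        μ = l T + κ T * M

        0<W : 0ℚ < W
        0<W = <⇒0<- (≤-<-trans A≤0 0<B)

        line : ∀ t → W * (C + t * s) ≡ c + s * (A + t * W)
        line t = lemma A C B E t
          where
          lemma : ∀ A C B E t → (B - A) * (C + t * (E - C)) ≡ (C * B - E * A) + (E - C) * (A + t * (B - A))
          lemma = RS.solve-∀ ℚring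

        contradict : ∀ {u v w} → 0ℚ < u → 0ℚ ≤ v → u + v ≡ w - w → ⊥
        contradict {w = w} 0<u 0≤v eq = 0<⇒≢0 (0<+0≤ 0<u 0≤v) (trans eq (+-inverseʳ w))

        -- The line passes the apex at height `c` / `W`. If this is positive, then near the apex the
        -- line stays above the upper side of the triangle, so a smaller δ suffices.
        above : 0ℚ < c → Σ Shape λ T′ → T′ ⊑ T × Avoids₀ T′ A C B E
        above 0<c = record T { δ = ε ; 0<δ = 0<ε } ,
          (λ (0<x , x≤ε , ly , yu) → 0<x , ≤-trans x≤ε ε≤δ , ly , yu) ,
          λ t _ _ (0<x , x≤ε , _ , y≤μx) → contradict {w = W * (C + t * s)} (near (A + t * W) 0<x x≤ε) (0≤*0≤ (<⇒≤ 0<W) (≤⇒0≤- y≤μx))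
            (trans (lemma c s W μ (A + t * W) (C + t * s)) (cong (λ z → z - W * (C + t * s)) (sym (line t))))
          where
          P = positive-near-0 (s - W * μ) 0<c (0<δ T)
          ε = proj₁ P
          0<ε = proj₁ (proj₂ P)
          ε≤δ = proj₁ (proj₂ (proj₂ P))
          near = proj₂ (proj₂ (proj₂ P))
          lemma : ∀ c s W μ x y → (c + (s - W * μ) * x) + W * (μ * x - y) ≡ c + s * x - W * y
          lemma = RS.solve-∀ ℚring

        under : c < 0ℚ → Σ Shape λ T′ → T′ ⊑ T × Avoids₀ T′ A C B E
        under c<0 = record T { δ = ε ; 0<δ = 0<ε } ,
          (λ (0<x , x≤ε , ly , yu) → 0<x , ≤-trans x≤ε ε≤δ , ly , yu) ,
          λ t _ _ (0<x , x≤ε , lx≤y , _) → contradict {w = W * (C + t * s)} (near (A + t * W) 0<x x≤ε) (0≤*0≤ (<⇒≤ 0<W) (≤⇒0≤- lx≤y))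
            (trans (lemma c s W (l T) (A + t * W) (C + t * s)) (cong (λ z → W * (C + t * s) - z) (sym (line t))))
          where
          P = positive-near-0 (W * l T - s) (<0⇒0<- c<0) (0<δ T)
          ε = proj₁ P
          0<ε = proj₁ (proj₂ P)
          ε≤δ = proj₁ (proj₂ (proj₂ P))
          near = proj₂ (proj₂ (proj₂ P))
          lemma : ∀ c s W l x y → (- c + (W * l - s) * x) + W * (y - l * x) ≡ W * y - (c + s * x)
          lemma = RS.solve-∀ ℚring

        h k : ℚ
        h = proj₁ (half (0<κ T))
        k = proj₁ (half (proj₁ (proj₂ (half (0<κ T)))))
        0<h : 0ℚ < h
        0<h = proj₁ (proj₂ (half (0<κ T)))
        0<k : 0ℚ < k
        0<k = proj₁ (proj₂ (half 0<h))
        h+h : h + h ≡ κ T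
        h+h = proj₂ (proj₂ (half (0<κ T)))
        k+k : k + k ≡ h
        k+k = proj₂ (proj₂ (half 0<h))
        ν : ℚ
        ν = l T + h * M

        line₀ : c ≡ 0ℚ → ∀ t → s * (A + t * W) ≡ W * (C + t * s)
        line₀ c≡0 t = sym (trans (line t) (trans (cong (_+ s * (A + t * W)) c≡0) (+-identityˡ _)))

        -- A line through the apex cannot be avoided by shortening; the range of slopes has to
        -- shrink. A line steeper than the middle slope `ν` misses the lower half of the range.
        steep : c ≡ 0ℚ → W * ν < s → Σ Shape λ T′ → T′ ⊑ T × Avoids₀ T′ A C B E
        steep c≡0 Wν<s = shape (l T) h (δ T) 0<h (0<δ T) ,
          (λ {x} {y} (0<x , x≤δ , ly , yu) → 0<x , x≤δ , ly ,
            0≤-⇒≤ (subst (0ℚ ≤_) (trans (lemma (l T) h M x y) (cong (λ z → (l T + z * M) * x - y) h+h))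
              (0≤+0≤ (≤⇒0≤- yu) (0≤*0≤ (0≤*0≤ (<⇒≤ 0<h) (<⇒≤ 0<M)) (<⇒≤ 0<x))))) ,
          λ t _ _ (0<x , _ , _ , y≤νx) → contradict {w = W * (C + t * s)} (0<*0< (<⇒0<- Wν<s) 0<x) (0≤*0≤ (<⇒≤ 0<W) (≤⇒0≤- y≤νx))
            (trans (lemma₂ s W ν (A + t * W) (C + t * s)) (cong (λ z → z - W * (C + t * s)) (line₀ c≡0 t)))
          where
          lemma : ∀ l h M x y → ((l + h * M) * x - y) + h * M * x ≡ (l + (h + h) * M) * x - y
          lemma = RS.solve-∀ ℚring
          lemma₂ : ∀ s W ν x y → (s - W * ν) * x + W * (ν * x - y) ≡ s * x - W * y
          lemma₂ = RS.solve-∀ ℚring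

        -- The line may have slope exactly `ν`, so the new range must start strictly above it: the
        -- top quarter, from `ν + k * M` to the old upper slope, is kept.
        flat : c ≡ 0ℚ → s ≤ W * ν → Σ Shape λ T′ → T′ ⊑ T × Avoids₀ T′ A C B E
        flat c≡0 s≤Wν = shape (ν + k * M) k (δ T) 0<k (0<δ T) ,
          (λ {x} {y} (0<x , x≤δ , ly , yu) → 0<x , x≤δ ,
            0≤-⇒≤ (subst (0ℚ ≤_) (lemma (l T) h k M x y)
              (0≤+0≤ (≤⇒0≤- ly) (0≤*0≤ (0≤*0≤ (0≤+0≤ (<⇒≤ 0<h) (<⇒≤ 0<k)) (<⇒≤ 0<M)) (<⇒≤ 0<x)))) ,
            subst (y ≤_) (cong (_* x) (trans (lemma₁ (l T) h k M) (trans (cong (λ z → l T + (h + z) * M) k+k) (cong (λ z → l T + z * M) h+h)))) yu) ,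
          λ t _ _ (0<x , _ , l′x≤y , _) → contradict {w = W * (C + t * s)}
            (0<*0< (0<*0< 0<W (0<*0< 0<k 0<M)) 0<x)
            (0≤+0≤ (0≤*0≤ (≤⇒0≤- s≤Wν) (<⇒≤ 0<x)) (0≤*0≤ (<⇒≤ 0<W) (≤⇒0≤- l′x≤y)))
            (trans (lemma₂ s W ν (k * M) (A + t * W) (C + t * s)) (cong (λ z → W * (C + t * s) - z) (line₀ c≡0 t)))
          where
          lemma : ∀ l h k M x y → (y - (l + h * M + k * M) * x) + (h + k) * M * x ≡ y - l * x
          lemma = RS.solve-∀ ℚring
          lemma₁ : ∀ l h k M → l + h * M + k * M + k * M ≡ l + (h + (k + k)) * M
          lemma₁ = RS.solve-∀ ℚring
          lemma₂ : ∀ s W ν d x y → W * d * x + ((W * ν - s) * x + W * (y - (ν + d) * x)) ≡ W * y - s * x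
          lemma₂ = RS.solve-∀ ℚring

        across : Σ Shape λ T′ → T′ ⊑ T × Avoids₀ T′ A C B E
        across = helper (<-cmp c 0ℚ) (W * ν <? s)
          where
          helper : _ → Dec (W * ν < s) → Σ Shape λ T′ → T′ ⊑ T × Avoids₀ T′ A C B E
          helper (tri< c<0 _ _) _ = under c<0
          helper (tri> _ _ 0<c) _ = above 0<c
          helper (tri≈ _ c≡0 _) (yes p) = steep c≡0 p
          helper (tri≈ _ c≡0 _) (no p) = flat c≡0 (≮⇒≥ p)

    avoid-segment₀ : ∀ T A C B E → A ≤ B → Σ Shape λ T′ → T′ ⊑ T × Avoids₀ T′ A C B E
    avoid-segment₀ T A C B E A≤B = helper (0ℚ <? A) (0ℚ <? B)
      where
      helper : Dec (0ℚ < A) → Dec (0ℚ < B) → Σ Shape λ T′ → T′ ⊑ T × Avoids₀ T′ A C B E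
      helper (no A≯0) (yes 0<B) = Across.across T A C B E (≮⇒≥ A≯0) 0<B
      helper _ (no B≯0) = T , id , λ t 0≤t t≤1 (0<x , _) →
        0<⇒≢0 (0<+0≤ 0<x (0≤+0≤ (0≤*0≤ (≤⇒0≤- t≤1) (≤⇒0≤- A≤B)) (≤⇒0≤- (≮⇒≥ B≯0)))) (lemma A B t)
        where
        lemma : ∀ A B t → (A + t * (B - A)) + ((1ℚ - t) * (B - A) + (0ℚ - B)) ≡ 0ℚ
        lemma = RS.solve-∀ ℚring
      helper (yes 0<A) (yes _) = record T { δ = ε ; 0<δ = 0<ε } ,
        (λ (0<x , x≤ε , ly , yu) → 0<x , ≤-trans x≤ε (<⇒≤ ε<δ) , ly , yu) ,
        λ t 0≤t _ (_ , x≤ε , _) →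
        0<⇒≢0 (0<+0≤ (<⇒0<- ε<A) (0≤+0≤ (0≤*0≤ 0≤t (≤⇒0≤- A≤B)) (≤⇒0≤- x≤ε))) (lemma A B t ε)
        where
        S = smaller 0<A (0<δ T)
        ε = proj₁ S
        0<ε = proj₁ (proj₂ S)
        ε<A = proj₁ (proj₂ (proj₂ S))
        ε<δ = proj₂ (proj₂ (proj₂ S))
        lemma : ∀ A B t ε → (A - ε) + (t * (B - A) + (ε - (A + t * (B - A)))) ≡ 0ℚ
        lemma = RS.solve-∀ ℚring

    -- The quantifier over all initial triangles lets finitely many sets be avoided one after
    -- another.
    Avoidable : (Pt → Set) → Set
    Avoidable S = ∀ T → Σ Shape λ T′ → T′ ⊑ T × (∀ q → S q → ¬ Triangle T′ q)

    private
      relative : ∀ a b p t → a + t * (b - a) - p ≡ (a - p) + t * ((b - p) - (a - p))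
      relative = RS.solve-∀ ℚring

      avoid-oriented : ∀ a b → proj₁ a ≤ proj₁ b → Avoidable (λ q → OnSeg q a b)
      avoid-oriented (ax , ay) (bx , by) ax≤bx T =
        let T′ , T′⊑T , avoids = avoid-segment₀ T (ax - px) (ay - py) (bx - px) (by - py) (+-monoˡ-≤ (- px) ax≤bx)
        in T′ , T′⊑T , λ { (qx , qy) (t , 0≤t , t≤1 , xeq , yeq) hit → avoids t 0≤t t≤1
             (subst₂ (Triangle₀ T′) (trans (cong (_- px) xeq) (relative ax bx px t)) (trans (cong (_- py) yeq) (relative ay by py t)) hit) }
        where
        px = proj₁ p
        py = proj₂ p

    avoid-segment : ∀ a b → Avoidable (λ q → OnSeg q a b)
    avoid-segment a b = helper (≤-total (proj₁ a) (proj₁ b))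
      where
      helper : proj₁ a ≤ proj₁ b ⊎ proj₁ b ≤ proj₁ a → Avoidable (λ q → OnSeg q a b)
      helper (inj₁ a≤b) = avoid-oriented a b a≤b
      helper (inj₂ b≤a) T = let T′ , T′⊑T , avoids = avoid-oriented b a b≤a T in
        T′ , T′⊑T , λ q on → avoids q (OnSeg-sym {q} {a} {b} on)

    avoid-⊆ : ∀ {S S′ : Pt → Set} → (∀ q → S q → S′ q) → Avoidable S′ → Avoidable S
    avoid-⊆ sub av T = let T′ , T′⊑T , avoids = av T in T′ , T′⊑T , λ q s → avoids q (sub q s)

    avoid-⊎ : ∀ {S S′ : Pt → Set} → Avoidable S → Avoidable S′ → Avoidable (λ q → S q ⊎ S′ q)
    avoid-⊎ av av′ T =
      let T₁ , T₁⊑T , avoids₁ = av T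
          T₂ , T₂⊑T₁ , avoids₂ = av′ T₁
      in T₂ , (λ h → T₁⊑T (T₂⊑T₁ h)) , λ { q (inj₁ s) h → avoids₁ q s (T₂⊑T₁ h) ; q (inj₂ s) h → avoids₂ q s h }

    avoid-∅ : ∀ {S : Pt → Set} → (∀ q → ¬ S q) → Avoidable S
    avoid-∅ empty T = T , id , λ q s → ⊥-elim (empty q s)

    avoid-∃ : ∀ {n} {S : Fin n → Pt → Set} → (∀ i → Avoidable (S i)) → Avoidable (λ q → ∃ λ i → S i q)
    avoid-∃ {zero} av = avoid-∅ (λ { q (() , _) })
    avoid-∃ {suc n} av = avoid-⊆ (λ { q (Fin.zero , s) → inj₁ s ; q (Fin.suc i , s) → inj₂ (i , s) })
      (avoid-⊎ (av Fin.zero) (avoid-∃ (λ i → av (Fin.suc i))))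

    avoid-arc : ∀ A → Avoidable (λ q → OnArc q A)
    avoid-arc A = avoid-∃ (λ i → avoid-segment (pt A (inject₁ i)) (pt A (Fin.suc i)))

    abstract
      -- Arcs that end at the apex, and a vertex placed there, are no exception: the triangle does
      -- not contain its apex.
      avoid-drawing : ∀ {n} {G : Graph n} (D : Drawing G) →
        Σ Shape λ T → (∀ e q → OnArc q (Drawing.arc D e) → ¬ Triangle T q) × (∀ w → ¬ Triangle T (Drawing.pos D w))
      avoid-drawing {n} {G} D =
        -- A vertex is avoided as a degenerate segment; the initial shape is arbitrary.
        let T , _ , avoids = avoid-⊎ (avoid-∃ (λ u → avoid-∃ (λ v → arcs u v))) (avoid-∃ (λ w → avoid-segment (pos w) (pos w)))
              (shape 0ℚ 1ℚ 1ℚ (positive⁻¹ 1ℚ) (positive⁻¹ 1ℚ))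
        in T , (λ { (u , v , e) q on → avoids q (inj₁ (u , v , e , on)) }) ,
               λ w → avoids (pos w) (inj₂ (w , OnSeg-start (pos w) (pos w)))
        where
        open Drawing D
        arcs : ∀ u v → Avoidable (λ q → Σ (toℕ u ℕ.< toℕ v × Adj G u v ≡ true) λ e → OnArc q (arc (u , v , e)))
        arcs u v with toℕ u ℕₚ.<? toℕ v | Adj G u v Bool.≟ true
        ... | no ¬u<v | _ = avoid-∅ (λ { q ((u<v , _) , _) → ¬u<v u<v })
        ... | yes _ | no ¬uv = avoid-∅ (λ { q ((_ , uv) , _) → ¬uv uv })
        -- The arc depends on the proofs contained in the edge. These are unique, so each pair u, v
        -- contributes a single arc.
        ... | yes u<v | yes uv = avoid-⊆ (λ { q ((u<v′ , uv′) , on) →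
                subst (λ e → OnArc q (arc (u , v , e))) (cong₂ _,_ (ℕₚ.<-irrelevant u<v′ u<v) (Decidable⇒UIP.≡-irrelevant Bool._≟_ uv′ uv)) on })
                (avoid-arc (arc (u , v , u<v , uv)))

-- Gluing a fan to a drawing at one vertex.

module Gluings where

  open RationalOrder
  open VanKampen using (Adj-sym; Adj-irrefl)
  open Counting using (Symm; Irrefl)
  open Contractions using (∨-true)
  open Fans
  open ThinTriangles
  import Data.Nat.Properties as ℕₚ
  open import Data.Fin.Properties using (_≟_; any?)
  open import Data.Rational using (0ℚ; 1ℚ; _+_; _*_; _-_; -_; _<_; _≤_)
  open import Data.Rational.Properties hiding (_≟_)
  import Data.Bool.Properties as Bool
  import Tactic.RingSolver as RS

  fromAdj : ∀ {n} → (Fin n → Fin n → Bool) → Graph n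
  fromAdj a = record { rel = a }

  Adj-fromAdj : ∀ {n} {a : Fin n → Fin n → Bool} → Symm a → Irrefl a → ∀ u v → Adj (fromAdj a) u v ≡ a u v
  Adj-fromAdj {a = a} a-sym a-irr u v with u ≟ v
  ... | yes refl = sym (a-irr u)
  ... | no _ = trans (cong (a u v ∨_) (a-sym v u)) (Bool.∨-idem (a u v))

  subdrawing : ∀ {n} {G H : Graph n} → (∀ u v → Adj H u v ≡ true → Adj G u v ≡ true) → Drawing G → Drawing H
  subdrawing {G = G} {H} sub D = record
    { pos = pos ; pos-inj = pos-inj
    ; arc = λ e → arc (lift e)
    ; arc-start = λ e → arc-start (lift e)
    ; arc-end = λ e → arc-end (lift e)
    ; avoid = λ e → avoid (lift e)
    ; cross = λ e f → cross (lift e) (lift f)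
    }
    where
    open Drawing D
    lift : Edge H → Edge G
    lift (u , v , u<v , uv) = u , v , u<v , sub u v uv

  straight : (a b : Pt) → a ≢ b → Arc
  straight a b a≢b = record
    { bends = 0
    ; pt = λ { 0F → a ; 1F → b }
    ; nondeg = λ { 0F → a≢b }
    ; consec = λ { 0F 0F () }
    ; apart = λ { 0F 0F () }
    }

  module Gluing {n m} {G : Graph n} (D : Drawing G) (ν : Fin (2 ℕ.+ m) → Fin n) (ν-inj : Injective _≡_ _≡_ ν)
    (isolated : ∀ i w → Adj G (ν (Fin.suc i)) w ≡ false) where

    open Drawing D

    private
      apex = pos (ν 0F)
      open ThinTriangle apex (height m) (height-pos m)

      T : Shape
      T = proj₁ (avoid-drawing D)

      -- Half of δ, because the fan extends to abscissa 2.
      h = proj₁ (half (0<δ T))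
      0<h = proj₁ (proj₂ (half (0<δ T)))

      -- Sends the slopes 0 and `height m` that bound the cone to the slopes `l T` and
      -- `l T + κ T * height m` that bound the thin triangle.
      place : Pt → Pt
      place (x , y) = proj₁ apex + h * x , proj₂ apex + h * (l T * x + κ T * y)

      place-origin : place (0ℚ , 0ℚ) ≡ apex
      place-origin = cong₂ _,_ (eq₁ (proj₁ apex) h) (eq₂ (proj₂ apex) h (l T) (κ T))
        where
        eq₁ : ∀ p h → p + h * 0ℚ ≡ p
        eq₁ = RS.solve-∀ ℚring
        eq₂ : ∀ p h l k → p + h * (l * 0ℚ + k * 0ℚ) ≡ p
        eq₂ = RS.solve-∀ ℚring

      place-injective : ∀ {q r} → place q ≡ place r → q ≡ r
      place-injective {qx , qy} {rx , ry} eq = cong₂ _,_ x≡ y≡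
        where
        cancel : ∀ p {u v} → p + h * u ≡ p + h * v → u ≡ v
        cancel p {u} {v} e = *-cancel-0< 0<h (trans (*-comm u h) (trans
          (trans (lemma p (h * u)) (trans (cong (_- p) e) (sym (lemma p (h * v))))) (*-comm h v)))
          where
          lemma : ∀ p z → z ≡ p + z - p
          lemma = RS.solve-∀ ℚring
        x≡ : qx ≡ rx
        x≡ = cancel (proj₁ apex) (cong proj₁ eq)
        y≡ : qy ≡ ry
        y≡ = *-cancel-0< (0<κ T) (trans (lemma (l T) (κ T) qx qy) (trans
          (cong₂ (λ s z → s - l T * z) (cancel (proj₂ apex) (cong proj₂ eq)) x≡) (sym (lemma (l T) (κ T) rx ry))))
          where
          lemma : ∀ l k x y → y * k ≡ (l * x + k * y) - l * x
          lemma = RS.solve-∀ ℚring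

      place-segment : ∀ q a b → OnSeg q (place a) (place b) → ∃ λ q′ → OnSeg q′ a b × q ≡ place q′
      place-segment (qx , qy) (ax , ay) (bx , by) (t , 0≤t , t≤1 , xeq , yeq) =
        (ax + t * (bx - ax) , ay + t * (by - ay)) , (t , 0≤t , t≤1 , refl , refl) ,
        cong₂ _,_ (trans xeq (eq₁ (proj₁ apex) h ax bx t)) (trans yeq (eq₂ (proj₂ apex) h (l T) (κ T) ax ay bx by t))
        where
        eq₁ : ∀ p h a b t → (p + h * a) + t * ((p + h * b) - (p + h * a)) ≡ p + h * (a + t * (b - a))
        eq₁ = RS.solve-∀ ℚring
        eq₂ : ∀ p h l k ax ay bx by t →
          (p + h * (l * ax + k * ay)) + t * ((p + h * (l * bx + k * by)) - (p + h * (l * ax + k * ay))) ≡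
          p + h * (l * (ax + t * (bx - ax)) + k * (ay + t * (by - ay)))
        eq₂ = RS.solve-∀ ℚring

      place-triangle : ∀ q → Cone m q → 0ℚ < proj₁ q → Triangle T (place q)
      place-triangle (x , y) (_ , x≤2 , 0≤y , y≤Mx) 0<x =
        subst (0ℚ <_) (sym (x-rel (proj₁ apex) h x)) (0<*0< 0<h 0<x) ,
        0≤-⇒≤ (subst (0ℚ ≤_) (trans (x-up (proj₁ apex) h x) (cong (_- (proj₁ apex + h * x - proj₁ apex)) (proj₂ (proj₂ (half (0<δ T))))))
          (0≤*0≤ (<⇒≤ 0<h) (≤⇒0≤- x≤2))) ,
        0≤-⇒≤ (subst (0ℚ ≤_) (y-low (proj₁ apex) (proj₂ apex) h (l T) (κ T) x y)
          (0≤*0≤ (<⇒≤ 0<h) (0≤*0≤ (<⇒≤ (0<κ T)) 0≤y))) ,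
        0≤-⇒≤ (subst (0ℚ ≤_) (y-up (proj₁ apex) (proj₂ apex) h (l T) (κ T) (height m) x y)
          (0≤*0≤ (<⇒≤ 0<h) (0≤*0≤ (<⇒≤ (0<κ T)) (≤⇒0≤- y≤Mx))))
        where
        x-rel : ∀ p h x → p + h * x - p ≡ h * x
        x-rel = RS.solve-∀ ℚring
        x-up : ∀ p h x → h * ((1ℚ + 1ℚ) - x) ≡ h + h - (p + h * x - p)
        x-up = RS.solve-∀ ℚring
        y-low : ∀ px py h l k x y → h * (k * y) ≡ py + h * (l * x + k * y) - py - l * (px + h * x - px)
        y-low = RS.solve-∀ ℚring
        y-up : ∀ px py h l k M x y → h * (k * (M * x - y)) ≡
          (l + k * M) * (px + h * x - px) - (py + h * (l * x + k * y) - py)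
        y-up = RS.solve-∀ ℚring

    index : ∀ u → Dec (∃ λ i → ν i ≡ u)
    index u = any? (λ i → ν i ≟ u)

    private
      fanAt : ∀ {u v} → Dec (∃ λ i → ν i ≡ u) → Dec (∃ λ i → ν i ≡ v) → Bool
      fanAt (yes (i , _)) (yes (j , _)) = fan i j
      fanAt (yes _) (no _) = false
      fanAt (no _) _ = false

    attached : Fin n → Fin n → Bool
    attached u v = fanAt (index u) (index v)

    attached-ν : ∀ i j → attached (ν i) (ν j) ≡ fan i j
    attached-ν i j with index (ν i) | index (ν j)
    ... | yes (i′ , p) | yes (j′ , q) = cong₂ fan (ν-inj p) (ν-inj q)
    ... | yes _ | no ∄j = ⊥-elim (∄j (j , refl))
    ... | no ∄i | _ = ⊥-elim (∄i (i , refl))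

    attached-inv : ∀ u v → attached u v ≡ true → ∃₂ λ i j → ν i ≡ u × ν j ≡ v × fan i j ≡ true
    attached-inv u v h with index u | index v
    ... | yes (i , p) | yes (j , q) = i , j , p , q , h
    attached-inv u v () | yes _ | no _
    attached-inv u v () | no _ | _

    attached-sym : Symm attached
    attached-sym u v with index u | index v
    ... | yes (i , _) | yes (j , _) = fan-sym i j
    ... | yes _ | no _ = refl
    ... | no _ | yes _ = refl
    ... | no _ | no _ = refl

    attached-irr : Irrefl attached
    attached-irr u with index u
    ... | yes (i , _) = fan-irrefl i
    ... | no _ = refl

    glue : Fin n → Fin n → Bool
    glue u v = Adj G u v ∨ attached u v

    glue-sym : Symm glue
    glue-sym u v = cong₂ _∨_ (Adj-sym G u v) (attached-sym u v)

    glue-irr : Irrefl glue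
    glue-irr u = cong₂ _∨_ (Adj-irrefl G u) (attached-irr u)

    private
      -- `ν 0F` counts as old and keeps its place, the apex. The other vertices of the fan are
      -- isolated in G, so they can be moved into the triangle without disturbing an arc.
      data View (w : Fin n) : Set where
        new : ∀ i → ν (Fin.suc i) ≡ w → View w
        old : (∀ i → ν (Fin.suc i) ≢ w) → View w

      view : ∀ w → View w
      view w with any? (λ i → ν (Fin.suc i) ≟ w)
      ... | yes (i , p) = new i p
      ... | no ∄ = old (λ i p → ∄ (i , p))

      posView : ∀ {w} → View w → Pt
      posView (new i _)   = place (fanPos (Fin.suc i))
      posView {w} (old _) = pos w

      pos′ : Fin n → Pt
      pos′ w = posView (view w)

      pos′-ν : ∀ i → pos′ (ν i) ≡ place (fanPos i)
      pos′-ν 0F with view (ν 0F)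
      ... | old _ = sym place-origin
      ... | new i p with ν-inj p
      ...   | ()
      pos′-ν (Fin.suc i) with view (ν (Fin.suc i))
      ... | new j p = cong (place ∘ fanPos) (ν-inj p)
      ... | old ≢ν = ⊥-elim (≢ν i refl)

      pos′-old : ∀ {w} → (∀ i → ν (Fin.suc i) ≢ w) → pos′ w ≡ pos w
      pos′-old {w} ≢ν with view w
      ... | new i p = ⊥-elim (≢ν i p)
      ... | old _ = refl

      place≢pos : ∀ q w → Cone m q → 0ℚ < proj₁ q → place q ≢ pos w
      place≢pos q w cone 0<x eq =
        proj₂ (proj₂ (avoid-drawing D)) w (subst (Triangle T) eq (place-triangle q cone 0<x))

      place≡pos⇒apex : ∀ q w → Cone m q → place q ≡ pos w → q ≡ (0ℚ , 0ℚ) × w ≡ ν 0F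
      place≡pos⇒apex q w cone eq = q≡0 , pos-inj (trans (sym eq) (trans (cong place q≡0) place-origin))
        where
        q≡0 : q ≡ (0ℚ , 0ℚ)
        q≡0 = cone-origin {m} q cone (λ 0<x → place≢pos q w cone 0<x eq)

      pos′-inj : Injective _≡_ _≡_ pos′
      pos′-inj {u} {v} eq with view u | view v
      ... | old _ | old _ = pos-inj eq
      ... | new i refl | new j refl = cong ν (fanPos-injective (place-injective eq))
      ... | new i _ | old _ = ⊥-elim (place≢pos _ v (fanPos-cone (Fin.suc i)) (fanPos-positive i) eq)
      ... | old _ | new i _ = ⊥-elim (place≢pos _ u (fanPos-cone (Fin.suc i)) (fanPos-positive i) (sym eq))

      endpoint-old : ∀ {u v} → Adj G u v ≡ true → ∀ i → ν (Fin.suc i) ≢ u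
      endpoint-old {v = v} uv i refl with trans (sym (isolated i v)) uv
      ... | ()

      glue-true : ∀ u v → Adj (fromAdj glue) u v ≡ true → Adj G u v ≡ true ⊎ attached u v ≡ true
      glue-true u v uv = ∨-true (trans (sym (Adj-fromAdj glue-sym glue-irr u v)) uv)

      distinct : ∀ u v → toℕ u ℕ.< toℕ v → pos′ u ≢ pos′ v
      distinct u v u<v eq = ℕₚ.<-irrefl (cong toℕ (pos′-inj eq)) u<v

      arcOf : ∀ u v → toℕ u ℕ.< toℕ v → Adj G u v ≡ true ⊎ attached u v ≡ true → Arc
      arcOf u v u<v (inj₁ uv) = arc (u , v , u<v , uv)
      arcOf u v u<v (inj₂ _)  = straight (pos′ u) (pos′ v) (distinct u v u<v)

      on-straight : ∀ {q a b} (a≢b : a ≢ b) → OnArc q (straight a b a≢b) → OnSeg q a b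
      on-straight _ (0F , on) = on

      on-attached : ∀ {q u v} u<v (uv : attached u v ≡ true) → OnArc q (arcOf u v u<v (inj₂ uv)) →
        ∃₂ λ i j → ν i ≡ u × ν j ≡ v × fan i j ≡ true × ∃ λ q′ → OnSeg q′ (fanPos i) (fanPos j) × q ≡ place q′
      on-attached {q} {u} {v} u<v uv on with attached-inv u v uv
      ... | i , j , refl , refl , ij = i , j , refl , refl , ij ,
        place-segment q (fanPos i) (fanPos j)
          (subst₂ (OnSeg q) (pos′-ν i) (pos′-ν j) (on-straight (distinct u v u<v) on))

      arc-start′ : ∀ u v u<v k → start (arcOf u v u<v k) ≡ pos′ u
      arc-start′ u v u<v (inj₁ uv) = trans (arc-start (u , v , u<v , uv)) (sym (pos′-old (endpoint-old uv)))
      arc-start′ u v u<v (inj₂ _)  = refl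

      arc-end′ : ∀ u v u<v k → end (arcOf u v u<v k) ≡ pos′ v
      arc-end′ u v u<v (inj₁ uv) = trans (arc-end (u , v , u<v , uv)) (sym (pos′-old (endpoint-old (trans (Adj-sym G v u) uv))))
      arc-end′ u v u<v (inj₂ _)  = refl

      avoid′ : ∀ u v u<v k w → w ≢ u → w ≢ v → ¬ OnArc (pos′ w) (arcOf u v u<v k)
      avoid′ u v u<v (inj₁ uv) w w≢u w≢v on with view w
      ... | old _ = avoid (u , v , u<v , uv) w w≢u w≢v on
      ... | new i _ = proj₁ (proj₂ (avoid-drawing D)) (u , v , u<v , uv) _ on
                        (place-triangle _ (fanPos-cone (Fin.suc i)) (fanPos-positive i))
      avoid′ u v u<v (inj₂ uv) w w≢u w≢v on with on-attached u<v uv on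
      ... | i , j , refl , refl , ij , q , onq , eq with view w
      ...   | old _ = let q≡0 , w≡ν0 = place≡pos⇒apex q w (fan-cone {m} {i} {j} ij q onq) (sym eq) in
                [ (λ p → w≢u (trans w≡ν0 (cong ν p))) , (λ p → w≢v (trans w≡ν0 (cong ν p))) ]
                  (fan-off {m} {i} {j} ij 0F (subst (λ q → OnSeg q (fanPos i) (fanPos j)) q≡0 onq))
      ...   | new l refl = [ (λ p → w≢u (cong ν p)) , (λ p → w≢v (cong ν p)) ]
                (fan-off {m} {i} {j} ij (Fin.suc l) (subst (λ q → OnSeg q (fanPos i) (fanPos j)) (sym (place-injective eq)) onq))

      Common : Fin n → Fin n → Fin n → Fin n → Pt → Set
      Common u v u′ v′ q = ∃ λ w → (q ≡ pos′ w) × (w ≡ u ⊎ w ≡ v) × (w ≡ u′ ⊎ w ≡ v′)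

      -- A common point other than the apex would lie in the triangle, which old arcs avoid; and an
      -- old arc contains the apex only as an end.
      cross-mixed : ∀ u v u<v (uv : Adj G u v ≡ true) u′ v′ u′<v′ (uv′ : attached u′ v′ ≡ true) q →
        OnArc q (arc (u , v , u<v , uv)) → OnArc q (arcOf u′ v′ u′<v′ (inj₂ uv′)) → Common u v u′ v′ q
      cross-mixed u v u<v uv u′ v′ u′<v′ uv′ q on on′ with on-attached u′<v′ uv′ on′
      ... | i , j , refl , refl , ij , q′ , onq′ , refl = ν 0F , trans (cong place q′≡0) (sym (pos′-ν 0F)) , first , second
        where
        q′≡0 : q′ ≡ (0ℚ , 0ℚ)
        q′≡0 = cone-origin {m} q′ (fan-cone {m} {i} {j} ij q′ onq′)
          (λ 0<x → proj₁ (proj₂ (avoid-drawing D)) (u , v , u<v , uv) _ on (place-triangle q′ (fan-cone {m} {i} {j} ij q′ onq′) 0<x))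
        first : ν 0F ≡ u ⊎ ν 0F ≡ v
        first = endpoint (ν 0F ≟ u) (ν 0F ≟ v)
          where
          endpoint : Dec (ν 0F ≡ u) → Dec (ν 0F ≡ v) → ν 0F ≡ u ⊎ ν 0F ≡ v
          endpoint (yes p) _ = inj₁ p
          endpoint (no _) (yes p) = inj₂ p
          endpoint (no p) (no r) = ⊥-elim (avoid (u , v , u<v , uv) (ν 0F) p r
            (subst (λ q → OnArc q (arc (u , v , u<v , uv))) (trans (cong place q′≡0) place-origin) on))
        second : ν 0F ≡ ν i ⊎ ν 0F ≡ ν j
        second = Data.Sum.map (cong ν) (cong ν) (fan-off {m} {i} {j} ij 0F (subst (λ q → OnSeg q (fanPos i) (fanPos j)) q′≡0 onq′))

      cross-old : ∀ u v u<v (uv : Adj G u v ≡ true) u′ v′ u′<v′ (uv′ : Adj G u′ v′ ≡ true) → (u , v) ≢ (u′ , v′) → ∀ q →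
        OnArc q (arc (u , v , u<v , uv)) → OnArc q (arc (u′ , v′ , u′<v′ , uv′)) → Common u v u′ v′ q
      cross-old u v u<v uv u′ v′ u′<v′ uv′ ≢e q on on′ =
        let w , q≡ , w∈e , w∈f = cross (u , v , u<v , uv) (u′ , v′ , u′<v′ , uv′) ≢e q on on′
        in w , trans q≡ (sym (pos′-old (old-end w w∈e))) , w∈e , w∈f
        where
        old-end : ∀ w → w ≡ u ⊎ w ≡ v → ∀ i → ν (Fin.suc i) ≢ w
        old-end w (inj₁ p) i r = endpoint-old uv i (trans r p)
        old-end w (inj₂ p) i r = endpoint-old (trans (Adj-sym G v u) uv) i (trans r p)

      fan-meet-placed : ∀ {i j i′ j′} → fan i j ≡ true → fan i′ j′ ≡ true → ∀ q r r′ →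
        OnSeg r (fanPos i) (fanPos j) → OnSeg r′ (fanPos i′) (fanPos j′) → q ≡ place r → q ≡ place r′ →
        ((i ≡ i′ × j ≡ j′) ⊎ (i ≡ j′ × j ≡ i′)) ⊎ (∃ λ w → q ≡ pos′ (ν w) × (w ≡ i ⊎ w ≡ j) × (w ≡ i′ ⊎ w ≡ j′))
      fan-meet-placed {i} {j} {i′} {j′} ij ij′ q r r′ onr onr′ q≡ q≡′ =
        Data.Sum.map₂ (λ (w , r≡ , w∈e , w∈f) → w , trans q≡ (trans (cong place r≡) (sym (pos′-ν w))) , w∈e , w∈f)
          (fan-meet {m} {i} {j} {i′} {j′} ij ij′ r onr (subst (λ z → OnSeg z (fanPos i′) (fanPos j′)) (sym (place-injective {r} {r′} (trans (sym q≡) q≡′))) onr′))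

      cross-new : ∀ u v u<v (uv : attached u v ≡ true) u′ v′ u′<v′ (uv′ : attached u′ v′ ≡ true) → (u , v) ≢ (u′ , v′) → ∀ q →
        OnArc q (arcOf u v u<v (inj₂ uv)) → OnArc q (arcOf u′ v′ u′<v′ (inj₂ uv′)) → Common u v u′ v′ q
      cross-new u v u<v uv u′ v′ u′<v′ uv′ ≢e q on on′ =
        let i , j , νi , νj , ij , r , onr , q≡ = on-attached u<v uv on
            i′ , j′ , νi′ , νj′ , ij′ , r′ , onr′ , q≡′ = on-attached u′<v′ uv′ on′
        in conclude i j i′ j′ νi νj νi′ νj′ (fan-meet-placed {i} {j} {i′} {j′} ij ij′ q r r′ onr onr′ q≡ q≡′)
        where
        conclude : ∀ i j i′ j′ → ν i ≡ u → ν j ≡ v → ν i′ ≡ u′ → ν j′ ≡ v′ →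
          ((i ≡ i′ × j ≡ j′) ⊎ (i ≡ j′ × j ≡ i′)) ⊎ (∃ λ w → q ≡ pos′ (ν w) × (w ≡ i ⊎ w ≡ j) × (w ≡ i′ ⊎ w ≡ j′)) →
          Common u v u′ v′ q
        conclude i j i′ j′ νi νj νi′ νj′ (inj₁ (inj₁ (p , r))) =
          ⊥-elim (≢e (cong₂ _,_ (trans (sym νi) (trans (cong ν p) νi′)) (trans (sym νj) (trans (cong ν r) νj′))))
        -- The same edge of the fan with its ends exchanged; impossible, as both edges are listed
        -- from the smaller to the larger index.
        conclude i j i′ j′ νi νj νi′ νj′ (inj₁ (inj₂ (p , r))) = ⊥-elim (ℕₚ.<-asym u<v
          (subst₂ (λ x y → toℕ x ℕ.< toℕ y) (trans (sym νi′) (trans (cong ν (sym r)) νj)) (trans (sym νj′) (trans (cong ν (sym p)) νi)) u′<v′))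
        conclude i j i′ j′ νi νj νi′ νj′ (inj₂ (w , q≡ , w∈e , w∈f)) = ν w , q≡ ,
          Data.Sum.map (λ p → trans (cong ν p) νi) (λ p → trans (cong ν p) νj) w∈e ,
          Data.Sum.map (λ p → trans (cong ν p) νi′) (λ p → trans (cong ν p) νj′) w∈f

      cross′ : ∀ u v u<v k u′ v′ u′<v′ k′ → (u , v) ≢ (u′ , v′) → ∀ q →
        OnArc q (arcOf u v u<v k) → OnArc q (arcOf u′ v′ u′<v′ k′) → Common u v u′ v′ q
      cross′ u v u<v (inj₁ uv) u′ v′ u′<v′ (inj₁ uv′) ≢e q on on′ = cross-old u v u<v uv u′ v′ u′<v′ uv′ ≢e q on on′
      cross′ u v u<v (inj₁ uv) u′ v′ u′<v′ (inj₂ uv′) _ q on on′ = cross-mixed u v u<v uv u′ v′ u′<v′ uv′ q on on′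
      cross′ u v u<v (inj₂ uv) u′ v′ u′<v′ (inj₁ uv′) _ q on on′ =
        let w , q≡ , w∈f , w∈e = cross-mixed u′ v′ u′<v′ uv′ u v u<v uv q on′ on in w , q≡ , w∈e , w∈f
      cross′ u v u<v (inj₂ uv) u′ v′ u′<v′ (inj₂ uv′) ≢e q on on′ = cross-new u v u<v uv u′ v′ u′<v′ uv′ ≢e q on on′

    glue-drawing : Drawing (fromAdj glue)
    glue-drawing = record
      { pos = pos′
      ; pos-inj = pos′-inj
      ; arc = λ (u , v , u<v , uv) → arcOf u v u<v (glue-true u v uv)
      ; arc-start = λ (u , v , u<v , uv) → arc-start′ u v u<v (glue-true u v uv)
      ; arc-end = λ (u , v , u<v , uv) → arc-end′ u v u<v (glue-true u v uv)
      ; avoid = λ (u , v , u<v , uv) → avoid′ u v u<v (glue-true u v uv)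
      ; cross = λ (u , v , u<v , uv) (u′ , v′ , u′<v′ , uv′) →
          cross′ u v u<v (glue-true u v uv) u′ v′ u′<v′ (glue-true u′ v′ uv′)
      }

-- Cycles as cyclic sequences, and embeddings of the forbidden graphs.

module CyclesInGraphs where

  open VanKampen using (Adj-sym)
  open Contractions using (∧-true; ∨-true)
  open import Data.Nat using (_<_; s≤s; _≡ᵇ_; _<ᵇ_)
  open import Data.Nat.Properties as ℕₚ using (_<?_)
  open import Data.Fin.Properties as Finₚ using (_≟_; any?; all?; toℕ-injective; toℕ-fromℕ<; toℕ-inject₁; toℕ-fromℕ; toℕ<n; splitAt-↑ˡ; splitAt-↑ʳ; splitAt⁻¹-↑ˡ; splitAt⁻¹-↑ʳ)
  open import Data.Fin.Relation.Unary.Top using (view; ‵fromℕ; ‵inject₁)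
  open import Data.Bool using (T)
  import Data.Bool.Properties as Bool
  open import Data.Vec.Functional using (_∷_)
  open import Relation.Nullary.Decidable using (_×-dec_; _→-dec_; ¬?; map′)

  next : ∀ {k} → Fin (suc k) → Fin (suc k)
  next {k} i with suc (toℕ i) <? suc k
  ... | yes p = fromℕ< p
  ... | no _  = Fin.zero

  next-inject₁ : ∀ {k} (i : Fin k) → next (inject₁ i) ≡ Fin.suc i
  next-inject₁ {k} i with suc (toℕ (inject₁ i)) <? suc k
  ... | yes p = toℕ-injective (trans (toℕ-fromℕ< p) (cong suc (toℕ-inject₁ i)))
  ... | no ¬p = ⊥-elim (¬p (s≤s (subst (_< k) (sym (toℕ-inject₁ i)) (toℕ<n i))))

  next-last : ∀ k → next (fromℕ k) ≡ Fin.zero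
  next-last k with suc (toℕ (fromℕ k)) <? suc k
  ... | yes (s≤s p) = ⊥-elim (ℕₚ.<-irrefl (toℕ-fromℕ k) p)
  ... | no _ = refl

  next-injective : ∀ {k} → Injective _≡_ _≡_ (next {k})
  next-injective {k} {i} {j} eq with view i | view j
  ... | ‵fromℕ | ‵fromℕ = refl
  ... | ‵inject₁ i | ‵inject₁ j = cong inject₁ (Finₚ.suc-injective (trans (sym (next-inject₁ i)) (trans eq (next-inject₁ j))))
  ... | ‵fromℕ | ‵inject₁ j with trans (sym (next-last k)) (trans eq (next-inject₁ j))
  ...   | ()
  next-injective {k} eq | ‵inject₁ i | ‵fromℕ with trans (sym (next-inject₁ i)) (trans eq (next-last k))
  ...   | ()

  next-surjective : ∀ {k} (i : Fin (suc k)) → ∃ λ j → next j ≡ i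
  next-surjective {k} Fin.zero    = fromℕ k , next-last k
  next-surjective     (Fin.suc i) = inject₁ i , next-inject₁ i

  record IsCycle {n k} (a : Fin n → Fin n → Bool) (f : Fin (suc k) → Fin n) : Set where
    constructor isCycle
    field
      distinct : ∀ i j → f i ≡ f j → i ≡ j
      linked   : ∀ i → a (f i) (f (next i)) ≡ true

  open IsCycle public

  -- Needed twice: `C⁺` has its pendant edge at vertex zero, and a cycle through a cut vertex is
  -- opened there.
  rotate : ∀ {n k} {a : Fin n → Fin n → Bool} {f : Fin (suc k) → Fin n} → IsCycle a f → ∀ i →
    ∃ λ (g : Fin (suc k) → Fin n) → IsCycle a g × g Fin.zero ≡ f i × (∀ i → ∃ λ j → f i ≡ g j) × (∀ i → ∃ λ j → g i ≡ f j)
  rotate {n} {k} {a} cyc i = helper (toℕ i) cyc i refl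
    where
    helper : ∀ t {f : Fin (suc k) → Fin n} → IsCycle a f → ∀ i → toℕ i ≡ t →
      ∃ λ (g : Fin (suc k) → Fin n) → IsCycle a g × g Fin.zero ≡ f i × (∀ i → ∃ λ j → f i ≡ g j) × (∀ i → ∃ λ j → g i ≡ f j)
    helper zero {f} cyc Fin.zero _ = f , cyc , refl , (λ i → i , refl) , (λ i → i , refl)
    helper (suc t) {f} (isCycle inj adj) (Fin.suc i) eq =
      let g , cyc , g₀ , f⊆g , g⊆f = helper t {f ∘ next} (isCycle (λ i j p → next-injective (inj _ _ p)) (λ i → adj (next i)))
            (inject₁ i) (trans (toℕ-inject₁ i) (ℕₚ.suc-injective eq))
      in g , cyc , trans g₀ (cong f (next-inject₁ i)) ,
         (λ j → let j′ , p = next-surjective j ; l , q = f⊆g j′ in l , trans (cong f (sym p)) q) ,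
         (λ j → let l , q = g⊆f j in next l , q)

  module _ {n : ℕ} where

    -- Functions are enumerated value by value and so are known only up to pointwise equality; hence
    -- the condition that P respects it.
    any-function? : ∀ m {P : (Fin m → Fin n) → Set} → (∀ {f g} → (∀ i → f i ≡ g i) → P f → P g) →
      (∀ f → Dec (P f)) → Dec (∃ P)
    any-function? zero ext P? = map′ (λ p → empty , p) (λ (f , p) → ext {f} {empty} (λ ()) p) (P? empty)
      where
      empty : Fin 0 → Fin n
      empty ()
    any-function? (suc m) ext P? = map′
      (λ (x , f , p) → x ∷ f , p)
      (λ (f , p) → f Fin.zero , f ∘ Fin.suc , ext (λ { Fin.zero → refl ; (Fin.suc i) → refl }) p)
      (any? (λ x → any-function? m (λ f≗g → ext (λ { Fin.zero → refl ; (Fin.suc i) → f≗g i })) (λ f → P? (x ∷ f))))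

    module _ {k : ℕ} (a : Fin n → Fin n → Bool) where

      IsCycle-ext : ∀ {f g : Fin (suc k) → Fin n} → (∀ i → f i ≡ g i) → IsCycle a f → IsCycle a g
      IsCycle-ext f≗g (isCycle inj adj) = isCycle
        (λ i j p → inj i j (trans (f≗g i) (trans p (sym (f≗g j)))))
        (λ i → subst₂ (λ u v → a u v ≡ true) (f≗g i) (f≗g (next i)) (adj i))

      isCycle? : ∀ (f : Fin (suc k) → Fin n) → Dec (IsCycle a f)
      isCycle? f = map′ (λ (inj , adj) → isCycle inj adj) (λ (isCycle inj adj) → inj , adj)
        (all? (λ i → all? (λ j → (f i ≟ f j) →-dec (i ≟ j))) ×-dec all? (λ i → a (f i) (f (next i)) Bool.≟ true))

      cycle? : ∀ {Q : (Fin (suc k) → Fin n) → Set} → (∀ {f g} → (∀ i → f i ≡ g i) → Q f → Q g) → (∀ f → Dec (Q f)) →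
        Dec (∃ λ f → IsCycle a f × Q f)
      cycle? ext Q? = any-function? (suc k) (λ f≗g (c , q) → IsCycle-ext f≗g c , ext f≗g q) (λ f → isCycle? f ×-dec Q? f)

  TwoCycles : ∀ {n} k → (Fin n → Fin n → Bool) → Set
  TwoCycles {n} k a = ∃ λ (f : Fin (suc k) → Fin n) → IsCycle a f × ∃ λ (g : Fin (suc k) → Fin n) → IsCycle a g × (∀ i j → f i ≢ g j)

  twoCycles? : ∀ {n} k (a : Fin n → Fin n → Bool) → Dec (TwoCycles k a)
  twoCycles? k a = cycle? a
    (λ f≗f′ (g , cyc , disj) → g , cyc , λ i j p → disj i j (trans (f≗f′ i) p))
    (λ f → cycle? a (λ g≗g′ disj i j p → disj i j (trans p (sym (g≗g′ j)))) (λ g → all? (λ i → all? (λ j → ¬? (f i ≟ g j)))))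

  T⇒≡ : ∀ {b} → T b → b ≡ true
  T⇒≡ {true} _ = refl

  ≡⇒T : ∀ {b} → b ≡ true → T b
  ≡⇒T refl = tt

  private
    ≡ᵇ-refl : ∀ n → (n ≡ᵇ n) ≡ true
    ≡ᵇ-refl n = T⇒≡ (ℕₚ.≡⇒≡ᵇ n n refl)

    ≡ᵇ-≡ : ∀ {m n} → (m ≡ᵇ n) ≡ true → m ≡ n
    ≡ᵇ-≡ {m} {n} h = ℕₚ.≡ᵇ⇒≡ m n (≡⇒T h)

  cycRel-next : ∀ {k} (i : Fin (suc k)) → cycRel (suc k) (toℕ i) (toℕ (next i)) ≡ true
  cycRel-next {k} i with view i
  ... | ‵inject₁ i rewrite next-inject₁ i | toℕ-inject₁ i | ≡ᵇ-refl (toℕ i) = refl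
  ... | ‵fromℕ rewrite next-last k | toℕ-fromℕ k | ≡ᵇ-refl k = refl

  cycRel-inv : ∀ {k} (i j : Fin (suc k)) → cycRel (suc k) (toℕ i) (toℕ j) ≡ true → j ≡ next i
  cycRel-inv {k} i j h with ∨-true {suc (toℕ i) ≡ᵇ toℕ j} h
  cycRel-inv {k} i (Fin.suc j) h | inj₁ p = trans (sym (next-inject₁ j))
    (cong next (toℕ-injective (trans (toℕ-inject₁ j) (sym (≡ᵇ-≡ {toℕ i} p)))))
  cycRel-inv {k} i Fin.zero h | inj₂ p = trans (sym (next-last k))
    (cong next (toℕ-injective (trans (toℕ-fromℕ k) (sym (≡ᵇ-≡ (proj₁ (∧-true {toℕ i ≡ᵇ k} p)))))))
  cycRel-inv {k} i (Fin.suc j) h | inj₂ p with proj₂ (∧-true {toℕ i ≡ᵇ k} p)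
  ... | ()

  next-≢ : ∀ {k} (i : Fin (suc (suc k))) → i ≢ next i
  next-≢ {k} i eq with view i
  ... | ‵inject₁ i = ℕₚ.<-irrefl (trans (sym (toℕ-inject₁ i)) (cong toℕ (trans eq (next-inject₁ i)))) ℕₚ.≤-refl
  ... | ‵fromℕ with trans eq (next-last (suc k))
  ...   | ()

  append : ∀ {n k l} → (Fin k → Fin n) → (Fin l → Fin n) → Fin (k ℕ.+ l) → Fin n
  append {k = k} f g i = [ f , g ] (splitAt k i)

  append-injective : ∀ {n k l} {f : Fin k → Fin n} {g : Fin l → Fin n} → (∀ i j → f i ≡ f j → i ≡ j) →
    (∀ i j → g i ≡ g j → i ≡ j) → (∀ i j → f i ≢ g j) → Injective _≡_ _≡_ (append f g)
  append-injective {k = k} {l} f-inj g-inj disj {i} {j} eq with splitAt k i in p | splitAt k j in q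
  ... | inj₁ x | inj₁ y = trans (sym (splitAt⁻¹-↑ˡ p)) (trans (cong (_↑ˡ l) (f-inj x y eq)) (splitAt⁻¹-↑ˡ q))
  ... | inj₂ x | inj₂ y = trans (sym (splitAt⁻¹-↑ʳ p)) (trans (cong (k ↑ʳ_) (g-inj x y eq)) (splitAt⁻¹-↑ʳ q))
  ... | inj₁ x | inj₂ y = ⊥-elim (disj x y eq)
  ... | inj₂ x | inj₁ y = ⊥-elim (disj y x (sym eq))

  append-left : ∀ {n k l} (f : Fin k → Fin n) (g : Fin l → Fin n) i → append f g (i ↑ˡ l) ≡ f i
  append-left {k = k} {l} f g i = cong [ f , g ] (splitAt-↑ˡ k i l)

  append-right : ∀ {n k l} (f : Fin k → Fin n) (g : Fin l → Fin n) i → append f g (k ↑ʳ i) ≡ g i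
  append-right {k = k} {l} f g i = cong [ f , g ] (splitAt-↑ʳ k l i)

  append-all : ∀ {n k l} {f : Fin k → Fin n} {g : Fin l → Fin n} {P : Fin n → Set} →
    (∀ i → P (f i)) → (∀ i → P (g i)) → ∀ i → P (append f g i)
  append-all {k = k} {f = f} {g} pf pg i with splitAt k i
  ... | inj₁ x = pf x
  ... | inj₂ y = pg y

  module _ {k l : ℕ} (G : Graph k) (H : Graph l) where

    ⊕-inv : ∀ i j → rel (G ⊕ H) i j ≡ true →
      (∃₂ λ x y → splitAt k i ≡ inj₁ x × splitAt k j ≡ inj₁ y × rel G x y ≡ true) ⊎
      (∃₂ λ x y → splitAt k i ≡ inj₂ x × splitAt k j ≡ inj₂ y × rel H x y ≡ true)
    ⊕-inv i j h with splitAt k i | splitAt k j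
    ... | inj₁ x | inj₁ y = inj₁ (x , y , refl , refl , h)
    ... | inj₂ x | inj₂ y = inj₂ (x , y , refl , refl , h)
    ⊕-inv i j () | inj₁ _ | inj₂ _
    ⊕-inv i j () | inj₂ _ | inj₁ _

    ⊕-left : ∀ x y → rel (G ⊕ H) (x ↑ˡ l) (y ↑ˡ l) ≡ rel G x y
    ⊕-left x y rewrite splitAt-↑ˡ k x l | splitAt-↑ˡ k y l = refl

    ⊕-right : ∀ x y → rel (G ⊕ H) (k ↑ʳ x) (k ↑ʳ y) ≡ rel H x y
    ⊕-right x y rewrite splitAt-↑ʳ k l x | splitAt-↑ʳ k l y = refl

  Adj⇒rel : ∀ {n} (G : Graph n) i j → Adj G i j ≡ true → rel G i j ≡ true ⊎ rel G j i ≡ true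
  Adj⇒rel G i j h with i ≟ j
  ... | no _ = ∨-true h
  Adj⇒rel G i j () | yes _

  rel⇒Adj : ∀ {n} (G : Graph n) i j → i ≢ j → rel G i j ≡ true → Adj G i j ≡ true
  rel⇒Adj G i j i≢j h with i ≟ j
  ... | yes p = ⊥-elim (i≢j p)
  ... | no _ rewrite h = refl

  module _ {n k l} (A : Graph n) (G : Graph k) (H : Graph l) where

    ⊕-embed : (f : Fin k → Fin n) (g : Fin l → Fin n) → (∀ i j → f i ≡ f j → i ≡ j) → (∀ i j → g i ≡ g j → i ≡ j) →
      (∀ i j → f i ≢ g j) → (∀ i j → rel G i j ≡ true → Adj A (f i) (f j) ≡ true) →
      (∀ i j → rel H i j ≡ true → Adj A (g i) (g j) ≡ true) → (G ⊕ H) ⊆ A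
    ⊕-embed f g f-inj g-inj disj f-adj g-adj = φ , φ-inj , λ i j h →
      [ φ-adj i j , (λ r → trans (Adj-sym A (φ i) (φ j)) (φ-adj j i r)) ] (Adj⇒rel (G ⊕ H) i j h)
      where
      φ = append f g
      φ-inj : Injective _≡_ _≡_ φ
      φ-inj = append-injective f-inj g-inj disj
      φ-adj : ∀ i j → rel (G ⊕ H) i j ≡ true → Adj A (φ i) (φ j) ≡ true
      φ-adj i j h with ⊕-inv G H i j h
      ... | inj₁ (x , y , p , q , xy) rewrite p | q = f-adj x y xy
      ... | inj₂ (x , y , p , q , xy) rewrite p | q = g-adj x y xy

  module _ {n k : ℕ} (A : Graph n) where

    cycle-adj : ∀ {f : Fin (suc k) → Fin n} → IsCycle (Adj A) f →
      ∀ i j → cycRel (suc k) (toℕ i) (toℕ j) ≡ true → Adj A (f i) (f j) ≡ true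
    cycle-adj {f} (isCycle _ adj) i j h = trans (cong (λ j → Adj A (f i) (f j)) (cycRel-inv i j h)) (adj i)

    twoCycles⇒⊆ : TwoCycles k (Adj A) → (C (suc k) ⊕ C (suc k)) ⊆ A
    twoCycles⇒⊆ (f , f-cyc , g , g-cyc , disj) =
      ⊕-embed A (C (suc k)) (C (suc k)) f g (distinct f-cyc) (distinct g-cyc) disj (cycle-adj f-cyc) (cycle-adj g-cyc)

    pendant⇒⊆ : ∀ {f g : Fin (suc k) → Fin n} {w} → IsCycle (Adj A) f → IsCycle (Adj A) g → (∀ i j → f i ≢ g j) →
      (∀ i → f i ≢ w) → (∀ i → g i ≢ w) → Adj A w (g Fin.zero) ≡ true → (C (suc k) ⊕ C⁺ (suc k)) ⊆ A
    pendant⇒⊆ {f} {g} {w} f-cyc g-cyc disj f≢w g≢w w-g₀ =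
      ⊕-embed A (C (suc k)) (C⁺ (suc k)) f g⁺ (distinct f-cyc) (λ i j → g⁺-inj (view i) (view j)) f-disj (cycle-adj f-cyc) g⁺-adj
      where
      open import Data.Fin.Relation.Unary.Top using (View)
      extend : ∀ {i : Fin (suc (suc k))} → View i → Fin n
      extend ‵fromℕ = w
      extend (‵inject₁ i) = g i
      g⁺ : Fin (suc (suc k)) → Fin n
      g⁺ i = extend (view i)
      g⁺-inj : ∀ {i j} (v : View i) (v′ : View j) → extend v ≡ extend v′ → i ≡ j
      g⁺-inj ‵fromℕ ‵fromℕ _ = refl
      g⁺-inj (‵inject₁ i) (‵inject₁ j) eq = cong inject₁ (distinct g-cyc i j eq)
      g⁺-inj ‵fromℕ (‵inject₁ j) eq = ⊥-elim (g≢w j (sym eq))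
      g⁺-inj (‵inject₁ i) ‵fromℕ eq = ⊥-elim (g≢w i eq)
      f-disj : ∀ i j → f i ≢ g⁺ j
      f-disj i j with view j
      ... | ‵fromℕ = f≢w i
      ... | ‵inject₁ j = disj i j
      g⁺-adj : ∀ i j → rel (C⁺ (suc k)) i j ≡ true → Adj A (g⁺ i) (g⁺ j) ≡ true
      g⁺-adj i j h with ∨-true {(toℕ i <ᵇ suc k) ∧ (toℕ j <ᵇ suc k) ∧ cycRel (suc k) (toℕ i) (toℕ j)} h | view i | view j
      ... | inj₁ p | ‵inject₁ i | ‵inject₁ j =
        cycle-adj g-cyc i j (subst₂ (λ x y → cycRel (suc k) x y ≡ true) (toℕ-inject₁ i) (toℕ-inject₁ j)
          (proj₂ (∧-true {toℕ (inject₁ j) <ᵇ suc k} (proj₂ (∧-true {toℕ (inject₁ i) <ᵇ suc k} p)))))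
      ... | inj₁ p | ‵fromℕ | _ =
        ⊥-elim (ℕₚ.<-irrefl (toℕ-fromℕ (suc k)) (ℕₚ.<ᵇ⇒< _ _ (≡⇒T (proj₁ (∧-true {toℕ (fromℕ (suc k)) <ᵇ suc k} p)))))
      ... | inj₁ p | ‵inject₁ i | ‵fromℕ =
        ⊥-elim (ℕₚ.<-irrefl (toℕ-fromℕ (suc k)) (ℕₚ.<ᵇ⇒< _ _ (≡⇒T (proj₁ (∧-true {toℕ (fromℕ (suc k)) <ᵇ suc k}
          (proj₂ (∧-true {toℕ (inject₁ i) <ᵇ suc k} p)))))))
      ... | inj₂ p | ‵inject₁ i | _ = ⊥-elim (ℕₚ.<-irrefl (trans (sym (toℕ-inject₁ i)) (≡ᵇ-≡ (proj₁ (∧-true {toℕ (inject₁ i) ≡ᵇ suc k} p)))) (toℕ<n i))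
      ... | inj₂ p | ‵fromℕ | ‵fromℕ with proj₂ (∧-true {toℕ (fromℕ (suc k)) ≡ᵇ suc k} p)
      ...   | ()
      g⁺-adj _ _ _ | inj₂ p | ‵fromℕ | ‵inject₁ (Fin.suc j′) with proj₂ (∧-true {toℕ (fromℕ (suc k)) ≡ᵇ suc k} p)
      ...   | ()
      g⁺-adj _ _ _ | inj₂ p | ‵fromℕ | ‵inject₁ Fin.zero = w-g₀

  module _ {n k : ℕ} (A : Graph n) where

    private
      -- The length is at least two, so `next i` differs from `i` and the relation of H is not
      -- discarded as a loop by `Adj`.
      cycle-of : ∀ {l} (H : Graph l) (φ : Fin l → Fin n) (ι : Fin (suc (suc k)) → Fin l) →
        Injective _≡_ _≡_ φ → (∀ {i j} → ι i ≡ ι j → i ≡ j) → (∀ i j → Adj H i j ≡ true → Adj A (φ i) (φ j) ≡ true) →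
        (∀ i → rel H (ι i) (ι (next i)) ≡ true) → IsCycle (Adj A) (φ ∘ ι)
      cycle-of H φ ι φ-inj ι-inj φ-adj ι-adj = isCycle (λ i j p → ι-inj (φ-inj p))
        (λ i → φ-adj _ _ (rel⇒Adj H (ι i) (ι (next i)) (next-≢ i ∘ ι-inj) (ι-adj i)))

    ⊆⇒twoCycles : (C (suc (suc k)) ⊕ C (suc (suc k))) ⊆ A → TwoCycles (suc k) (Adj A)
    ⊆⇒twoCycles (φ , φ-inj , φ-adj) =
      φ ∘ (_↑ˡ K) , cycle-of (C K ⊕ C K) φ (_↑ˡ K) φ-inj (Finₚ.↑ˡ-injective K _ _) φ-adj (λ i → trans (⊕-left (C K) (C K) i (next i)) (cycRel-next i)) ,
      φ ∘ (K ↑ʳ_) , cycle-of (C K ⊕ C K) φ (K ↑ʳ_) φ-inj (Finₚ.↑ʳ-injective K _ _) φ-adj (λ i → trans (⊕-right (C K) (C K) i (next i)) (cycRel-next i)) ,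
      λ i j p → ↑ˡ≢↑ʳ i j (φ-inj p)
      where
      K = suc (suc k)
      ↑ˡ≢↑ʳ : ∀ (i : Fin K) (j : Fin K) → i ↑ˡ K ≢ K ↑ʳ j
      ↑ˡ≢↑ʳ i j eq with trans (sym (splitAt-↑ˡ K i K)) (trans (cong (splitAt K) eq) (splitAt-↑ʳ K K j))
      ... | ()

    ⊆⁺⇒twoCycles : (C (suc (suc k)) ⊕ C⁺ (suc (suc k))) ⊆ A → TwoCycles (suc k) (Adj A)
    ⊆⁺⇒twoCycles (φ , φ-inj , φ-adj) =
      φ ∘ (_↑ˡ suc K) , cycle-of (C K ⊕ C⁺ K) φ (_↑ˡ suc K) φ-inj (Finₚ.↑ˡ-injective (suc K) _ _) φ-adj
        (λ i → trans (⊕-left (C K) (C⁺ K) i (next i)) (cycRel-next i)) ,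
      φ ∘ (K ↑ʳ_) ∘ inject₁ , cycle-of (C K ⊕ C⁺ K) φ ((K ↑ʳ_) ∘ inject₁) φ-inj (Finₚ.inject₁-injective ∘ Finₚ.↑ʳ-injective K _ _) φ-adj
        (λ i → trans (⊕-right (C K) (C⁺ K) (inject₁ i) (inject₁ (next i))) (C⁺-next i)) ,
      λ i j p → ↑ˡ≢↑ʳ i (inject₁ j) (φ-inj p)
      where
      K = suc (suc k)
      ↑ˡ≢↑ʳ : ∀ (i : Fin K) (j : Fin (suc K)) → i ↑ˡ suc K ≢ K ↑ʳ j
      ↑ˡ≢↑ʳ i j eq with trans (sym (splitAt-↑ˡ K i (suc K))) (trans (cong (splitAt K) eq) (splitAt-↑ʳ K (suc K) j))
      ... | ()
      <ᵇ-inject₁ : ∀ (i : Fin K) → (toℕ (inject₁ i) <ᵇ K) ≡ true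
      <ᵇ-inject₁ i = T⇒≡ (ℕₚ.<⇒<ᵇ (subst (_< K) (sym (toℕ-inject₁ i)) (toℕ<n i)))
      C⁺-next : ∀ i → rel (C⁺ K) (inject₁ i) (inject₁ (next i)) ≡ true
      C⁺-next i rewrite <ᵇ-inject₁ i | <ᵇ-inject₁ (next i) | toℕ-inject₁ i | toℕ-inject₁ (next i) | cycRel-next i = refl

-- Removal and replacement of the edges at a set of vertices.

module Surgery where

  open VanKampen using (Adj-sym; Adj-irrefl; drawing⇒flat)
  open Counting
  open Contractions using (false≢true; ¬true⇒false; ∧-true; ∨-true; Flat-pullback)
  open PlanarBound using (flat-size; ∷-injective)
  open Fans using (fan; fan-sym; fan-irrefl)
  open Gluings
  open CyclesInGraphs
  open import Data.Nat using (_+_; _*_; _≤_; z≤n; s≤s)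
  open import Data.Nat.Properties hiding (_≟_; suc-injective)
  open import Data.Nat.Tactic.RingSolver using (solve-∀)
  open import Data.Fin.Properties using (_≟_; any?; suc-injective; injective⇒≤)
  import Data.Bool.Properties as Bool
  open import Data.Vec.Functional using (_∷_; [])

  -- Twice 3(m + 3) - 6. The path is taken nonempty, since K₂ alone has one edge and would break the
  -- formula.
  size-fan : ∀ m → size (fan {suc m}) ≡ 6 * suc m
  size-fan m = begin
    size (fan {suc m})                          ≡⟨ size-remove (fan {suc m}) fan-sym fan-irrefl 0F ⟩
    size fan₁ + (degree (fan {suc m}) 0F + degree (fan {suc m}) 0F) ≡⟨ cong₂ (λ s d → s + (d + d))
      (size-remove fan₁ (λ i j → fan-sym (Fin.suc i) (Fin.suc j)) (λ i → fan-irrefl {suc m} (Fin.suc i)) 0F) (ones (2 + m)) ⟩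
    size (path {suc m}) + (degree fan₁ 0F + degree fan₁ 0F) + (2 + m + (2 + m)) ≡⟨ cong₂ (λ s d → s + (d + d) + (2 + m + (2 + m))) (size-path m) (ones (1 + m)) ⟩
    2 * m + (1 + m + (1 + m)) + (2 + m + (2 + m)) ≡⟨ arith m ⟩
    6 * suc m                                   ∎
    where
    open ≡-Reasoning
    arith : ∀ m → 2 * m + (1 + m + (1 + m)) + (2 + m + (2 + m)) ≡ 6 * suc m
    arith = solve-∀
    fan₁ : Fin (2 + m) → Fin (2 + m) → Bool
    fan₁ i j = fan {suc m} (Fin.suc i) (Fin.suc j)
    path : ∀ {m} → Fin m → Fin m → Bool
    path {m} i j = fan {m} (Fin.suc (Fin.suc i)) (Fin.suc (Fin.suc j))
    ones : ∀ m → sum {m} (λ _ → 1) ≡ m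
    ones m = trans (sum-const m 1) (*-identityʳ m)
    zeros : ∀ m → sum {m} (λ _ → 0) ≡ 0
    zeros m = trans (sum-const m 0) (*-zeroʳ m)
    size-path : ∀ m → size (path {suc m}) ≡ 2 * m
    size-path zero = refl
    size-path (suc m) = begin
      size (path {suc (suc m)}) ≡⟨ size-remove (path {suc (suc m)}) (λ i j → fan-sym (Fin.suc (Fin.suc i)) (Fin.suc (Fin.suc j)))
                                     (λ i → fan-irrefl {suc (suc m)} (Fin.suc (Fin.suc i))) 0F ⟩
      size (path {suc m}) + (degree (path {suc (suc m)}) 0F + degree (path {suc (suc m)}) 0F)
        ≡⟨ cong₂ (λ s d → s + (d + d)) (size-path m) (cong suc (zeros m)) ⟩
      2 * m + 2 ≡⟨ arith′ m ⟩
      2 * suc m ∎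
      where
      arith′ : ∀ m → 2 * m + 2 ≡ 2 * suc m
      arith′ = solve-∀

  size-fromAdj : ∀ {n} {a : Fin n → Fin n → Bool} → Symm a → Irrefl a → size (Adj (fromAdj a)) ≡ size a
  size-fromAdj a-sym a-irr = sum-cong (λ u → sum-cong (λ v → cong 𝟙 (Adj-fromAdj a-sym a-irr u v)))

  cycle-avoids-isolated : ∀ {n k} {a : Fin n → Fin n → Bool} {c : Fin (suc k) → Fin n} → IsCycle a c →
    ∀ {u} → (∀ w → a u w ≡ false) → ∀ i → u ≢ c i
  cycle-avoids-isolated cyc iso i refl with trans (sym (iso _)) (linked cyc i)
  ... | ()

  cycle-⊆ : ∀ {n k} {a b : Fin n → Fin n → Bool} {c : Fin (suc k) → Fin n} → IsCycle a c →
    (∀ i → a (c i) (c (next i)) ≡ true → b (c i) (c (next i)) ≡ true) → IsCycle b c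
  cycle-⊆ (isCycle d l) sub = isCycle d (λ i → sub i (l i))

  pigeonhole : ∀ {n k l} {f : Fin k → Fin n} {ν : Fin l → Fin n} → (∀ i j → f i ≡ f j → i ≡ j) →
    (∀ i → ∃ λ j → ν j ≡ f i) → k ≤ l
  pigeonhole {ν = ν} f-inj covered = injective⇒≤ {f = proj₁ ∘ covered} (λ {i} {j} eq →
    f-inj i j (trans (sym (proj₂ (covered i))) (trans (cong ν eq) (proj₂ (covered j)))))

  module Glued {n m} {G : Graph n} (D : Drawing G) (ν : Fin (2 + m) → Fin n) (ν-inj : Injective _≡_ _≡_ ν)
    (isolated : ∀ i w → Adj G (ν (Fin.suc i)) w ≡ false) where

    open Gluing D ν ν-inj isolated public

    glued : Graph n
    glued = fromAdj glue

    Adj-glued : ∀ u v → Adj glued u v ≡ glue u v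
    Adj-glued = Adj-fromAdj glue-sym glue-irr

    glued-⊆ : ∀ u v → (∀ i → ν i ≢ u) → Adj glued u v ≡ true → Adj G u v ≡ true
    glued-⊆ u v ∉ν uv with ∨-true {Adj G u v} (trans (sym (Adj-glued u v)) uv)
    ... | inj₁ p = p
    ... | inj₂ p = let i , _ , νi , _ = attached-inv u v p in ⊥-elim (∉ν i νi)

    size-glued : ∀ {m′} → m ≡ suc m′ → size (Adj G) + 6 * m ≤ size (Adj glued)
    size-glued refl = begin
      size (Adj G) + 6 * m              ≡⟨ cong (size (Adj G) +_) (size-fan _) ⟨
      size (Adj G) + size (fan {m})     ≡⟨ cong (size (Adj G) +_) (sum-cong (λ i → sum-cong (λ j → cong 𝟙 (attached-ν i j)))) ⟨
      size (Adj G) + sum (λ i → sum (λ j → 𝟙 (attached (ν i) (ν j))))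
        ≤⟨ +-monoʳ-≤ (size (Adj G)) (≤-trans (sum-mono (λ i → sum-pullback-≤ ν-inj (λ v → 𝟙 (attached (ν i) v))))
                                             (sum-pullback-≤ ν-inj (λ u → sum (λ v → 𝟙 (attached u v))))) ⟩
      size (Adj G) + size attached      ≡⟨ ∑-distrib-+ (λ u → sum (λ v → 𝟙 (Adj G u v))) (λ u → sum (λ v → 𝟙 (attached u v))) ⟨
      sum (λ u → sum (λ v → 𝟙 (Adj G u v)) + sum (λ v → 𝟙 (attached u v)))
        ≡⟨ sum-cong (λ u → ∑-distrib-+ (λ v → 𝟙 (Adj G u v)) (λ v → 𝟙 (attached u v))) ⟨
      sum (λ u → sum (λ v → 𝟙 (Adj G u v) + 𝟙 (attached u v))) ≤⟨ sum-mono (λ u → sum-mono (pointwise u)) ⟩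
      size glue                         ≡⟨ size-fromAdj glue-sym glue-irr ⟨
      size (Adj glued)                  ∎
      where
      open ≤-Reasoning
      -- An attached edge has an end other than the apex, and this end is isolated in G.
      exclusive : ∀ u v → Adj G u v ≡ true → attached u v ≡ true → ⊥
      exclusive u v uv p with attached-inv u v p
      ... | Fin.suc i , _ , refl , _ with trans (sym (isolated i v)) uv
      ...   | ()
      exclusive u v uv p | 0F , Fin.suc j , _ , refl , _ with trans (sym (isolated j u)) (trans (Adj-sym G v u) uv)
      ...   | ()
      exclusive u v uv p | 0F , 0F , _ , _ , ()
      pointwise : ∀ u v → 𝟙 (Adj G u v) + 𝟙 (attached u v) ≤ 𝟙 (glue u v)
      pointwise u v with Adj G u v in p | attached u v in q
      ... | true  | true  = ⊥-elim (exclusive u v p q)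
      ... | true  | false = ≤-refl
      ... | false | true  = ≤-refl
      ... | false | false = ≤-refl

    private
      New? : ∀ w → Dec (∃ λ i → ν (Fin.suc i) ≡ w)
      New? w = any? (λ i → ν (Fin.suc i) ≟ w)

      new-step : ∀ u v → u ≢ ν 0F → v ≢ ν 0F → Adj glued u v ≡ true →
        (∃ λ i → ν (Fin.suc i) ≡ u) → ∃ λ i → ν (Fin.suc i) ≡ v
      new-step u v u≢x v≢x uv (i , refl) with ∨-true {Adj G u v} (trans (sym (Adj-glued u v)) uv)
      ... | inj₁ p with trans (sym (isolated i v)) p
      ...   | ()
      new-step u v u≢x v≢x uv (i , refl) | inj₂ p with attached-inv u v p
      ... | _ , 0F , _ , refl , _ = ⊥-elim (v≢x refl)
      ... | _ , Fin.suc j , _ , refl , _ = j , refl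

      all-or-none : ∀ {l} (p : Fin (suc l) → Fin n) → (∀ i → p i ≢ ν 0F) → (∀ i → Adj glued (p (inject₁ i)) (p (Fin.suc i)) ≡ true) →
        (∀ i → ∃ λ j → ν (Fin.suc j) ≡ p i) ⊎ (∀ i j → ν (Fin.suc j) ≢ p i)
      all-or-none {zero} p ≢x adj with New? (p 0F)
      ... | yes q = inj₁ (λ { 0F → q })
      ... | no ¬q = inj₂ (λ { 0F j r → ¬q (j , r) })
      all-or-none {suc l} p ≢x adj with all-or-none (p ∘ Fin.suc) (≢x ∘ Fin.suc) (adj ∘ Fin.suc)
      ... | inj₁ all = inj₁ (λ { 0F → new-step (p 1F) (p 0F) (≢x 1F) (≢x 0F) (trans (Adj-sym glued (p 1F) (p 0F)) (adj 0F)) (all 0F)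
                               ; (Fin.suc i) → all i })
      ... | inj₂ none = inj₂ (λ { 0F j r → let j′ , r′ = new-step (p 0F) (p 1F) (≢x 0F) (≢x 1F) (adj 0F) (j , r) in none 0F j′ r′
                                ; (Fin.suc i) → none i })

      consecutive : ∀ {k} {c : Fin (suc k) → Fin n} → IsCycle (Adj glued) c → ∀ i → Adj glued (c (inject₁ i)) (c (Fin.suc i)) ≡ true
      consecutive {c = c} cyc i = subst (λ j → Adj glued (c (inject₁ i)) (c j) ≡ true) (next-inject₁ i) (linked cyc (inject₁ i))

      -- Away from the apex, new vertices are joined only to new ones. A cycle through the apex is
      -- rotated to start there; the rest is a walk that misses the apex and hence cannot change
      -- sides.
      split : ∀ {k} {c : Fin (suc (suc k)) → Fin n} → IsCycle (Adj glued) c →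
        (∀ i → ∃ λ j → ν j ≡ c i) ⊎ (∀ i j → ν (Fin.suc j) ≢ c i)
      split {c = c} cyc with any? (λ i → c i ≟ ν 0F)
      ... | no ∉ = Data.Sum.map₁ (λ all i → Fin.suc (proj₁ (all i)) , proj₂ (all i))
                     (all-or-none c (λ i r → ∉ (i , r)) (consecutive cyc))
      ... | yes (i₀ , r₀) with rotate cyc i₀
      ... | g , g-cyc , g₀ , c⊆g , _ with all-or-none (g ∘ Fin.suc) g≢x (consecutive g-cyc ∘ Fin.suc)
        where
        g≢x : ∀ i → g (Fin.suc i) ≢ ν 0F
        g≢x i r with distinct g-cyc (Fin.suc i) 0F (trans r (trans (sym r₀) (sym g₀)))
        ... | ()
      ... | inj₁ all = inj₁ λ i → helper i (c⊆g i)
        where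
        helper : ∀ i → (∃ λ j → c i ≡ g j) → ∃ λ j → ν j ≡ c i
        helper i (0F , r) = 0F , trans (sym r₀) (trans (sym g₀) (sym r))
        helper i (Fin.suc j , r) = let j′ , q = all j in Fin.suc j′ , trans q (sym r)
      ... | inj₂ none = inj₂ λ i → helper i (c⊆g i)
        where
        helper : ∀ i → (∃ λ j → c i ≡ g j) → ∀ j → ν (Fin.suc j) ≢ c i
        helper i (0F , r) j q with ν-inj (trans q (trans r (trans g₀ r₀)))
        ... | ()
        helper i (Fin.suc j′ , r) j q = none j′ j (trans q r)

    -- The apex is a cut vertex, so a cycle lies on one side.
    block : ∀ {k} {c : Fin (suc (suc k)) → Fin n} → IsCycle (Adj glued) c →
      (∀ i → ∃ λ j → ν j ≡ c i) ⊎ IsCycle (Adj G) c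
    block {c = c} cyc with split cyc
    ... | inj₁ all = inj₁ all
    ... | inj₂ none = inj₂ (cycle-⊆ cyc edge)
      where
      edge : ∀ i → Adj glued (c i) (c (next i)) ≡ true → Adj G (c i) (c (next i)) ≡ true
      edge i uv with ∨-true {Adj G (c i) (c (next i))} (trans (sym (Adj-glued (c i) (c (next i)))) uv)
      ... | inj₁ p = p
      ... | inj₂ p with attached-inv (c i) (c (next i)) p
      ...   | Fin.suc j , _ , r , _ = ⊥-elim (none i j r)
      ...   | 0F , Fin.suc j , _ , r , _ = ⊥-elim (none (next i) j r)
      ...   | 0F , 0F , _ , _ , ()

  Closed : ∀ {n s} → Graph n → (Fin s → Fin n) → Set
  Closed G φ = ∀ i w → (∀ j → φ j ≢ w) → Adj G (φ i) w ≡ false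

  module Removal {n s} {G : Graph n} (D : Drawing G) (φ : Fin s → Fin n) where

    inside? : ∀ u → Dec (∃ λ i → φ i ≡ u)
    inside? u = any? (λ i → φ i ≟ u)

    outside : Fin n → Bool
    outside u = not (does (inside? u))

    -- The vertices of φ are kept as isolated vertices: n does not change, and they are free to be
    -- glued in again.
    remaining : Fin n → Fin n → Bool
    remaining u v = Adj G u v ∧ (outside u ∧ outside v)

    remaining-sym : Symm remaining
    remaining-sym u v = cong₂ _∧_ (Adj-sym G u v) (Bool.∧-comm (outside u) (outside v))

    remaining-irr : Irrefl remaining
    remaining-irr u rewrite Adj-irrefl G u = refl

    removed : Graph n
    removed = fromAdj remaining

    Adj-removed : ∀ u v → Adj removed u v ≡ remaining u v
    Adj-removed = Adj-fromAdj remaining-sym remaining-irr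

    removed-⊆ : ∀ u v → Adj removed u v ≡ true → Adj G u v ≡ true
    removed-⊆ u v uv = proj₁ (∧-true (trans (sym (Adj-removed u v)) uv))

    removed-isolated : ∀ i w → Adj removed (φ i) w ≡ false
    removed-isolated i w = trans (Adj-removed (φ i) w) φi-gone
      where
      φi-gone : remaining (φ i) w ≡ false
      φi-gone with inside? (φ i)
      ... | yes _ = Bool.∧-zeroʳ (Adj G (φ i) w)
      ... | no ∉ = ⊥-elim (∉ (i , refl))

    removed-drawing : Drawing removed
    removed-drawing = subdrawing removed-⊆ D

    private
      inside : Fin n → ℕ
      inside u = 𝟙 (does (inside? u))

      cover : ∀ (F : Fin n → ℕ) → sum (λ u → inside u * F u) ≤ sum (F ∘ φ)
      cover F = begin
        sum (λ u → inside u * F u)                      ≤⟨ sum-mono pointwise ⟩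
        sum (λ u → sum (λ i → 𝟙 (u == φ i) * F u))      ≡⟨ ∑-comm (λ u i → 𝟙 (u == φ i) * F u) ⟩
        sum (λ i → sum (λ u → 𝟙 (u == φ i) * F u))      ≡⟨ sum-cong (λ i → sum-point (φ i) F) ⟩
        sum (F ∘ φ)                                     ∎
        where
        open ≤-Reasoning
        pointwise : ∀ u → inside u * F u ≤ sum (λ i → 𝟙 (u == φ i) * F u)
        pointwise u with inside? u
        ... | no _ = z≤n
        ... | yes (i , refl) = ≤-trans (≤-reflexive (cong (λ b → 𝟙 b * F u) (sym (==-refl u)))) (term≤sum (λ i → 𝟙 (u == φ i) * F u) i)

      split-edge : Closed G φ → ∀ u v → 𝟙 (Adj G u v) ≤ 𝟙 (remaining u v) + inside u * (inside v * 𝟙 (Adj G u v))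
      split-edge closed u v with Adj G u v in uv | inside? u | inside? v
      ... | false | _ | _ = z≤n
      ... | true | yes _ | yes _ = s≤s z≤n
      ... | true | no _ | no _ = s≤s z≤n
      ... | true | yes (i , refl) | no ∉ with trans (sym (closed i v (λ j r → ∉ (j , r)))) uv
      ...   | ()
      split-edge closed u v | true | no ∉ | yes (i , refl) with trans (sym (closed i u (λ j r → ∉ (j , r)))) (trans (Adj-sym G v u) uv)
      ...   | ()

    -- As no edge leaves φ, the lost edges are those of the graph induced on φ, at most 3s - 6 by
    -- the planar bound.
    size-removed : ∀ {s′} → s ≡ 3 + s′ → Injective _≡_ _≡_ φ → Closed G φ → size (Adj G) + 12 ≤ size (Adj removed) + 6 * s
    size-removed refl φ-inj closed = begin
      size (Adj G) + 12                                      ≤⟨ +-monoˡ-≤ 12 (sum-mono (λ u → sum-mono (split-edge closed u))) ⟩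
      sum (λ u → sum (λ v → 𝟙 (remaining u v) + inside u * (inside v * 𝟙 (Adj G u v)))) + 12
        ≡⟨ cong (_+ 12) (sum-cong (λ u → ∑-distrib-+ (λ v → 𝟙 (remaining u v)) _)) ⟩
      sum (λ u → sum (λ v → 𝟙 (remaining u v)) + sum (λ v → inside u * (inside v * 𝟙 (Adj G u v)))) + 12
        ≡⟨ cong (_+ 12) (∑-distrib-+ (λ u → sum (λ v → 𝟙 (remaining u v))) _) ⟩
      size remaining + sum (λ u → sum (λ v → inside u * (inside v * 𝟙 (Adj G u v)))) + 12
        ≡⟨ cong (λ z → size remaining + z + 12) (∑-comm (λ u v → inside u * (inside v * 𝟙 (Adj G u v)))) ⟩
      size remaining + sum (λ v → sum (λ u → inside u * (inside v * 𝟙 (Adj G u v)))) + 12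
        ≤⟨ +-monoˡ-≤ 12 (+-monoʳ-≤ (size remaining) (sum-mono (λ v → cover (λ u → inside v * 𝟙 (Adj G u v))))) ⟩
      size remaining + sum (λ v → sum (λ i → inside v * 𝟙 (Adj G (φ i) v))) + 12
        ≡⟨ cong (λ z → size remaining + z + 12) (∑-comm (λ v i → inside v * 𝟙 (Adj G (φ i) v))) ⟩
      size remaining + sum (λ i → sum (λ v → inside v * 𝟙 (Adj G (φ i) v))) + 12
        ≤⟨ +-monoˡ-≤ 12 (+-monoʳ-≤ (size remaining) (sum-mono (λ i → cover (λ v → 𝟙 (Adj G (φ i) v))))) ⟩
      size remaining + size (λ i j → Adj G (φ i) (φ j)) + 12 ≡⟨ +-assoc (size remaining) _ 12 ⟩
      size remaining + (size (λ i j → Adj G (φ i) (φ j)) + 12)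
        ≤⟨ +-monoʳ-≤ (size remaining) (flat-size _ (λ i j → Adj G (φ i) (φ j)) (λ i j → Adj-sym G (φ i) (φ j)) (λ i → Adj-irrefl G (φ i))
             (Flat-pullback φ-inj (λ i j p → p) (drawing⇒flat D))) ⟩
      size remaining + 6 * s                                 ≡⟨ cong (_+ 6 * s) (size-fromAdj remaining-sym remaining-irr) ⟨
      size (Adj removed) + 6 * s                             ∎
      where
      open ≤-Reasoning

  -- The edges at the vertices φ are replaced by a copy of K₂ + P_m on x and all but two of these
  -- vertices and a triangle on x and the remaining two; by the planar bound no edge is lost.
  module Replacement {n m} {G : Graph n} (D : Drawing G) (φ : Fin (3 + m) → Fin n) (φ-inj : Injective _≡_ _≡_ φ)
    (closed : Closed G φ) (x : Fin n) (x∉φ : ∀ i → φ i ≢ x) where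

    private
      module R = Removal D φ

    ν₁ : Fin (2 + m) → Fin n
    ν₁ = x ∷ (φ ∘ Fin.suc ∘ Fin.suc)

    -- The triangle is the fan with one path vertex, so both pieces come from the same construction.
    ν₂ : Fin 3 → Fin n
    ν₂ = x ∷ φ 0F ∷ φ 1F ∷ []

    private
      ν₁-inj : Injective _≡_ _≡_ ν₁
      ν₁-inj = ∷-injective (λ i → x∉φ _) (suc-injective ∘ suc-injective ∘ φ-inj)

      ν₂-inj : Injective _≡_ _≡_ ν₂
      ν₂-inj = ∷-injective ≢x (∷-injective ≢φ₀ (∷-injective (λ ()) (λ { {()} })))
        where
        ≢x : ∀ i → (φ 0F ∷ φ 1F ∷ []) i ≢ x
        ≢x 0F = x∉φ 0F
        ≢x 1F = x∉φ 1F
        ≢φ₀ : ∀ i → (φ 1F ∷ []) i ≢ φ 0F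
        ≢φ₀ 0F p with φ-inj p
        ... | ()

      module G₁ = Glued R.removed-drawing ν₁ ν₁-inj (λ i w → R.removed-isolated (Fin.suc (Fin.suc i)) w)

      isolated₁ : ∀ i w → (∀ j → ν₁ j ≢ φ i) → Adj G₁.glued (φ i) w ≡ false
      isolated₁ i w ∉ν₁ = ¬true⇒false λ h → false≢true (trans (sym (R.removed-isolated i w)) (G₁.glued-⊆ (φ i) w ∉ν₁ h))

      ∉ν₁ : ∀ (i : Fin 2) j → ν₁ j ≢ φ (i Fin.↑ˡ (suc m))
      ∉ν₁ i 0F p = x∉φ _ (sym p)
      ∉ν₁ 0F (Fin.suc j) p with φ-inj p
      ... | ()
      ∉ν₁ 1F (Fin.suc j) p with φ-inj p
      ... | ()

      isolated₂ : ∀ (i : Fin 2) w → Adj G₁.glued (ν₂ (Fin.suc i)) w ≡ false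
      isolated₂ 0F w = isolated₁ 0F w (∉ν₁ 0F)
      isolated₂ 1F w = isolated₁ 1F w (∉ν₁ 1F)

      module G₂ = Glued G₁.glue-drawing ν₂ ν₂-inj isolated₂

    replaced : Graph n
    replaced = G₂.glued

    replaced-drawing : Drawing replaced
    replaced-drawing = G₂.glue-drawing

    replaced-⊆ : ∀ u v → u ≢ x → (∀ i → φ i ≢ u) → Adj replaced u v ≡ true → Adj G u v ≡ true
    replaced-⊆ u v u≢x u∉φ uv = R.removed-⊆ u v (G₁.glued-⊆ u v u∉ν₁ (G₂.glued-⊆ u v u∉ν₂ uv))
      where
      u∉ν₁ : ∀ i → ν₁ i ≢ u
      u∉ν₁ 0F p = u≢x (sym p)
      u∉ν₁ (Fin.suc i) = u∉φ _
      u∉ν₂ : ∀ i → ν₂ i ≢ u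
      u∉ν₂ 0F p = u≢x (sym p)
      u∉ν₂ 1F = u∉φ _
      u∉ν₂ 2F = u∉φ _

    -- At most 3(3 + m) - 6 = 3m + 3 edges are lost; the fan returns 3m and the triangle 3.
    size-replaced : ∀ {m′} → m ≡ suc m′ → size (Adj G) ≤ size (Adj replaced)
    size-replaced m≡ = +-cancelʳ-≤ (12 + 6 * (1 + m)) _ _ (begin
      size (Adj G) + (12 + 6 * (1 + m))            ≡⟨ +-assoc (size (Adj G)) 12 _ ⟨
      size (Adj G) + 12 + 6 * (1 + m)              ≤⟨ +-monoˡ-≤ (6 * (1 + m)) (R.size-removed refl φ-inj closed) ⟩
      size (Adj R.removed) + 6 * (3 + m) + 6 * (1 + m) ≡⟨ arith (size (Adj R.removed)) m ⟩
      size (Adj R.removed) + 6 * m + 6 * 1 + (12 + 6 * (1 + m)) ≤⟨ +-monoˡ-≤ (12 + 6 * (1 + m)) (+-monoˡ-≤ 6 (G₁.size-glued m≡)) ⟩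
      size (Adj G₁.glued) + 6 * 1 + (12 + 6 * (1 + m)) ≤⟨ +-monoˡ-≤ (12 + 6 * (1 + m)) (G₂.size-glued refl) ⟩
      size (Adj replaced) + (12 + 6 * (1 + m))     ∎)
      where
      open ≤-Reasoning
      arith : ∀ r m → r + 6 * (3 + m) + 6 * (1 + m) ≡ r + 6 * m + 6 * 1 + (12 + 6 * (1 + m))
      arith = solve-∀

    replaced-cycle : ∀ {k} {c : Fin (4 + k) → Fin n} → IsCycle (Adj replaced) c →
      (∀ i → ∃ λ j → ν₁ j ≡ c i) ⊎ (IsCycle (Adj G) c × (∀ i j → φ j ≢ c i))
    replaced-cycle {k} {c} cyc with G₂.block cyc
    -- A cycle of length at least four does not fit into the triangle.
    ... | inj₁ all = ⊥-elim (<-irrefl refl (≤-trans (s≤s (s≤s (s≤s (s≤s z≤n)))) (pigeonhole {f = c} {ν₂} (distinct cyc) all)))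
    ... | inj₂ cyc₁ with G₁.block cyc₁
    ... | inj₁ all = inj₁ all
    ... | inj₂ cyc₀ = inj₂ (cycle-⊆ cyc₀ (λ i → R.removed-⊆ _ _) , λ i j → cycle-avoids-isolated cyc₀ (R.removed-isolated j) i)

-- The exchange of disjoint k-cycles.

module Exchange where

  open VanKampen using (Adj-sym; Adj-irrefl)
  open Counting renaming (sum to ∑)
  open Contractions using (false≢true; ¬true⇒false)
  open CyclesInGraphs
  open Surgery
  open import Data.Nat using (_+_; _*_; _≤_; _<_; z≤n; _<ᵇ_)
  open import Data.Nat.Properties hiding (_≟_; suc-injective)
  open import Data.Nat.ListAction using (sum)
  open import Data.Nat.Tactic.RingSolver using (solve-∀)
  open import Data.Fin.Properties using (_≟_; any?; all?; suc-injective; toℕ-injective; splitAt-↑ˡ; splitAt-↑ʳ; splitAt⁻¹-↑ˡ; splitAt⁻¹-↑ʳ)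
  import Data.Bool.Properties as Bool
  open import Data.List using (map; allFin; tabulate)
  open import Data.List.Properties using (map-tabulate)
  open import Relation.Nullary.Decidable using (¬?; dec-true; dec-false)

  sum-allFin : ∀ n (f : Fin n → ℕ) → sum (map f (allFin n)) ≡ ∑ f
  sum-allFin n f = trans (cong sum (map-tabulate id f)) (helper n f)
    where
    helper : ∀ n (f : Fin n → ℕ) → sum (tabulate f) ≡ ∑ f
    helper zero    f = refl
    helper (suc n) f = cong (f Fin.zero +_) (helper n (f ∘ Fin.suc))

  size≡2*edges : ∀ {n} (G : Graph n) → size (Adj G) ≡ 2 * edges G
  size≡2*edges {n} G = begin
    size (Adj G)                                    ≡⟨ sum-cong (λ i → sum-cong (pointwise i)) ⟩
    ∑ (λ i → ∑ (λ j → up i j + up j i))             ≡⟨ sum-cong (λ i → ∑-distrib-+ (up i) (λ j → up j i)) ⟩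
    ∑ (λ i → ∑ (up i) + ∑ (λ j → up j i))           ≡⟨ ∑-distrib-+ (λ i → ∑ (up i)) _ ⟩
    e + ∑ (λ i → ∑ (λ j → up j i))                  ≡⟨ cong (e +_) (∑-comm (λ i j → up j i)) ⟩
    e + e                                           ≡⟨ cong (e +_) (+-identityʳ e) ⟨
    2 * e                                           ≡⟨ cong (2 *_) (trans (sum-allFin n (λ i → sum (map (up i) (allFin n)))) (sum-cong (λ i → sum-allFin n (up i)))) ⟨
    2 * edges G                                     ∎
    where
    open ≡-Reasoning
    up : Fin n → Fin n → ℕ
    up i j = if Adj G i j ∧ (toℕ i <ᵇ toℕ j) then 1 else 0
    e = ∑ (λ i → ∑ (up i))
    <ᵇ-true : ∀ {m n} → m < n → (m <ᵇ n) ≡ true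
    <ᵇ-true p = T⇒≡ (<⇒<ᵇ p)
    <ᵇ-false : ∀ {m n} → ¬ m < n → (m <ᵇ n) ≡ false
    <ᵇ-false {m} {n} ¬p = ¬true⇒false (λ h → ¬p (<ᵇ⇒< m n (≡⇒T h)))
    pointwise : ∀ i j → 𝟙 (Adj G i j) ≡ up i j + up j i
    pointwise i j with <-cmp (toℕ i) (toℕ j)
    ... | tri< i<j _ j≮i rewrite Adj-sym G j i | <ᵇ-true i<j | <ᵇ-false j≮i with Adj G i j
    ...   | true  = refl
    ...   | false = refl
    pointwise i j | tri> i≮j _ j<i rewrite Adj-sym G j i | <ᵇ-true j<i | <ᵇ-false i≮j with Adj G i j
    ...   | true  = refl
    ...   | false = refl
    pointwise i j | tri≈ _ i≡j _ with toℕ-injective i≡j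
    ...   | refl rewrite Adj-irrefl G i = refl

  edges-mono : ∀ {n} (G H : Graph n) → size (Adj G) ≤ size (Adj H) → edges G ≤ edges H
  edges-mono G H le = *-cancelˡ-≤ 2 (subst₂ _≤_ (size≡2*edges G) (size≡2*edges H) le)

  member : ∀ {n s} → (Fin s → Fin n) → Fin n → Bool
  member φ u = does (any? (λ i → φ i ≟ u))

  member-true : ∀ {n s} (φ : Fin s → Fin n) i → member φ (φ i) ≡ true
  member-true φ i = dec-true (any? (λ j → φ j ≟ φ i)) (i , refl)

  member-false : ∀ {n s} (φ : Fin s → Fin n) {u} → (∀ i → φ i ≢ u) → member φ u ≡ false
  member-false φ {u} ∉ = dec-false (any? (λ i → φ i ≟ u)) (λ (i , p) → ∉ i p)

  module _ {n κ : ℕ} where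

    private
      k = 4 + κ

    Cyc : Graph n → (Fin k → Fin n) → Set
    Cyc G f = IsCycle (Adj G) f

    module PendantFree (G : Graph n) (free : ¬ ((C k ⊕ C⁺ k) ⊆ G)) where

      pair-closed : ∀ {f g} → Cyc G f → Cyc G g → (∀ i j → f i ≢ g j) →
        ∀ i w → (∀ j → f j ≢ w) → (∀ j → g j ≢ w) → Adj G (g i) w ≡ false
      pair-closed {f} {g} f-cyc g-cyc disj i w f≢w g≢w = ¬true⇒false λ adj →
        -- Rotated so that the offending vertex `g i` becomes vertex zero, where `C⁺` carries its
        -- pendant edge.
        let g′ , g′-cyc , g′₀ , _ , g′⊆g = rotate g-cyc i in
        free (pendant⇒⊆ G {g = g′} f-cyc g′-cyc
          (λ i j p → let j′ , q = g′⊆g j in disj i j′ (trans p q))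
          f≢w (λ j p → let j′ , q = g′⊆g j in g≢w j′ (trans (sym q) p))
          (trans (Adj-sym G w (g′ 0F)) (trans (cong (λ u → Adj G u w) g′₀) adj)))

      pair-closed₂ : ∀ {f g} → Cyc G f → Cyc G g → (∀ i j → f i ≢ g j) → Closed G (append f g)
      pair-closed₂ {f} {g} f-cyc g-cyc disj i w ∉ = append-all {f = f} {g} {P = λ u → Adj G u w ≡ false}
        (λ i → pair-closed g-cyc f-cyc (λ i j p → disj j i (sym p)) i w g≢w f≢w)
        (λ i → pair-closed f-cyc g-cyc disj i w f≢w g≢w) i
        where
        f≢w : ∀ j → f j ≢ w
        f≢w j p = ∉ (j ↑ˡ k) (trans (append-left f g j) p)
        g≢w : ∀ j → g j ≢ w
        g≢w j p = ∉ (k ↑ʳ j) (trans (append-right f g j) p)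

      -- Pairing f with g and with h shows that no edge leaves f.
      triple-closed : ∀ {f g h} → Cyc G f → Cyc G g → Cyc G h → (∀ i j → f i ≢ g j) → (∀ i j → f i ≢ h j) →
        (∀ i j → g i ≢ h j) → Closed G f
      triple-closed {f} {g} {h} f-cyc g-cyc h-cyc fg fh gh i w f≢w with any? (λ j → g j ≟ w)
      ... | no ∉g = pair-closed g-cyc f-cyc (λ i j p → fg j i (sym p)) i w (λ j p → ∉g (j , p)) f≢w
      ... | yes (j , refl) = pair-closed h-cyc f-cyc (λ i j p → fh j i (sym p)) i w (λ l p → gh j l (sym p)) f≢w

    Inside : ∀ {l} → (Fin l → Fin n) → (Fin k → Fin n) → Set
    Inside ν c = ∀ i → ∃ λ j → ν j ≡ c i

    -- For l < 2k, confinement of all k-cycles to l vertices excludes two disjoint ones, and unlike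
    -- that exclusion it can be tracked through successive replacements.
    Target : ℕ → Graph n → Set
    Target l G = Σ (Graph n) λ H → Drawing H × size (Adj G) ≤ size (Adj H) ×
      ∃ λ (ν : Fin l → Fin n) → ∀ {c} → Cyc H c → Inside ν c

    target⇒no-twoCycles : ∀ {l} {G H : Graph n} → l < k + k → {ν : Fin l → Fin n} →
      (∀ {c} → Cyc H c → Inside ν c) → ¬ TwoCycles (3 + κ) (Adj H)
    target⇒no-twoCycles l<2k {ν} inside (f , f-cyc , g , g-cyc , disj) = <-irrefl refl (≤-trans l<2k
      (pigeonhole {f = append f g} {ν} (λ i j → append-injective (distinct f-cyc) (distinct g-cyc) disj)
        (append-all {f = f} {g} {P = λ u → ∃ λ j → ν j ≡ u} (inside f-cyc) (inside g-cyc))))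

    -- Repeatedly replace the cycles that avoid the processed vertices; each of them is a component.
    module Loop {l} (ν : Fin (suc l) → Fin n) where

      -- `done` marks ν and the vertices already processed. A cycle not confined to ν lies among
      -- untouched vertices and no edge leaves it, so it can be replaced by itself.
      Invariant : Graph n → (Fin n → Bool) → Set
      Invariant G done = (∀ i → done (ν i) ≡ true) ×
        (∀ {c} → Cyc G c → Inside ν c ⊎ (Closed G c × (∀ i → done (c i) ≡ false)))

      loop : ∀ t (G : Graph n) → Drawing G → ∀ done → Invariant G done → ∑ (λ w → 𝟙 (not (done w))) ≤ t →
        Σ (Graph n) λ H → Drawing H × size (Adj G) ≤ size (Adj H) × (∀ {c} → Cyc H c → Inside ν c)
      loop t G D done (ν-done , cycles) todo≤t
        -- By the invariant a cycle with one fresh vertex is entirely fresh, so vertex zero is a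
        -- sufficient test.
        with cycle? (Adj G) {Q = λ c → done (c 0F) ≡ false} (λ f≗g p → trans (cong done (sym (f≗g 0F))) p) (λ c → done (c 0F) Bool.≟ false)
      ... | no none = G , D , ≤-refl , λ {c} cyc → helper cyc (cycles cyc)
        where
        helper : ∀ {c} → Cyc G c → Inside ν c ⊎ (Closed G c × (∀ i → done (c i) ≡ false)) → Inside ν c
        helper cyc (inj₁ inside) = inside
        helper {c} cyc (inj₂ (_ , outside)) = ⊥-elim (none (c , cyc , outside 0F))
      ... | yes (c , c-cyc , c₀) with cycles c-cyc
      ... | inj₁ inside = ⊥-elim (false≢true (trans (sym c₀) (trans (cong done (sym (proj₂ (inside 0F)))) (ν-done (proj₁ (inside 0F))))))
      ... | inj₂ (closed , fresh) = continue t todo≤t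
        where
        x = ν 0F
        x∉c : ∀ i → c i ≢ x
        x∉c i p with trans (sym (ν-done 0F)) (trans (cong done (sym p)) (fresh i))
        ... | ()
        open Replacement {m = 1 + κ} D c (λ {i} {j} → distinct c-cyc i j) closed x x∉c
        done′ : Fin n → Bool
        done′ u = done u ∨ member c u
        invariant : Invariant replaced done′
        invariant = (λ i → cong (_∨ _) (ν-done i)) , λ {c′} cyc → helper {c′} (replaced-cycle cyc) cyc
          where
          helper : ∀ {c′} → (∀ i → ∃ λ j → ν₁ j ≡ c′ i) ⊎ (Cyc G c′ × (∀ i j → c j ≢ c′ i)) → Cyc replaced c′ →
            Inside ν c′ ⊎ (Closed replaced c′ × (∀ i → done′ (c′ i) ≡ false))
          -- `ν₁` has only k - 1 entries: x and k - 2 vertices of c.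
          helper {c′} (inj₁ all) cyc = ⊥-elim (<-irrefl refl (pigeonhole {f = c′} {ν₁} (distinct cyc) all))
          helper {c′} (inj₂ (cyc-G , c≢c′)) _ with cycles cyc-G
          ... | inj₁ inside = inj₁ inside
          -- The replacement adds edges only between x and vertices of c or among the latter; c′
          -- avoids x and c, hence gains no edge.
          ... | inj₂ (closed′ , fresh′) = inj₂
            ( (λ i w ∉ → ¬true⇒false λ adj → false≢true (trans (sym (closed′ i w ∉)) (replaced-⊆ (c′ i) w (c′≢x i) (c≢c′ i) adj)))
            , λ i → trans (cong (_∨ member c (c′ i)) (fresh′ i)) (member-false c (c≢c′ i)))
            where
            c′≢x : ∀ i → c′ i ≢ x
            c′≢x i p with trans (sym (ν-done 0F)) (trans (cong done (sym p)) (fresh′ i))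
            ... | ()
        -- The measure of termination is the number of unmarked vertices, and `c 0F` at least is
        -- newly marked.
        progress : ∑ (λ w → 𝟙 (not (done′ w))) + 1 ≤ ∑ (λ w → 𝟙 (not (done w)))
        progress = begin
          ∑ (λ w → 𝟙 (not (done′ w))) + 1                        ≡⟨ cong (∑ (λ w → 𝟙 (not (done′ w))) +_) (sum-indicator (c 0F)) ⟨
          ∑ (λ w → 𝟙 (not (done′ w))) + ∑ (λ w → 𝟙 (w == c 0F)) ≡⟨ ∑-distrib-+ (λ w → 𝟙 (not (done′ w))) _ ⟨
          ∑ (λ w → 𝟙 (not (done′ w)) + 𝟙 (w == c 0F))           ≤⟨ sum-mono pointwise ⟩
          ∑ (λ w → 𝟙 (not (done w)))                             ∎
          where
          open ≤-Reasoning
          pointwise : ∀ w → 𝟙 (not (done′ w)) + 𝟙 (w == c 0F) ≤ 𝟙 (not (done w))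
          pointwise w with w ≟ c 0F
          ... | no _ = ≤-trans (≤-reflexive (+-identityʳ _)) (shrink (done w) (member c w))
            where
            shrink : ∀ x y → 𝟙 (not (x ∨ y)) ≤ 𝟙 (not x)
            shrink true  _     = z≤n
            shrink false true  = z≤n
            shrink false false = ≤-refl
          ... | yes refl rewrite c₀ | member-true c 0F = ≤-refl
        continue : ∀ t → ∑ (λ w → 𝟙 (not (done w))) ≤ t →
          Σ (Graph n) λ H → Drawing H × size (Adj G) ≤ size (Adj H) × (∀ {c} → Cyc H c → Inside ν c)
        continue zero todo≤0 = ⊥-elim (<-irrefl refl (≤-trans (m≤n+m 1 _) (≤-trans progress todo≤0)))
        continue (suc t) todo≤ with loop t replaced replaced-drawing done′ invariant
          (+-cancelʳ-≤ 1 _ _ (≤-trans progress (≤-trans todo≤ (≤-reflexive (+-comm 1 t)))))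
        ... | H , D′ , size≤ , inside = H , D′ , ≤-trans (size-replaced refl) size≤ , inside

    some-outside : ∀ {l} (φ : Fin l → Fin n) → l < n → ∃ λ x → ∀ i → φ i ≢ x
    some-outside {l} φ l<n with any? (λ x → all? (λ i → ¬? (φ i ≟ x)))
    ... | yes found = found
    ... | no none = ⊥-elim (<-irrefl refl (≤-trans l<n (pigeonhole {f = id} {φ} (λ i j p → p) covered)))
      where
      covered : ∀ x → ∃ λ i → φ i ≡ x
      covered x with any? (λ i → φ i ≟ x)
      ... | yes p = p
      ... | no ∉ = ⊥-elim (none (x , λ i p → ∉ (i , p)))

    module TwoDisjoint (G : Graph n) (D : Drawing G) (free : ¬ ((C k ⊕ C⁺ k) ⊆ G)) {f g : Fin k → Fin n}
      (f-cyc : Cyc G f) (g-cyc : Cyc G g) (disj : ∀ i j → f i ≢ g j) where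

      open PendantFree G free

      φ : Fin (k + k) → Fin n
      φ = append f g

      φ-inj : Injective _≡_ _≡_ φ
      φ-inj = append-injective (distinct f-cyc) (distinct g-cyc) disj

      φ-disj : ∀ {h : Fin k → Fin n} → (∀ i j → φ j ≢ h i) → (∀ i j → f i ≢ h j) × (∀ i j → g i ≢ h j)
      φ-disj φ≢h = (λ i j p → φ≢h j (i ↑ˡ k) (trans (append-left f g i) p)) ,
                   (λ i j p → φ≢h j (k ↑ʳ i) (trans (append-right f g i) p))

      -- `2 + (1 + κ + k)` is 2k - 1. Edges may run between f and g, so only their union is closed
      -- and the planar bound is applied to all 2k vertices together.
      no-third-cycle : (∀ {h} → Cyc G h → ¬ (∀ i j → φ j ≢ h i)) → k + k < n → Target (2 + (1 + κ + k)) G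
      no-third-cycle no-third 2k<n = helper (some-outside φ 2k<n)
        where
        helper : (∃ λ x → ∀ i → φ i ≢ x) → Target (2 + (1 + κ + k)) G
        helper (x , x∉φ) = replaced , replaced-drawing , size-replaced refl , ν₁ ,
          λ cyc → [ id , (λ (cyc-G , φ≢c) → ⊥-elim (no-third cyc-G φ≢c)) ] (replaced-cycle cyc)
          where
          open Replacement {m = 1 + κ + k} D φ φ-inj (pair-closed₂ f-cyc g-cyc disj) x x∉φ

      -- The cycle h makes f and g closed separately, so they are removed one after the other and
      -- the planar bound applies to each.
      third-cycle : ∀ {h} → Cyc G h → (∀ i j → φ j ≢ h i) → Target (2 + (1 + κ + k)) G
      third-cycle {h} h-cyc φ≢h = finish (loop _ G₁.glued G₁.glue-drawing done invariant ≤-refl)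
        where
        fh = proj₁ (φ-disj φ≢h)
        gh = proj₂ (φ-disj φ≢h)
        module F = Removal D f
        module FG = Removal F.removed-drawing g
        ν : Fin (2 + (1 + κ + k)) → Fin n
        -- All vertices of f and g but one. `φ 1F` becomes the apex, and it is also the vertex x at
        -- which `Loop` glues all later pieces.
        ν = φ ∘ Fin.suc
        isolated-φ : ∀ i w → Adj FG.removed (φ i) w ≡ false
        isolated-φ = append-all {f = f} {g} {P = λ u → ∀ w → Adj FG.removed u w ≡ false}
          (λ i w → ¬true⇒false λ adj → false≢true (trans (sym (F.removed-isolated i w)) (FG.removed-⊆ (f i) w adj)))
          (λ i w → FG.removed-isolated i w)
        module G₁ = Glued FG.removed-drawing ν (suc-injective ∘ φ-inj) (λ i → isolated-φ (Fin.suc (Fin.suc i)))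
        open Loop ν
        done : Fin n → Bool
        done = member φ
        invariant : Invariant G₁.glued done
        invariant = ν-done , λ {c} cyc → helper {c} (G₁.block cyc)
          where
          ν-done : ∀ i → done (ν i) ≡ true
          ν-done i = member-true φ (Fin.suc i)
          helper : ∀ {c} → (∀ i → ∃ λ j → ν j ≡ c i) ⊎ Cyc FG.removed c → Inside ν c ⊎ (Closed G₁.glued c × (∀ i → done (c i) ≡ false))
          helper (inj₁ all) = inj₁ all
          helper {c} (inj₂ cyc) = inj₂ ((λ i w ∉ → ¬true⇒false λ adj → false≢true (trans (sym (closed-G i w ∉))
              (F.removed-⊆ (c i) w (FG.removed-⊆ (c i) w (G₁.glued-⊆ (c i) w (λ j → φ≢c i (Fin.suc j)) adj))))) , fresh)
            where
            φ≢c : ∀ i j → φ j ≢ c i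
            φ≢c i j = cycle-avoids-isolated cyc (isolated-φ j) i
            cyc-G : Cyc G c
            cyc-G = cycle-⊆ cyc (λ i adj → F.removed-⊆ (c i) (c (next i)) (FG.removed-⊆ (c i) (c (next i)) adj))
            fc = proj₁ (φ-disj φ≢c)
            gc = proj₂ (φ-disj φ≢c)
            closed-G : Closed G c
            closed-G = triple-closed cyc-G f-cyc g-cyc (λ i j p → fc j i (sym p)) (λ i j p → gc j i (sym p)) disj
            fresh : ∀ i → done (c i) ≡ false
            fresh i = member-false φ (φ≢c i)
        size-G₁ : size (Adj G) ≤ size (Adj G₁.glued)
        size-G₁ = +-cancelʳ-≤ 24 _ _ (begin
          size (Adj G) + 24                          ≡⟨ +-assoc (size (Adj G)) 12 12 ⟨
          size (Adj G) + 12 + 12                     ≤⟨ +-monoˡ-≤ 12 (F.size-removed refl (λ {i} {j} → distinct f-cyc i j) f-closed) ⟩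
          size (Adj F.removed) + 6 * k + 12          ≡⟨ swap-last (size (Adj F.removed)) (6 * k) ⟩
          size (Adj F.removed) + 12 + 6 * k          ≤⟨ +-monoˡ-≤ (6 * k) (FG.size-removed refl (λ {i} {j} → distinct g-cyc i j) g-closed) ⟩
          -- The slack: at most 2(3k - 6) = 6k - 12 edges are lost and the fan on 2k - 1 vertices
          -- has 6k - 9, a surplus of three edges, or six in `size`.
          size (Adj FG.removed) + 6 * k + 6 * k      ≤⟨ m≤m+n _ 6 ⟩
          size (Adj FG.removed) + 6 * k + 6 * k + 6  ≡⟨ arith (size (Adj FG.removed)) κ ⟩
          size (Adj FG.removed) + 6 * (1 + κ + k) + 24 ≤⟨ +-monoˡ-≤ 24 (G₁.size-glued refl) ⟩
          size (Adj G₁.glued) + 24                   ∎)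
          where
          open ≤-Reasoning
          swap-last : ∀ a b → a + b + 12 ≡ a + 12 + b
          swap-last = solve-∀
          arith : ∀ r κ → r + 6 * (4 + κ) + 6 * (4 + κ) + 6 ≡ r + 6 * (1 + κ + (4 + κ)) + 24
          arith = solve-∀
          f-closed : Closed G f
          f-closed = triple-closed f-cyc g-cyc h-cyc disj fh gh
          g-closed : Closed F.removed g
          g-closed i w ∉ = ¬true⇒false λ adj → false≢true (trans
            (sym (triple-closed g-cyc f-cyc h-cyc (λ i j p → disj j i (sym p)) gh fh i w ∉)) (F.removed-⊆ (g i) w adj))
        finish : (Σ (Graph n) λ H → Drawing H × size (Adj G₁.glued) ≤ size (Adj H) × (∀ {c} → Cyc H c → Inside ν c)) →
          Target (2 + (1 + κ + k)) G
        finish (H , D′ , size≤ , inside) = H , D′ , ≤-trans size-G₁ size≤ , ν , inside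

    TwoCycleFree≥ : Graph n → Set
    TwoCycleFree≥ G = Σ (Graph n) λ H → Drawing H × ¬ ((C k ⊕ C k) ⊆ H) × edges G ≤ edges H

    target⇒twoCycleFree≥ : ∀ {l} (G : Graph n) → l < k + k → Target l G → TwoCycleFree≥ G
    target⇒twoCycleFree≥ G l<2k (H , D , size≤ , ν , inside) =
      H , D , (λ sub → target⇒no-twoCycles {G = G} {H} l<2k {ν} inside (⊆⇒twoCycles H sub)) , edges-mono G H size≤

    disjoint-cycles-replaceable : ∀ (G : Graph n) → Drawing G → ¬ ((C k ⊕ C⁺ k) ⊆ G) → k + k < n →
      TwoCycles (3 + κ) (Adj G) → Target (2 + (1 + κ + k)) G
    disjoint-cycles-replaceable G D free 2k<n (f , f-cyc , g , g-cyc , disj) = conclude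
      (cycle? (Adj G) (λ h≗h′ φ≢h i j p → φ≢h i j (trans p (sym (h≗h′ i))))
        (λ h → all? (λ i → all? (λ j → ¬? (φ j ≟ h i)))))
      where
      open TwoDisjoint G D free f-cyc g-cyc disj
      conclude : Dec (∃ λ h → Cyc G h × (∀ i j → φ j ≢ h i)) → Target (2 + (1 + κ + k)) G
      conclude (no none) = no-third-cycle (λ {h} h-cyc φ≢h → none (h , h-cyc , φ≢h)) 2k<n
      conclude (yes (h , h-cyc , φ≢h)) = third-cycle h-cyc φ≢h

    twoCycleFree≥ : ∀ (G : Graph n) → Drawing G → ¬ ((C k ⊕ C⁺ k) ⊆ G) → k + k < n → TwoCycleFree≥ G
    twoCycleFree≥ G D free 2k<n = conclude (twoCycles? (3 + κ) (Adj G))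
      where
      conclude : Dec (TwoCycles (3 + κ) (Adj G)) → TwoCycleFree≥ G
      conclude (no none) = G , D , (λ sub → none (⊆⇒twoCycles G sub)) , ≤-refl
      conclude (yes two) = target⇒twoCycleFree≥ G ≤-refl (disjoint-cycles-replaceable G D free 2k<n two)

-- Equality of the two extremal numbers.

open import Data.Nat using (ℕ; _+_; _*_; _≤_)
open import Function.Bundles using (_⇔_)
open import Data.Nat using (_<_; s≤s)
open import Function.Bundles using (mk⇔)
open CyclesInGraphs
open Exchange
open import Data.Nat.Properties using (≤-trans; ≤-antisym; +-comm; +-identityʳ)

module _ (n κ : ℕ) where

  private
    k = 4 + κ

  twoCycleFree⇒pendantFree : ∀ (G : Graph n) → ¬ ((C k ⊕ C k) ⊆ G) → ¬ ((C k ⊕ C⁺ k) ⊆ G)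
  twoCycleFree⇒pendantFree G free = free ∘ twoCycles⇒⊆ G ∘ ⊆⁺⇒twoCycles G

  -- The class without two disjoint k-cycles is contained in the other, and each graph of the larger
  -- class is matched by one of the smaller with at least as many edges. So a value attained and
  -- maximal in one class is so in the other.
  extremal⇔ : k + k < n → ∀ m → IsExP n (C k ⊕ C⁺ k) m ⇔ IsExP n (C k ⊕ C k) m
  extremal⇔ 2k<n m = mk⇔
    (λ ((G , planar , free , e≡m) , max) →
      let H , planar′ , free′ , le = twoCycleFree≥ G planar free 2k<n in
      (H , planar′ , free′ , ≤-antisym (max H planar′ (twoCycleFree⇒pendantFree H free′)) (subst (_≤ edges H) e≡m le)) ,
      λ G′ planar″ free″ → max G′ planar″ (twoCycleFree⇒pendantFree G′ free″))
    (λ ((G , planar , free , e≡m) , max) →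
      (G , planar , twoCycleFree⇒pendantFree G free , e≡m) ,
      λ G′ planar′ free′ → let H , planar″ , free″ , le = twoCycleFree≥ G′ planar′ free′ 2k<n in
        ≤-trans le (max H planar″ free″))

theorem4p3 : ∀ (n k : ℕ) → 4 ≤ k → 2 * k + 1 ≤ n →
    ∀ (m : ℕ) → IsExP n (C k ⊕ C⁺ k) m ⇔ IsExP n (C k ⊕ C k) m
theorem4p3 n (suc (suc (suc (suc κ)))) (s≤s (s≤s (s≤s (s≤s _)))) 2k+1≤n m = extremal⇔ n κ
  (subst (_≤ n) (trans (+-comm (2 * (4 + κ)) 1) (cong (λ z → suc (4 + κ + z)) (+-identityʳ (4 + κ)))) 2k+1≤n) m
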